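{- Let $k$ be a field, let $g$ and $d$ be natural numbers, and suppose that $M\in\mathrm{Rep}_k(\mathcal{G}_g^{\mathrm{op}})$ is $d$-smallish. Let $G$ be a graph of genus $g$, let $r$ be a natural number, and let $\underline e=(e_1,\dots,e_r)$ be an ordered $r$-tuple of distinct directed non-loop edges of $G$. Then there exists a multivariate polynomial $f_{M,G,\underline e}(t_1,\dots,t_r)$ of total degree at most $d$ such that, if $\underline m=(m_1,\dots,m_r)$ is sufficiently large in every coordinate, $$\dim_k M(G(\underline e,\underline m))=f_{M,G,\underline e}(m_1,\dots,m_r).$$
   Context: A graph is a finite CW complex of dimension at most 1; 0-cells are vertices, 1-cells are edges (loops and multiple edges allowed). The genus of a non-empty connected graph is the rank of its first homology; a "graph of genus $g$" is always non-empty and connected. A map of CW complexes between graphs is very cellular if it takes every vertex to a vertex and every edge to either a vertex or an edge. A graph morphism is an equivalence class of very cellular maps under homotopy through very cellular maps. A contraction is a surjective graph morphism with contractible fibers (it amounts to collapsing a set of edges forming a forest, followed by a graph isomorphism). $\mathcal{G}_g$ is the category of graphs of genus $g$ with contractions as morphisms, and $\mathrm{Rep}_k(\mathcal{G}_g^{\mathrm{op}})$ is the category of functors from $\mathcal{G}_g^{\mathrm{op}}$ to $k$-modules. $M$ is finitely generated in degrees $\le d$ if there are finitely many graphs $G_1,\dots,G_s$ of genus $g$, each with at most $d$ edges, and elements $v_i\in M(G_i)$ such that for every $G$, $M(G)$ is spanned by the images of the $v_i$ under the maps $M(G_i)\to M(G)$ induced by all contractions $G\to G_i$. $M$ is $d$-small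 if it is a subquotient of a module that is finitely generated in degrees $\le d$, and $d$-smallish if it admits a (finite) filtration by submodules, $0=M_0\subset\dots\subset M_m=M$, whose associated graded module is $d$-small. For an $r$-tuple $\underline m=(m_1,\dots,m_r)$ of positive integers, $G(\underline e,\underline m)$ is the graph obtained from $G$ by subdividing each edge $e_i$ into a path of $m_i$ edges. "Sufficiently large in every coordinate" means that there is a constant $N$ such that the equality holds whenever $m_i\ge N$ for all $i$. The polynomial has rational coefficients. -}

module Defs where

open import Level using (Level; 0ℓ; _⊔_) renaming (suc to lsuc)
open import Algebra.Bundles using (Ring; CommutativeRing; CommutativeMonoid)
open import Algebra.Module.Bundles using (LeftModule)
open import Algebra.Module.Construct.TensorUnit using (leftModule)
open import Algebra.Apartness.Bundles using (HeytingCommutativeRing; HeytingField)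
import Algebra.Definitions.RawMonoid as RawMonoidDefs
import Algebra.Definitions.RawSemiring as RawSemiringDefs
import Algebra.Module.Morphism.Structures as ModuleMorphisms
import Algebra.Properties.AbelianGroup as AbelianGroupProperties
import Algebra.Properties.CommutativeSemigroup as CommutativeSemigroupProperties
import Algebra.Properties.Semiring.Sum as SemiringSum
open import Data.Fin.Base as Fin using (Fin; zero; suc; inject₁; fromℕ)
import Data.Fin.Properties as Fin
open import Data.Integer.Base as ℤ using (ℤ; 0ℤ; 1ℤ; -1ℤ)
import Data.Integer.Properties as ℤ
open import Data.Integer.Tactic.RingSolver using (solve-∀)
open import Data.List.Base using (List; foldr)
open import Data.List.Relation.Unary.All using (All)
open import Data.Nat.Base as ℕ using (ℕ; zero; suc)
import Data.Nat.Properties as ℕ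
open import Data.Product using (Σ; Σ-syntax; ∃; ∃!; _×_; _,_; proj₁; proj₂)
open import Data.Product.Function.Dependent.Propositional using (Σ-↔)
open import Data.Rational.Base as ℚ using (ℚ; 0ℚ)
open import Data.Sign.Base as Sign using (Sign)
import Data.Sign.Properties as Sign
open import Data.Sum.Base using (_⊎_; inj₁; inj₂)
open import Data.Sum.Function.Propositional using (_⊎-↔_)
open import Data.Unit.Base using (⊤; tt)
open import Function.Base using (_∘_; id)
open import Function.Bundles using (_↔_; Inverse; mk↔ₛ′)
open import Function.Definitions using (Injective)
open import Function.Properties.Inverse using (↔-refl; ↔-sym; ↔-trans; ↔⇒↣)
open import Relation.Binary.Construct.Closure.Equivalence using (EqClosure; symmetric) renaming (map to EqClosure-map)
open import Relation.Binary.Construct.Closure.ReflexiveTransitive using (ε; _◅_; _◅◅_)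
open import Relation.Binary.Construct.Closure.Symmetric using (fwd; bwd)
open import Relation.Binary.Definitions using (DecidableEquality)
open import Relation.Binary.PropositionalEquality using (_≡_; _≢_; _≗_; refl; sym; trans; cong; cong₂; subst; module ≡-Reasoning)
open import Relation.Nullary using (¬_; Dec; yes; no; contradiction)
open import Relation.Unary using (Pred)

private
  variable
    c ℓr a ℓ a′ ℓ′ : Level

module _ {R : Ring c ℓr} (M : LeftModule R a ℓ) where
  open Ring R using () renaming (Carrier to K; _≈_ to _≈ᴷ_; 0# to 0ᴷ)
  open LeftModule M

  linComb : {n : ℕ} → (Fin n → K) → (Fin n → Carrierᴹ) → Carrierᴹ
  linComb x v = RawMonoidDefs.sum +ᴹ-rawMonoid (λ i → x i *ₗ v i)

  Spans : {i : Level} {I : Set i} → (I → Carrierᴹ) → Set (c ⊔ a ⊔ ℓ ⊔ i)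
  Spans {I = I} v =
    ∀ y → Σ[ n ∈ ℕ ] Σ[ j ∈ (Fin n → I) ] Σ[ x ∈ (Fin n → K) ] y ≈ᴹ linComb x (v ∘ j)

  record IsBasis {n : ℕ} (v : Fin n → Carrierᴹ) : Set (c ⊔ ℓr ⊔ a ⊔ ℓ) where
    field
      spanning    : ∀ y → Σ[ x ∈ (Fin n → K) ] y ≈ᴹ linComb x v
      independent : ∀ x → linComb x v ≈ᴹ 0ᴹ → ∀ i → x i ≈ᴷ 0ᴷ

  -- M is free of rank n; over a field this says that dim M = n.
  HasRank : ℕ → Set (c ⊔ ℓr ⊔ a ⊔ ℓ)
  HasRank n = Σ[ v ∈ (Fin n → Carrierᴹ) ] IsBasis v

  record Submodule : Set (c ⊔ a ⊔ lsuc ℓ) where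
    field
      Mem     : Pred Carrierᴹ ℓ
      resp    : ∀ {x y} → x ≈ᴹ y → Mem x → Mem y
      0-mem   : Mem 0ᴹ
      +-mem   : ∀ {x y} → Mem x → Mem y → Mem (x +ᴹ y)
      *ₗ-mem  : ∀ r {x} → Mem x → Mem (r *ₗ x)

module _ {R : Ring c ℓr} (M : LeftModule R a ℓ) where
  open Ring R using (1#) renaming (-_ to -ᴷ_)
  open LeftModule M
  open AbelianGroupProperties +ᴹ-abelianGroup using (inverseʳ-unique; ⁻¹-∙-comm; ⁻¹-involutive)
  open CommutativeSemigroupProperties (CommutativeMonoid.commutativeSemigroup +ᴹ-commutativeMonoid) using (interchange)
  private
    module R = Ring R

    -1*ₗ : ∀ x → (-ᴷ 1#) *ₗ x ≈ᴹ -ᴹ x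
    -1*ₗ x = inverseʳ-unique x ((-ᴷ 1#) *ₗ x)
      (≈ᴹ-trans (+ᴹ-congʳ (≈ᴹ-sym (*ₗ-identityˡ x)))
      (≈ᴹ-trans (≈ᴹ-sym (*ₗ-distribʳ x 1# (-ᴷ 1#)))
      (≈ᴹ-trans (*ₗ-congʳ (R.-‿inverseʳ 1#)) (*ₗ-zeroˡ x))))

    *ₗ-neg : ∀ r x → r *ₗ (-ᴹ x) ≈ᴹ -ᴹ (r *ₗ x)
    *ₗ-neg r x = inverseʳ-unique (r *ₗ x) (r *ₗ (-ᴹ x))
      (≈ᴹ-trans (≈ᴹ-sym (*ₗ-distribˡ r x (-ᴹ x)))
      (≈ᴹ-trans (*ₗ-congˡ (-ᴹ‿inverseʳ x)) (*ₗ-zeroʳ r)))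

  neg-mem : (N : Submodule M) → ∀ {x} → Submodule.Mem N x → Submodule.Mem N (-ᴹ x)
  neg-mem N {x} p = Submodule.resp N (-1*ₗ x) (Submodule.*ₗ-mem N (-ᴷ 1#) p)

  submodule : Submodule M → LeftModule R (a ⊔ ℓ) ℓ
  submodule N = record
    { Carrierᴹ     = Σ Carrierᴹ Mem
    ; _≈ᴹ_         = λ x y → proj₁ x ≈ᴹ proj₁ y
    ; _+ᴹ_         = λ x y → proj₁ x +ᴹ proj₁ y , +-mem (proj₂ x) (proj₂ y)
    ; _*ₗ_         = λ r x → r *ₗ proj₁ x , *ₗ-mem r (proj₂ x)
    ; 0ᴹ           = 0ᴹ , 0-mem
    ; -ᴹ_          = λ x → -ᴹ proj₁ x , neg-mem N (proj₂ x)
    ; isLeftModule = record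
      { isLeftSemimodule = record
        { +ᴹ-isCommutativeMonoid = record
          { isMonoid = record
            { isSemigroup = record
              { isMagma = record
                { isEquivalence = record { refl = ≈ᴹ-refl ; sym = ≈ᴹ-sym ; trans = ≈ᴹ-trans }
                ; ∙-cong        = +ᴹ-cong
                }
              ; assoc = λ x y z → +ᴹ-assoc _ _ _
              }
            ; identity = (λ x → +ᴹ-identityˡ _) , (λ x → +ᴹ-identityʳ _)
            }
          ; comm = λ x y → +ᴹ-comm _ _
          }
        ; isPreleftSemimodule = record
          { *ₗ-cong      = *ₗ-cong
          ; *ₗ-zeroˡ     = λ x → *ₗ-zeroˡ _
          ; *ₗ-distribʳ  = λ x r s → *ₗ-distribʳ _ r s
          ; *ₗ-identityˡ = λ x → *ₗ-identityˡ _
          ; *ₗ-assoc     = λ r s x → *ₗ-assoc r s _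
          ; *ₗ-zeroʳ     = *ₗ-zeroʳ
          ; *ₗ-distribˡ  = λ r x y → *ₗ-distribˡ r _ _
          }
        }
      ; -ᴹ‿cong    = -ᴹ‿cong
      ; -ᴹ‿inverse = (λ x → -ᴹ‿inverseˡ _) , (λ x → -ᴹ‿inverseʳ _)
      }
    }
    where open Submodule N

  quotient-≈ : (N : Submodule M) → ∀ {x y} → x ≈ᴹ y → Submodule.Mem N (x +ᴹ (-ᴹ y))
  quotient-≈ N {x} {y} x≈y =
    Submodule.resp N (≈ᴹ-trans (≈ᴹ-sym (-ᴹ‿inverseʳ y)) (+ᴹ-congʳ (≈ᴹ-sym x≈y))) (Submodule.0-mem N)

  quotient : Submodule M → LeftModule R a ℓ
  quotient N = record
    { Carrierᴹ     = Carrierᴹ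
    ; _≈ᴹ_         = _~_
    ; _+ᴹ_         = _+ᴹ_
    ; _*ₗ_         = _*ₗ_
    ; 0ᴹ           = 0ᴹ
    ; -ᴹ_          = -ᴹ_
    ; isLeftModule = record
      { isLeftSemimodule = record
        { +ᴹ-isCommutativeMonoid = record
          { isMonoid = record
            { isSemigroup = record
              { isMagma = record
                { isEquivalence = record { refl = ↓ ≈ᴹ-refl ; sym = ~-sym ; trans = ~-trans }
                ; ∙-cong        = ~-+
                }
              ; assoc = λ x y z → ↓ (+ᴹ-assoc x y z)
              }
            ; identity = (λ x → ↓ (+ᴹ-identityˡ x)) , (λ x → ↓ (+ᴹ-identityʳ x))
            }
          ; comm = λ x y → ↓ (+ᴹ-comm x y)
          }
        ; isPreleftSemimodule = record
          { *ₗ-cong      = λ {r} {s} {x} {y} r≈s x~y → ~-trans (↓ (*ₗ-congʳ r≈s)) (~-* s x~y)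
          ; *ₗ-zeroˡ     = λ x → ↓ (*ₗ-zeroˡ x)
          ; *ₗ-distribʳ  = λ x r s → ↓ (*ₗ-distribʳ x r s)
          ; *ₗ-identityˡ = λ x → ↓ (*ₗ-identityˡ x)
          ; *ₗ-assoc     = λ r s x → ↓ (*ₗ-assoc r s x)
          ; *ₗ-zeroʳ     = λ r → ↓ (*ₗ-zeroʳ r)
          ; *ₗ-distribˡ  = λ r x y → ↓ (*ₗ-distribˡ r x y)
          }
        }
      ; -ᴹ‿cong    = ~-neg
      ; -ᴹ‿inverse = (λ x → ↓ (-ᴹ‿inverseˡ x)) , (λ x → ↓ (-ᴹ‿inverseʳ x))
      }
    }
    where
    open Submodule N
    _~_ : Carrierᴹ → Carrierᴹ → Set ℓ
    x ~ y = Mem (x +ᴹ (-ᴹ y))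
    ↓ : ∀ {x y} → x ≈ᴹ y → x ~ y
    ↓ = quotient-≈ N
    ~-sym : ∀ {x y} → x ~ y → y ~ x
    ~-sym {x} {y} p = resp
      (≈ᴹ-trans (≈ᴹ-sym (⁻¹-∙-comm x (-ᴹ y)))
      (≈ᴹ-trans (+ᴹ-comm _ _) (+ᴹ-congʳ (⁻¹-involutive y)))) (neg-mem N p)
    ~-trans : ∀ {x y z} → x ~ y → y ~ z → x ~ z
    ~-trans {x} {y} {z} p q = resp
      (≈ᴹ-trans (+ᴹ-assoc x (-ᴹ y) (y +ᴹ (-ᴹ z)))
      (+ᴹ-congˡ (≈ᴹ-trans (≈ᴹ-sym (+ᴹ-assoc (-ᴹ y) y (-ᴹ z)))
      (≈ᴹ-trans (+ᴹ-congʳ (-ᴹ‿inverseˡ y)) (+ᴹ-identityˡ _))))) (+-mem p q)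
    ~-+ : ∀ {x y u v} → x ~ y → u ~ v → (x +ᴹ u) ~ (y +ᴹ v)
    ~-+ {x} {y} {u} {v} p q = resp
      (≈ᴹ-trans (interchange x (-ᴹ y) u (-ᴹ v)) (+ᴹ-congˡ (⁻¹-∙-comm y v))) (+-mem p q)
    ~-* : ∀ r {x y} → x ~ y → (r *ₗ x) ~ (r *ₗ y)
    ~-* r {x} {y} p = resp
      (≈ᴹ-trans (*ₗ-distribˡ r x (-ᴹ y)) (+ᴹ-congˡ (*ₗ-neg r y))) (*ₗ-mem r p)
    ~-neg : ∀ {x y} → x ~ y → (-ᴹ x) ~ (-ᴹ y)
    ~-neg {x} {y} p = resp (≈ᴹ-sym (⁻¹-∙-comm x (-ᴹ y))) (neg-mem N p)

restrictTo : {R : Ring c ℓr} {M : LeftModule R a ℓ} (B A : Submodule M) → Submodule (submodule M B)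
restrictTo B A = record
  { Mem    = λ x → Mem (proj₁ x)
  ; resp   = resp
  ; 0-mem  = 0-mem
  ; +-mem  = +-mem
  ; *ₗ-mem = λ r → *ₗ-mem r
  }
  where open Submodule A

Πᴹ : {R : Ring c ℓr} (I : Set) → (I → LeftModule R a ℓ) → LeftModule R a ℓ
Πᴹ I M = record
  { Carrierᴹ     = ∀ i → Carrierᴹ (M i)
  ; _≈ᴹ_         = λ x y → ∀ i → _≈ᴹ_ (M i) (x i) (y i)
  ; _+ᴹ_         = λ x y i → _+ᴹ_ (M i) (x i) (y i)
  ; _*ₗ_         = λ r x i → _*ₗ_ (M i) r (x i)
  ; 0ᴹ           = λ i → 0ᴹ (M i)
  ; -ᴹ_          = λ x i → -ᴹ_ (M i) (x i)
  ; isLeftModule = record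
    { isLeftSemimodule = record
      { +ᴹ-isCommutativeMonoid = record
        { isMonoid = record
          { isSemigroup = record
            { isMagma = record
              { isEquivalence = record
                { refl  = λ i → ≈ᴹ-refl (M i)
                ; sym   = λ p i → ≈ᴹ-sym (M i) (p i)
                ; trans = λ p q i → ≈ᴹ-trans (M i) (p i) (q i)
                }
              ; ∙-cong        = λ p q i → +ᴹ-cong (M i) (p i) (q i)
              }
            ; assoc = λ x y z i → +ᴹ-assoc (M i) _ _ _
            }
          ; identity = (λ x i → +ᴹ-identityˡ (M i) _) , (λ x i → +ᴹ-identityʳ (M i) _)
          }
        ; comm = λ x y i → +ᴹ-comm (M i) _ _
        }
      ; isPreleftSemimodule = record
        { *ₗ-cong      = λ p q i → *ₗ-cong (M i) p (q i)
        ; *ₗ-zeroˡ     = λ x i → *ₗ-zeroˡ (M i) _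
        ; *ₗ-distribʳ  = λ x r s i → *ₗ-distribʳ (M i) _ r s
        ; *ₗ-identityˡ = λ x i → *ₗ-identityˡ (M i) _
        ; *ₗ-assoc     = λ r s x i → *ₗ-assoc (M i) r s _
        ; *ₗ-zeroʳ     = λ r i → *ₗ-zeroʳ (M i) r
        ; *ₗ-distribˡ  = λ r x y i → *ₗ-distribˡ (M i) r _ _
        }
      }
    ; -ᴹ‿cong    = λ p i → -ᴹ‿cong (M i) (p i)
    ; -ᴹ‿inverse = (λ x i → -ᴹ‿inverseˡ (M i) _) , (λ x i → -ᴹ‿inverseʳ (M i) _)
    }
  }
  where open LeftModule

IsLinear : {R : Ring c ℓr} (M : LeftModule R a ℓ) (N : LeftModule R a′ ℓ′) →
           (LeftModule.Carrierᴹ M → LeftModule.Carrierᴹ N) → Set (c ⊔ a ⊔ ℓ ⊔ ℓ′)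
IsLinear M N = ModuleMorphisms.LeftModuleMorphisms.IsLeftModuleHomomorphism
  (LeftModule.rawLeftModule M) (LeftModule.rawLeftModule N)

IsLinearIso : {R : Ring c ℓr} (M : LeftModule R a ℓ) (N : LeftModule R a′ ℓ′) →
              (LeftModule.Carrierᴹ M → LeftModule.Carrierᴹ N) → Set (c ⊔ a ⊔ a′ ⊔ ℓ ⊔ ℓ′)
IsLinearIso M N = ModuleMorphisms.LeftModuleMorphisms.IsLeftModuleIsomorphism
  (LeftModule.rawLeftModule M) (LeftModule.rawLeftModule N)

record Finite (A : Set) : Set where
  field
    size : ℕ
    enum : A ↔ Fin size

  _≟_ : DecidableEquality A
  _≟_ = Fin.inj⇒≟ (↔⇒↣ enum)

Fin-finite : (n : ℕ) → Finite (Fin n)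
Fin-finite n = record { size = n ; enum = ↔-refl }

open SemiringSum (CommutativeRing.semiring ℤ.+-*-commutativeRing)
  using (sum; sum-cong-≗; ∑-distrib-+; ∑-comm; *-distribˡ-sum; sum-replicate-zero)

private
  sum-single : {n : ℕ} (i : Fin n) (h : Fin n → ℤ) → (∀ j → j ≢ i → h j ≡ 0ℤ) → sum h ≡ h i
  sum-single {suc n} zero h q = trans
    (cong (ℤ._+_ (h zero)) (trans (sum-cong-≗ (λ j → q (suc j) (λ ()))) (sum-replicate-zero n)))
    (ℤ.+-identityʳ (h zero))
  sum-single {suc n} (suc i) h q = trans
    (cong₂ ℤ._+_ (q zero (λ ())) (sum-single i (h ∘ suc) (λ j j≢i → q (suc j) (j≢i ∘ Fin.suc-injective))))
    (ℤ.+-identityˡ (h (suc i)))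

-- Opaque only to help unification.
opaque
  ∑ : {A : Set} → Finite A → (A → ℤ) → ℤ
  ∑ F f = sum (f ∘ Inverse.from (Finite.enum F))

  ∑-Fin : (n : ℕ) (f : Fin n → ℤ) → ∑ (Fin-finite n) f ≡ sum f
  ∑-Fin n f = refl

  ∑-cong : {A : Set} (F : Finite A) {f g : A → ℤ} → f ≗ g → ∑ F f ≡ ∑ F g
  ∑-cong F p = sum-cong-≗ (p ∘ Inverse.from (Finite.enum F))

  ∑-0 : {A : Set} (F : Finite A) {f : A → ℤ} → (∀ x → f x ≡ 0ℤ) → ∑ F f ≡ 0ℤ
  ∑-0 F p = trans (∑-cong F p) (sum-replicate-zero (Finite.size F))

  ∑-+ : {A : Set} (F : Finite A) (f g : A → ℤ) → ∑ F (λ x → f x ℤ.+ g x) ≡ ∑ F f ℤ.+ ∑ F g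
  ∑-+ F f g = ∑-distrib-+ (f ∘ Inverse.from (Finite.enum F)) (g ∘ Inverse.from (Finite.enum F))

  ∑-*ˡ : {A : Set} (F : Finite A) (r : ℤ) (f : A → ℤ) → ∑ F (λ x → r ℤ.* f x) ≡ r ℤ.* ∑ F f
  ∑-*ˡ F r f = sym (*-distribˡ-sum r (f ∘ Inverse.from (Finite.enum F)))

  ∑-single : {A : Set} (F : Finite A) (a : A) (f : A → ℤ) → (∀ x → x ≢ a → f x ≡ 0ℤ) → ∑ F f ≡ f a
  ∑-single F a f p = trans
    (sum-single (to a) (f ∘ from) (λ i i≢ → p (from i) (λ eq → i≢ (trans (sym (strictlyInverseˡ i)) (cong to eq)))))
    (cong f (strictlyInverseʳ a))
    where open Inverse (Finite.enum F)

  ∑-swap : {A B : Set} (F : Finite A) (G : Finite B) (f : A → B → ℤ) →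
           ∑ F (λ x → ∑ G (f x)) ≡ ∑ G (λ y → ∑ F (λ x → f x y))
  ∑-swap F G f = ∑-comm (λ i j → f (Inverse.from (Finite.enum F) i) (Inverse.from (Finite.enum G) j))

δ : {A : Set} → Finite A → A → A → ℤ
δ F x y with Finite._≟_ F x y
... | yes _ = 1ℤ
... | no _  = 0ℤ

module _ {A : Set} (F : Finite A) where
  δ-≡ : ∀ {x y} → x ≡ y → δ F x y ≡ 1ℤ
  δ-≡ {x} {y} eq with Finite._≟_ F x y
  ... | yes _ = refl
  ... | no ne = contradiction eq ne

  δ-≢ : ∀ {x y} → x ≢ y → δ F x y ≡ 0ℤ
  δ-≢ {x} {y} ne with Finite._≟_ F x y
  ... | yes eq = contradiction eq ne
  ... | no _   = refl

  ∑-δ : (f : A → ℤ) (a : A) → ∑ F (λ x → f x ℤ.* δ F x a) ≡ f a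
  ∑-δ f a = trans
    (∑-single F a (λ x → f x ℤ.* δ F x a) (λ x ne → trans (cong (f x ℤ.*_) (δ-≢ ne)) (ℤ.*-zeroʳ (f x))))
    (trans (cong (f a ℤ.*_) (δ-≡ {a} refl)) (ℤ.*-identityʳ (f a)))

⊎-finite : {A B : Set} → Finite A → Finite B → Finite (A ⊎ B)
⊎-finite F G = record
  { size = Finite.size F ℕ.+ Finite.size G
  ; enum = ↔-trans (Finite.enum F ⊎-↔ Finite.enum G) (↔-sym Fin.+↔⊎)
  }

private
  total : {n : ℕ} → (Fin n → ℕ) → ℕ
  total {zero}  s = 0
  total {suc n} s = s zero ℕ.+ total (s ∘ suc)

  ΣFin↔⊎ : {n : ℕ} (P : Fin (suc n) → Set) → Σ (Fin (suc n)) P ↔ (P zero ⊎ Σ (Fin n) (P ∘ suc))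
  ΣFin↔⊎ P = mk↔ₛ′
    (λ { (zero , p) → inj₁ p ; (suc i , p) → inj₂ (i , p) })
    (λ { (inj₁ p) → zero , p ; (inj₂ (i , p)) → suc i , p })
    (λ { (inj₁ p) → refl ; (inj₂ (i , p)) → refl })
    (λ { (zero , p) → refl ; (suc i , p) → refl })

  ΣFin↔Fin : {n : ℕ} (s : Fin n → ℕ) → Σ (Fin n) (Fin ∘ s) ↔ Fin (total s)
  ΣFin↔Fin {zero}  s = mk↔ₛ′ (λ ()) (λ ()) (λ ()) (λ ())
  ΣFin↔Fin {suc n} s = ↔-trans (ΣFin↔⊎ (Fin ∘ s)) (↔-trans (↔-refl ⊎-↔ ΣFin↔Fin (s ∘ suc)) (↔-sym Fin.+↔⊎))

Σ-finite : {A : Set} {B : A → Set} → Finite A → (∀ x → Finite (B x)) → Finite (Σ A B)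
Σ-finite {A} {B} F G = record
  { size = total (λ i → Finite.size (G (from i)))
  ; enum = ↔-trans (↔-sym (Σ-↔ (↔-sym (Finite.enum F)) (λ {i} → ↔-sym (Finite.enum (G (from i))))))
                   (ΣFin↔Fin (λ i → Finite.size (G (from i))))
  }
  where open Inverse (Finite.enum F) using (from)

∑-Σ : {A : Set} {B : A → Set} (F : Finite A) (G : ∀ x → Finite (B x)) (H : Finite (Σ A B)) (f : Σ A B → ℤ) →
      ∑ H f ≡ ∑ F (λ x → ∑ (G x) (λ y → f (x , y)))
∑-Σ {A} {B} F G H f = begin
  ∑ H f                                                        ≡⟨ ∑-cong H (λ z → sym (inner z)) ⟩
  ∑ H (λ z → ∑ F (λ x → ∑ (G x) (λ y → k z (x , y))))          ≡⟨ ∑-swap H F _ ⟩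
  ∑ F (λ x → ∑ H (λ z → ∑ (G x) (λ y → k z (x , y))))          ≡⟨ ∑-cong F (λ x → ∑-swap H (G x) _) ⟩
  ∑ F (λ x → ∑ (G x) (λ y → ∑ H (λ z → k z (x , y))))          ≡⟨ ∑-cong F (λ x → ∑-cong (G x) (λ y → ∑-δ H f (x , y))) ⟩
  ∑ F (λ x → ∑ (G x) (λ y → f (x , y)))                        ∎
  where
  open ≡-Reasoning
  k : Σ A B → Σ A B → ℤ
  k z w = f z ℤ.* δ H z w
  k-0 : ∀ z w → z ≢ w → k z w ≡ 0ℤ
  k-0 z w ne = trans (cong (f z ℤ.*_) (δ-≢ H ne)) (ℤ.*-zeroʳ (f z))
  k-1 : ∀ z → k z z ≡ f z
  k-1 z = trans (cong (f z ℤ.*_) (δ-≡ H {z} refl)) (ℤ.*-identityʳ (f z))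
  inner : ∀ z → ∑ F (λ x → ∑ (G x) (λ y → k z (x , y))) ≡ f z
  inner (a , b) = trans
    (∑-single F a _ (λ x ne → ∑-0 (G x) (λ y → k-0 (a , b) (x , y) (λ eq → ne (sym (cong proj₁ eq))))))
    (trans (∑-single (G a) b _ (λ y ne → k-0 (a , b) (a , y) (λ { refl → ne refl }))) (k-1 (a , b)))

-- The reference orientation given by src and tgt is a choice of
-- characteristic map for each 1-cell.  It carries no information:
-- morphisms need not respect it.
record Graph : Set₁ where
  field
    V E      : Set
    V-finite : Finite V
    E-finite : Finite E
    src tgt  : E → V

  #E : ℕ
  #E = Finite.size E-finite

  DirectedEdge : Set
  DirectedEdge = E × Sign

  tail head : DirectedEdge → V
  tail (e , Sign.+) = src e
  tail (e , Sign.-) = tgt e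
  head (e , Sign.+) = tgt e
  head (e , Sign.-) = src e

  -- The image of an edge under a very cellular map, up to homotopy: a vertex,
  -- or an edge traversed once in one of two directions.  The endpoints
  -- determine the direction unless the image is a loop, whose two directions
  -- are not homotopic.  Winding several times around a loop is left out: such
  -- a map never has contractible fibres.
  Cell : Set
  Cell = V ⊎ DirectedEdge

  start end : Cell → V
  start (inj₁ v) = v
  start (inj₂ d) = tail d
  end (inj₁ v) = v
  end (inj₂ d) = head d

  act : Sign → Cell → Cell
  act s (inj₁ v)       = inj₁ v
  act s (inj₂ (e , t)) = inj₂ (e , s Sign.* t)

  start-act : ∀ x → start (act Sign.- x) ≡ end x
  start-act (inj₁ v)            = refl
  start-act (inj₂ (e , Sign.+)) = refl
  start-act (inj₂ (e , Sign.-)) = refl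

  end-act : ∀ x → end (act Sign.- x) ≡ start x
  end-act (inj₁ v)            = refl
  end-act (inj₂ (e , Sign.+)) = refl
  end-act (inj₂ (e , Sign.-)) = refl

  act-+ : ∀ x → act Sign.+ x ≡ x
  act-+ (inj₁ v) = refl
  act-+ (inj₂ d) = refl

  Chain₁ : LeftModule ℤ.+-*-ring 0ℓ 0ℓ
  Chain₁ = Πᴹ E (λ _ → leftModule)

  ∂ : (E → ℤ) → V → ℤ
  ∂ c v = ∑ E-finite (λ e → c e ℤ.* (δ V-finite v (tgt e) ℤ.- δ V-finite v (src e)))

  -- ⟨ ∂ c , φ ⟩ computed on edges.
  ⟨∂_,_⟩ : (E → ℤ) → (V → ℤ) → ℤ
  ⟨∂ c , φ ⟩ = ∑ E-finite (λ e → c e ℤ.* (φ (tgt e) ℤ.- φ (src e)))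

  cycle⇒pairing : (c : E → ℤ) → (∀ v → ∂ c v ≡ 0ℤ) → ∀ φ → ⟨∂ c , φ ⟩ ≡ 0ℤ
  cycle⇒pairing c ∂c φ = begin
    ∑ E-finite (λ e → c e ℤ.* (φ (tgt e) ℤ.- φ (src e)))                  ≡⟨ ∑-cong E-finite (λ e → cong (c e ℤ.*_) (sym (evaluate (tgt e) (src e)))) ⟩
    ∑ E-finite (λ e → c e ℤ.* ∑ V-finite (λ v → φ v ℤ.* D v e))           ≡⟨ ∑-cong E-finite (λ e → sym (∑-*ˡ V-finite (c e) _)) ⟩
    ∑ E-finite (λ e → ∑ V-finite (λ v → c e ℤ.* (φ v ℤ.* D v e)))         ≡⟨ ∑-swap E-finite V-finite _ ⟩
    ∑ V-finite (λ v → ∑ E-finite (λ e → c e ℤ.* (φ v ℤ.* D v e)))         ≡⟨ ∑-cong V-finite (λ v → ∑-cong E-finite (λ e → left-comm (c e) (φ v) (D v e))) ⟩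
    ∑ V-finite (λ v → ∑ E-finite (λ e → φ v ℤ.* (c e ℤ.* D v e)))         ≡⟨ ∑-cong V-finite (λ v → ∑-*ˡ E-finite (φ v) _) ⟩
    ∑ V-finite (λ v → φ v ℤ.* ∂ c v)                                      ≡⟨ ∑-0 V-finite (λ v → trans (cong (φ v ℤ.*_) (∂c v)) (ℤ.*-zeroʳ (φ v))) ⟩
    0ℤ                                                                    ∎
    where
    open ≡-Reasoning
    D : V → E → ℤ
    D v e = δ V-finite v (tgt e) ℤ.- δ V-finite v (src e)
    left-comm : ∀ x y z → x ℤ.* (y ℤ.* z) ≡ y ℤ.* (x ℤ.* z)
    left-comm = solve-∀
    split : ∀ x y z → x ℤ.* (y ℤ.- z) ≡ x ℤ.* y ℤ.+ -1ℤ ℤ.* (x ℤ.* z)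
    split = solve-∀
    join : ∀ x y → x ℤ.+ -1ℤ ℤ.* y ≡ x ℤ.- y
    join = solve-∀
    evaluate : ∀ t s → ∑ V-finite (λ v → φ v ℤ.* (δ V-finite v t ℤ.- δ V-finite v s)) ≡ φ t ℤ.- φ s
    evaluate t s = begin
      ∑ V-finite (λ v → φ v ℤ.* (δ V-finite v t ℤ.- δ V-finite v s))                           ≡⟨ ∑-cong V-finite (λ v → split (φ v) _ _) ⟩
      ∑ V-finite (λ v → φ v ℤ.* δ V-finite v t ℤ.+ -1ℤ ℤ.* (φ v ℤ.* δ V-finite v s))           ≡⟨ ∑-+ V-finite _ _ ⟩
      ∑ V-finite (λ v → φ v ℤ.* δ V-finite v t) ℤ.+ ∑ V-finite (λ v → -1ℤ ℤ.* (φ v ℤ.* δ V-finite v s)) ≡⟨ cong₂ ℤ._+_ (∑-δ V-finite φ t) (trans (∑-*ˡ V-finite -1ℤ _) (cong (-1ℤ ℤ.*_) (∑-δ V-finite φ s))) ⟩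
      φ t ℤ.+ -1ℤ ℤ.* φ s                                                                      ≡⟨ join (φ t) (φ s) ⟩
      φ t ℤ.- φ s                                                                              ∎

  pairing⇒cycle : (c : E → ℤ) → (∀ φ → ⟨∂ c , φ ⟩ ≡ 0ℤ) → ∀ v → ∂ c v ≡ 0ℤ
  pairing⇒cycle c p v = p (δ V-finite v)

  ∂-+ : ∀ c c′ v → ∂ (λ e → c e ℤ.+ c′ e) v ≡ ∂ c v ℤ.+ ∂ c′ v
  ∂-+ c c′ v = trans (∑-cong E-finite (λ e → ℤ.*-distribʳ-+ _ (c e) (c′ e))) (∑-+ E-finite _ _)

  ∂-* : ∀ r c v → ∂ (λ e → r ℤ.* c e) v ≡ r ℤ.* ∂ c v
  ∂-* r c v = trans (∑-cong E-finite (λ e → ℤ.*-assoc r (c e) _)) (∑-*ˡ E-finite r _)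

record Subgraph (G : Graph) : Set₁ where
  open Graph G
  field
    inV     : V → Set
    inE     : E → Set
    src-inV : ∀ {e} → inE e → inV (src e)
    tgt-inV : ∀ {e} → inE e → inV (tgt e)

  -- A graph has no 2-cells, so H₁ = ker ∂.
  cycles : Submodule Chain₁
  cycles = record
    { Mem    = λ c → (∀ v → ∂ c v ≡ 0ℤ) × (∀ e → ¬ inE e → c e ≡ 0ℤ)
    ; resp   = λ {c} {c′} eq (p , q) →
        (λ v → trans (∑-cong E-finite (λ e → cong (ℤ._* _) (sym (eq e)))) (p v)) , (λ e ne → trans (sym (eq e)) (q e ne))
    ; 0-mem  = (λ v → ∑-0 E-finite (λ e → ℤ.*-zeroˡ (δ V-finite v (tgt e) ℤ.- δ V-finite v (src e)))) , (λ e _ → refl)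
    ; +-mem  = λ {c} {c′} (p , q) (p′ , q′) →
        (λ v → trans (∂-+ c c′ v) (cong₂ ℤ._+_ (p v) (p′ v))) , (λ e ne → cong₂ ℤ._+_ (q e ne) (q′ e ne))
    ; *ₗ-mem = λ r {c} (p , q) →
        (λ v → trans (∂-* r c v) (trans (cong (r ℤ.*_) (p v)) (ℤ.*-zeroʳ r))) , (λ e ne → trans (cong (r ℤ.*_) (q e ne)) (ℤ.*-zeroʳ r))
    }

  H₁ : LeftModule ℤ.+-*-ring 0ℓ 0ℓ
  H₁ = submodule Chain₁ cycles

  Adjacent : V → V → Set
  Adjacent u v = Σ[ e ∈ E ] inE e × src e ≡ u × tgt e ≡ v

  record IsConnected : Set where
    field
      nonEmpty : ∃ inV
      path     : ∀ {u v} → inV u → inV v → EqClosure Adjacent u v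

  -- A 1-dimensional complex is contractible iff it is connected with
  -- vanishing first homology, i.e. a tree.
  record IsContractible : Set where
    field
      isConnected : IsConnected
      acyclic     : HasRank H₁ 0

whole : (G : Graph) → Subgraph G
whole G = record { inV = λ _ → ⊤ ; inE = λ _ → ⊤ ; src-inV = λ _ → tt ; tgt-inV = λ _ → tt }

record HasGenus (g : ℕ) (G : Graph) : Set where
  field
    isConnected : Subgraph.IsConnected (whole G)
    rank        : HasRank (Subgraph.H₁ (whole G)) g

record GenusGraph (g : ℕ) : Set₁ where
  field
    graph    : Graph
    hasGenus : HasGenus g graph

module _ {G : Graph} (S : Subgraph G) where
  open Graph G using (E; ∂)
  open Subgraph S

  rank-0⇒trivial : HasRank H₁ 0 → (c : E → ℤ) → (∀ v → ∂ c v ≡ 0ℤ) → (∀ e → ¬ inE e → c e ≡ 0ℤ) → ∀ e → c e ≡ 0ℤ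
  rank-0⇒trivial (_ , basis) c p q = proj₂ (IsBasis.spanning basis (c , p , q))

  trivial⇒rank-0 : (∀ (c : E → ℤ) → (∀ v → ∂ c v ≡ 0ℤ) → (∀ e → ¬ inE e → c e ≡ 0ℤ) → ∀ e → c e ≡ 0ℤ) → HasRank H₁ 0
  trivial⇒rank-0 h = (λ ()) , record
    { spanning    = λ (c , p , q) → (λ ()) , h c p q
    ; independent = λ _ _ ()
    }

record Morphism (G H : Graph) : Set where
  private
    module G = Graph G
    module H = Graph H
  field
    onV     : G.V → H.V
    onE     : G.E → H.Cell
    onE-src : ∀ e → H.start (onE e) ≡ onV (G.src e)
    onE-tgt : ∀ e → H.end (onE e) ≡ onV (G.tgt e)

  onCell : G.Cell → H.Cell
  onCell (inj₁ v)       = inj₁ (onV v)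
  onCell (inj₂ (e , s)) = H.act s (onE e)

  MapsOnto : G.E → H.E → Set
  MapsOnto e e′ = Σ[ s ∈ Sign ] onE e ≡ inj₂ (e′ , s)

  fibre : H.V → Subgraph G
  fibre w = record
    { inV     = λ v → onV v ≡ w
    ; inE     = λ e → onE e ≡ inj₁ w
    ; src-inV = λ {e} p → trans (sym (onE-src e)) (cong H.start p)
    ; tgt-inV = λ {e} p → trans (sym (onE-tgt e)) (cong H.end p)
    }

  -- The fibre over an interior point of an edge e′ is discrete, with one
  -- point for each edge mapped onto e′, so it is contractible iff there is
  -- exactly one such edge.
  record IsContraction : Set where
    field
      edgeFibre   : ∀ e′ → ∃! _≡_ (λ e → MapsOnto e e′)
      vertexFibre : ∀ w → Subgraph.IsContractible (fibre w)

record _≗ᴹ_ {G H : Graph} (f f′ : Morphism G H) : Set where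
  field
    onV-≗ : Morphism.onV f ≗ Morphism.onV f′
    onE-≗ : Morphism.onE f ≗ Morphism.onE f′

idᴹ : (G : Graph) → Morphism G G
idᴹ G = record
  { onV     = id
  ; onE     = λ e → inj₂ (e , Sign.+)
  ; onE-src = λ _ → refl
  ; onE-tgt = λ _ → refl
  }

infixr 9 _∘ᴹ_

_∘ᴹ_ : {G H K : Graph} → Morphism H K → Morphism G H → Morphism G K
_∘ᴹ_ {G} {H} {K} g f = record
  { onV     = g.onV ∘ f.onV
  ; onE     = g.onCell ∘ f.onE
  ; onE-src = λ e → trans (start-onCell (f.onE e)) (cong g.onV (f.onE-src e))
  ; onE-tgt = λ e → trans (end-onCell (f.onE e)) (cong g.onV (f.onE-tgt e))
  }
  where
  module f = Morphism f
  module H = Graph H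
  module K = Graph K
  module g = Morphism g
  start-onCell : ∀ x → K.start (g.onCell x) ≡ g.onV (H.start x)
  start-onCell (inj₁ v)            = refl
  start-onCell (inj₂ (e , Sign.+)) = trans (cong K.start (K.act-+ (g.onE e))) (g.onE-src e)
  start-onCell (inj₂ (e , Sign.-)) = trans (K.start-act (g.onE e)) (g.onE-tgt e)
  end-onCell : ∀ x → K.end (g.onCell x) ≡ g.onV (H.end x)
  end-onCell (inj₁ v)            = refl
  end-onCell (inj₂ (e , Sign.+)) = trans (cong K.end (K.act-+ (g.onE e))) (g.onE-tgt e)
  end-onCell (inj₂ (e , Sign.-)) = trans (K.end-act (g.onE e)) (g.onE-src e)

id-isContraction : (G : Graph) → Morphism.IsContraction (idᴹ G)
id-isContraction G = record
  { edgeFibre   = λ e → e , (Sign.+ , refl) , λ { (s , refl) → refl }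
  ; vertexFibre = λ w → record
    { isConnected = record
      { nonEmpty = w , refl
      ; path     = λ { refl refl → ε }
      }
    ; acyclic = trivial⇒rank-0 (Morphism.fibre (idᴹ G) w) (λ c _ q e → q e (λ ()))
    }
  }

module _ {G H : Graph} (f : Morphism G H) where
  open Morphism f
  private
    module G = Graph G
    module H = Graph H

    sgn : Sign → ℤ
    sgn Sign.+ = 1ℤ
    sgn Sign.- = -1ℤ

    coeff : H.Cell → H.E → ℤ
    coeff (inj₁ v)       e′ = 0ℤ
    coeff (inj₂ (e , s)) e′ = sgn s ℤ.* δ H.E-finite e′ e

    ∑-*ʳ : {A : Set} (F : Finite A) (h : A → ℤ) (r : ℤ) → ∑ F h ℤ.* r ≡ ∑ F (λ x → h x ℤ.* r)
    ∑-*ʳ F h r = trans (ℤ.*-comm (∑ F h) r) (trans (sym (∑-*ˡ F r h)) (∑-cong F (λ x → ℤ.*-comm r (h x))))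

    rearrange : ∀ x y z → x ℤ.* y ℤ.* z ≡ y ℤ.* (z ℤ.* x)
    rearrange = solve-∀

    negate : ∀ x y → -1ℤ ℤ.* (x ℤ.- y) ≡ y ℤ.- x
    negate = solve-∀

    dsum : (φ : H.V → ℤ) (x : H.Cell) → ∑ H.E-finite (λ e′ → coeff x e′ ℤ.* (φ (H.tgt e′) ℤ.- φ (H.src e′))) ≡ φ (H.end x) ℤ.- φ (H.start x)
    dsum φ (inj₁ v) = trans (∑-0 H.E-finite (λ e′ → refl)) (sym (ℤ.+-inverseʳ (φ v)))
    dsum φ (inj₂ (e , s)) = trans (∑-cong H.E-finite (λ e′ → rearrange (sgn s) (δ H.E-finite e′ e) (dφ e′)))
      (trans (∑-cong H.E-finite (λ e′ → trans (ℤ.*-comm (δ H.E-finite e′ e) (dφ e′ ℤ.* sgn s)) (trans (cong (ℤ._* δ H.E-finite e′ e) (ℤ.*-comm (dφ e′) (sgn s))) refl)))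
      (trans (∑-δ H.E-finite (λ e′ → sgn s ℤ.* dφ e′) e) (ends s)))
      where
      dφ : H.E → ℤ
      dφ e′ = φ (H.tgt e′) ℤ.- φ (H.src e′)
      ends : ∀ s → sgn s ℤ.* dφ e ≡ φ (H.head (e , s)) ℤ.- φ (H.tail (e , s))
      ends Sign.+ = ℤ.*-identityˡ (dφ e)
      ends Sign.- = negate (φ (H.tgt e)) (φ (H.src e))

  pushforward : (G.E → ℤ) → H.E → ℤ
  pushforward c e′ = ∑ G.E-finite (λ e → c e ℤ.* coeff (onE e) e′)

  pushforward-pairing : (c : G.E → ℤ) (φ : H.V → ℤ) → H.⟨∂ pushforward c , φ ⟩ ≡ G.⟨∂ c , φ ∘ onV ⟩
  pushforward-pairing c φ = begin
    ∑ H.E-finite (λ e′ → pushforward c e′ ℤ.* dφ e′)                                  ≡⟨ ∑-cong H.E-finite (λ e′ → ∑-*ʳ G.E-finite _ (dφ e′)) ⟩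
    ∑ H.E-finite (λ e′ → ∑ G.E-finite (λ e → c e ℤ.* coeff (onE e) e′ ℤ.* dφ e′))     ≡⟨ ∑-swap H.E-finite G.E-finite _ ⟩
    ∑ G.E-finite (λ e → ∑ H.E-finite (λ e′ → c e ℤ.* coeff (onE e) e′ ℤ.* dφ e′))     ≡⟨ ∑-cong G.E-finite (λ e → ∑-cong H.E-finite (λ e′ → ℤ.*-assoc (c e) (coeff (onE e) e′) (dφ e′))) ⟩
    ∑ G.E-finite (λ e → ∑ H.E-finite (λ e′ → c e ℤ.* (coeff (onE e) e′ ℤ.* dφ e′)))   ≡⟨ ∑-cong G.E-finite (λ e → ∑-*ˡ H.E-finite (c e) _) ⟩
    ∑ G.E-finite (λ e → c e ℤ.* ∑ H.E-finite (λ e′ → coeff (onE e) e′ ℤ.* dφ e′))     ≡⟨ ∑-cong G.E-finite (λ e → cong (c e ℤ.*_) (dsum φ (onE e))) ⟩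
    ∑ G.E-finite (λ e → c e ℤ.* (φ (H.end (onE e)) ℤ.- φ (H.start (onE e))))              ≡⟨ ∑-cong G.E-finite (λ e → cong₂ (λ x y → c e ℤ.* (φ x ℤ.- φ y)) (onE-tgt e) (onE-src e)) ⟩
    ∑ G.E-finite (λ e → c e ℤ.* (φ (onV (G.tgt e)) ℤ.- φ (onV (G.src e))))            ∎
    where
    open ≡-Reasoning
    dφ : H.E → ℤ
    dφ e′ = φ (H.tgt e′) ℤ.- φ (H.src e′)

  module _ (isC : IsContraction) where
    open IsContraction isC

    private
      coeff-≢ : ∀ x {e′} → (∀ s → x ≢ inj₂ (e′ , s)) → coeff x e′ ≡ 0ℤ
      coeff-≢ (inj₁ v) _ = refl
      coeff-≢ (inj₂ (e , s)) {e′} ne =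
        trans (cong (sgn s ℤ.*_) (δ-≢ H.E-finite {e′} {e} (λ { refl → ne s refl }))) (ℤ.*-zeroʳ (sgn s))

      cancel : ∀ s x → x ℤ.* (sgn s ℤ.* 1ℤ) ≡ 0ℤ → x ≡ 0ℤ
      cancel Sign.+ x p = trans (sym (ℤ.*-identityʳ x)) p
      cancel Sign.- x p = trans (sym (neg-neg x)) (cong ℤ.-_ p)
        where
        neg-neg : ∀ x → ℤ.- (x ℤ.* (-1ℤ ℤ.* 1ℤ)) ≡ x
        neg-neg = solve-∀

    pushforward-outside : ∀ c e′ → (∀ e → MapsOnto e e′ → c e ≡ 0ℤ) → pushforward c e′ ≡ 0ℤ
    pushforward-outside c e′ h = ∑-0 G.E-finite (λ e → term e (onE e) refl)
      where
      term : ∀ e x → onE e ≡ x → c e ℤ.* coeff (onE e) e′ ≡ 0ℤ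
      term e (inj₁ v) eq = trans (cong (λ x → c e ℤ.* coeff x e′) eq) (ℤ.*-zeroʳ (c e))
      term e (inj₂ (e″ , s)) eq with Finite._≟_ H.E-finite e″ e′
      ... | yes refl = trans (cong (ℤ._* coeff (onE e) e′) (h e (s , eq))) (ℤ.*-zeroˡ (coeff (onE e) e′))
      ... | no ne    = trans (cong (c e ℤ.*_) (coeff-≢ (onE e) (λ t eq′ → ne (inj₂-edge (trans (sym eq) eq′))))) (ℤ.*-zeroʳ (c e))
        where
        inj₂-edge : ∀ {t} → _≡_ {A = H.Cell} (inj₂ (e″ , s)) (inj₂ (e′ , t)) → e″ ≡ e′
        inj₂-edge refl = refl

    pushforward-zero : ∀ c {e e′} → MapsOnto e e′ → pushforward c e′ ≡ 0ℤ → c e ≡ 0ℤ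
    pushforward-zero c {e} {e′} (s , eq) p = cancel s (c e) (trans (sym (trans
      (∑-single G.E-finite e (λ e₁ → c e₁ ℤ.* coeff (onE e₁) e′) others)
      (trans (cong (λ x → c e ℤ.* coeff x e′) eq) (cong (λ x → c e ℤ.* (sgn s ℤ.* x)) (δ-≡ H.E-finite {e′} refl))))) p)
      where
      unique : ∀ e₁ → MapsOnto e₁ e′ → e₁ ≡ e
      unique e₁ m = trans (sym (proj₂ (proj₂ (edgeFibre e′)) m)) (proj₂ (proj₂ (edgeFibre e′)) (s , eq))
      others : ∀ e₁ → e₁ ≢ e → c e₁ ℤ.* coeff (onE e₁) e′ ≡ 0ℤ
      others e₁ ne = trans (cong (c e₁ ℤ.*_) (coeff-≢ (onE e₁) (λ t m → ne (unique e₁ (t , m))))) (ℤ.*-zeroʳ (c e₁))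

    -- A cycle supported on collapsed edges vanishes.
    collapsed-acyclic : (c : G.E → ℤ) → (∀ v → G.∂ c v ≡ 0ℤ) → (∀ {e e′} → MapsOnto e e′ → c e ≡ 0ℤ) → ∀ e → c e ≡ 0ℤ
    collapsed-acyclic c ∂c supp e = by (onE e) refl
      where
      by : ∀ x → onE e ≡ x → c e ≡ 0ℤ
      by (inj₂ (e′ , s)) eq = supp (s , eq)
      by (inj₁ w) eq = trans (sym (at-inside eq)) (zero-w e)
        where
        _∈?_ : (x : H.Cell) (w : H.V) → Dec (x ≡ inj₁ w)
        inj₁ v ∈? w with Finite._≟_ H.V-finite v w
        ... | yes refl = yes refl
        ... | no ne    = no (λ { refl → ne refl })
        inj₂ d ∈? w = no (λ ())
        keepIf : {P : Set} → Dec P → ℤ → ℤ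
        keepIf (yes _) z = z
        keepIf (no _)  z = 0ℤ
        c-w : G.E → ℤ
        c-w e = keepIf (onE e ∈? w) (c e)
        at-inside : ∀ {e} → onE e ≡ inj₁ w → c-w e ≡ c e
        at-inside {e} eq with onE e ∈? w
        ... | yes _ = refl
        ... | no ne = contradiction eq ne
        at-outside : ∀ e → ¬ (onE e ≡ inj₁ w) → c-w e ≡ 0ℤ
        at-outside e ne with onE e ∈? w
        ... | yes eq = contradiction eq ne
        ... | no _   = refl
        cut : (G.V → ℤ) → G.V → ℤ
        cut φ v = keepIf (Finite._≟_ H.V-finite (onV v) w) (φ v)
        cut-in : ∀ φ {v} → onV v ≡ w → cut φ v ≡ φ v
        cut-in φ {v} eq with Finite._≟_ H.V-finite (onV v) w
        ... | yes _ = refl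
        ... | no ne = contradiction eq ne
        cut-out : ∀ φ {v} → onV v ≢ w → cut φ v ≡ 0ℤ
        cut-out φ {v} ne with Finite._≟_ H.V-finite (onV v) w
        ... | yes eq = contradiction eq ne
        ... | no _   = refl
        termwise : ∀ φ e → c-w e ℤ.* (φ (G.tgt e) ℤ.- φ (G.src e)) ≡ c e ℤ.* (cut φ (G.tgt e) ℤ.- cut φ (G.src e))
        termwise φ e = on (onE e) refl
          where
          on : ∀ x → onE e ≡ x → c-w e ℤ.* (φ (G.tgt e) ℤ.- φ (G.src e)) ≡ c e ℤ.* (cut φ (G.tgt e) ℤ.- cut φ (G.src e))
          on (inj₂ (e′ , s)) eq = trans
            (cong (ℤ._* (φ (G.tgt e) ℤ.- φ (G.src e))) (at-outside e (λ eq′ → contradiction (trans (sym eq) eq′) (λ ()))))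
            (sym (cong (ℤ._* (cut φ (G.tgt e) ℤ.- cut φ (G.src e))) (supp (s , eq))))
          on (inj₁ u) eq with Finite._≟_ H.V-finite u w
          ... | yes refl = cong₂ ℤ._*_ (at-inside eq) (sym (cong₂ ℤ._-_
                  (cut-in φ (trans (sym (onE-tgt e)) (cong H.end eq)))
                  (cut-in φ (trans (sym (onE-src e)) (cong H.start eq)))))
          ... | no ne    = trans
                  (cong (ℤ._* (φ (G.tgt e) ℤ.- φ (G.src e))) (at-outside e (λ eq′ → ne (cong H.start (trans (sym eq) eq′)))))
                  (sym (trans (cong (c e ℤ.*_) (cong₂ ℤ._-_
                    (cut-out φ (λ t → ne (trans (trans (sym (cong H.end eq)) (onE-tgt e)) t)))
                    (cut-out φ (λ t → ne (trans (trans (sym (cong H.start eq)) (onE-src e)) t)))))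
                    (ℤ.*-zeroʳ (c e))))
        zero-w : ∀ e → c-w e ≡ 0ℤ
        zero-w = rank-0⇒trivial (fibre w) (Subgraph.IsContractible.acyclic (vertexFibre w)) c-w
          (G.pairing⇒cycle c-w (λ φ → trans (∑-cong G.E-finite (termwise φ)) (G.cycle⇒pairing c ∂c (cut φ))))
          at-outside

∘-isContraction : {G H K : Graph} {g : Morphism H K} {f : Morphism G H} →
                  Morphism.IsContraction g → Morphism.IsContraction f → Morphism.IsContraction (g ∘ᴹ f)
∘-isContraction {G} {H} {K} {g} {f} isG isF = record { edgeFibre = edge ; vertexFibre = vertex }
  where
  module f = Morphism f
  module g = Morphism g
  module gf = Morphism (g ∘ᴹ f)
  module F = Morphism.IsContraction isF
  module C = Morphism.IsContraction isG
  module GG = Graph G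
  module HH = Graph H
  module KK = Graph K

  act-inj₂ : ∀ s (x : KK.Cell) {e s′} → KK.act s x ≡ inj₂ (e , s′) → Σ[ t ∈ Sign ] x ≡ inj₂ (e , t)
  act-inj₂ s (inj₂ (e , t)) refl = t , refl

  act-inj₁ : ∀ s (x : KK.Cell) {w} → KK.act s x ≡ inj₁ w → x ≡ inj₁ w
  act-inj₁ s (inj₁ w) refl = refl

  factor : ∀ {e e″} → gf.MapsOnto e e″ → Σ[ e′ ∈ HH.E ] f.MapsOnto e e′ × g.MapsOnto e′ e″
  factor {e} {e″} (s , eq) = go (f.onE e) refl eq
    where
    go : ∀ x → f.onE e ≡ x → g.onCell x ≡ inj₂ (e″ , s) → Σ[ e′ ∈ HH.E ] f.MapsOnto e e′ × g.MapsOnto e′ e″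
    go (inj₂ (e′ , t)) p q = e′ , (t , p) , act-inj₂ t (g.onE e′) q

  edge : ∀ e″ → ∃! _≡_ (λ e → gf.MapsOnto e e″)
  edge e″ with C.edgeFibre e″
  ... | e′ , (t , p) , unique′ with F.edgeFibre e′
  ... | e , (s , q) , unique =
    e , (s Sign.* t , trans (cong g.onCell q) (cong (KK.act s) p)) , λ m → unique (transport m)
    where
    transport : ∀ {e₁} → gf.MapsOnto e₁ e″ → f.MapsOnto e₁ e′
    transport m with factor m
    ... | e₂ , m₁ , m₂ = subst (f.MapsOnto _) (sym (unique′ m₂)) m₁

  module _ (w : Graph.V K) where
    module S = Subgraph (gf.fibre w)
    module T = Subgraph (g.fibre w)

    Connects : GG.V → GG.V → Set
    Connects = EqClosure S.Adjacent

    within : ∀ {u v x} → g.onV x ≡ w → f.onV u ≡ x → f.onV v ≡ x → Connects u v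
    within {x = x} gx p q = EqClosure-map include (Subgraph.IsConnected.path (Subgraph.IsContractible.isConnected (F.vertexFibre x)) p q)
      where
      include : ∀ {u v} → Subgraph.Adjacent (f.fibre x) u v → S.Adjacent u v
      include (e , eq , ends) = e , trans (cong g.onCell eq) (cong inj₁ gx) , ends

    cross : ∀ e′ → g.onE e′ ≡ inj₁ w → Σ[ p ∈ GG.V ] Σ[ q ∈ GG.V ] f.onV p ≡ HH.src e′ × f.onV q ≡ HH.tgt e′ × Connects p q
    cross e′ eq with F.edgeFibre e′
    ... | e , (Sign.+ , m) , _ =
      GG.src e , GG.tgt e , trans (sym (f.onE-src e)) (cong HH.start m) , trans (sym (f.onE-tgt e)) (cong HH.end m) ,
      fwd (e , trans (cong g.onCell m) (cong (KK.act Sign.+) eq) , refl , refl) ◅ ε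
    ... | e , (Sign.- , m) , _ =
      GG.tgt e , GG.src e , trans (sym (f.onE-tgt e)) (cong HH.end m) , trans (sym (f.onE-src e)) (cong HH.start m) ,
      bwd (e , trans (cong g.onCell m) (cong (KK.act Sign.-) eq) , refl , refl) ◅ ε

    lift : ∀ {x y u v} → EqClosure T.Adjacent x y → f.onV u ≡ x → f.onV v ≡ y → g.onV x ≡ w → Connects u v
    lift ε p q gx = within gx p q
    lift (fwd (e′ , eq , refl , refl) ◅ rest) p q gx with cross e′ eq
    ... | a , b , fa , fb , ab = within gx p fa ◅◅ ab ◅◅ lift rest fb q (T.tgt-inV eq)
    lift (bwd (e′ , eq , refl , refl) ◅ rest) p q gx with cross e′ eq
    ... | a , b , fa , fb , ab = within gx p fb ◅◅ symmetric S.Adjacent ab ◅◅ lift rest fa q (T.src-inV eq)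

    nonEmpty : ∃ S.inV
    nonEmpty with Subgraph.IsConnected.nonEmpty (Subgraph.IsContractible.isConnected (C.vertexFibre w))
    ... | x , gx with Subgraph.IsConnected.nonEmpty (Subgraph.IsContractible.isConnected (F.vertexFibre x))
    ... | v , fv = v , trans (cong g.onV fv) gx

    acyclic : (c : GG.E → ℤ) → (∀ v → GG.∂ c v ≡ 0ℤ) → (∀ e → ¬ S.inE e → c e ≡ 0ℤ) → ∀ e → c e ≡ 0ℤ
    acyclic c ∂c supp = collapsed-acyclic f isF c ∂c (λ {e} {e′} m → pushforward-zero f isF c m (pushed e′))
      where
      pushed : ∀ e′ → pushforward f c e′ ≡ 0ℤ
      pushed = rank-0⇒trivial (g.fibre w) (Subgraph.IsContractible.acyclic (C.vertexFibre w)) (pushforward f c)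
        (HH.pairing⇒cycle (pushforward f c) (λ φ → trans (pushforward-pairing f c φ) (GG.cycle⇒pairing c ∂c (φ ∘ f.onV))))
        (λ e′ ne → pushforward-outside f isF c e′ (λ e (s , m) → supp e (λ eq →
          ne (act-inj₁ s (g.onE e′) (trans (sym (cong g.onCell m)) eq)))))

    vertex : Subgraph.IsContractible (gf.fibre w)
    vertex = record
      { isConnected = record
        { nonEmpty = nonEmpty
        ; path     = λ {u} {v} p q → lift
            (Subgraph.IsConnected.path (Subgraph.IsContractible.isConnected (C.vertexFibre w)) p q) refl refl p
        }
      ; acyclic = trivial⇒rank-0 (gf.fibre w) acyclic
      }

-- The path  s , inner 0 , … , inner (k - 1) , t  has k + 1 edges.
module _ {A : Set} where
  pathSrc : {k : ℕ} → A → (Fin k → A) → Fin (suc k) → A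
  pathSrc s inner zero    = s
  pathSrc s inner (suc j) = inner j

  pathTgt : {k : ℕ} → (Fin k → A) → A → Fin (suc k) → A
  pathTgt {zero}  inner t zero    = t
  pathTgt {suc k} inner t zero    = inner zero
  pathTgt {suc k} inner t (suc j) = pathTgt (inner ∘ suc) t j

  pathTgt-inject₁ : {k : ℕ} (inner : Fin k → A) (t : A) (j : Fin k) → pathTgt inner t (inject₁ j) ≡ inner j
  pathTgt-inject₁ inner t zero    = refl
  pathTgt-inject₁ inner t (suc j) = pathTgt-inject₁ (inner ∘ suc) t j

  pathTgt-view : {k : ℕ} (inner : Fin k → A) (t : A) (x : Fin (suc k)) →
                 (Σ[ j ∈ Fin k ] x ≡ inject₁ j × pathTgt inner t x ≡ inner j) ⊎ (pathTgt inner t x ≡ t)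
  pathTgt-view {zero}  inner t zero    = inj₂ refl
  pathTgt-view {suc k} inner t zero    = inj₁ (zero , refl , refl)
  pathTgt-view {suc k} inner t (suc x) with pathTgt-view (inner ∘ suc) t x
  ... | inj₁ (j , refl , eq) = inj₁ (suc j , refl , eq)
  ... | inj₂ eq              = inj₂ eq

  path-telescope : {k : ℕ} (φ : A → ℤ) (s : A) (inner : Fin k → A) (t : A) →
                   sum (λ x → φ (pathTgt inner t x) ℤ.- φ (pathSrc s inner x)) ≡ φ t ℤ.- φ s
  path-telescope {zero}  φ s inner t = ℤ.+-identityʳ (φ t ℤ.- φ s)
  path-telescope {suc k} φ s inner t = trans
    (cong (ℤ._+_ (φ (inner zero) ℤ.- φ s)) (trans (sum-cong-≗ step) (path-telescope φ (inner zero) (inner ∘ suc) t)))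
    (join (φ (inner zero)) (φ s) (φ t))
    where
    step : ∀ x → φ (pathTgt inner t (suc x)) ℤ.- φ (pathSrc s inner (suc x)) ≡
                 φ (pathTgt (inner ∘ suc) t x) ℤ.- φ (pathSrc (inner zero) (inner ∘ suc) x)
    step zero    = refl
    step (suc x) = refl
    join : ∀ x y z → (x ℤ.- y) ℤ.+ (z ℤ.- x) ≡ z ℤ.- y
    join = solve-∀

  module _ (_~_ : A → A → Set) where
    path-connects : {k : ℕ} (s : A) (inner : Fin k → A) (t : A) →
                    (∀ x → EqClosure _~_ (pathSrc s inner x) (pathTgt inner t x)) →
                    EqClosure _~_ s t × (∀ j → EqClosure _~_ s (inner j))
    path-connects {zero}  s inner t h = h zero , λ ()
    path-connects {suc k} s inner t h with path-connects (inner zero) (inner ∘ suc) t shifted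
      where
      shifted : ∀ x → EqClosure _~_ (pathSrc (inner zero) (inner ∘ suc) x) (pathTgt (inner ∘ suc) t x)
      shifted zero    = h (suc zero)
      shifted (suc x) = h (suc (suc x))
    ... | toEnd , toInner = h zero ◅◅ toEnd , λ { zero → h zero ; (suc j) → h zero ◅◅ toInner j }

-- Replaces each edge e by a path with k e interior vertices.
subdivide : (G : Graph) → (Graph.E G → ℕ) → Graph
subdivide G k = record
  { V        = V ⊎ Σ[ e ∈ E ] Fin (k e)
  ; E        = Σ[ e ∈ E ] Fin (suc (k e))
  ; V-finite = ⊎-finite V-finite (Σ-finite E-finite (λ e → Fin-finite (k e)))
  ; E-finite = Σ-finite E-finite (λ e → Fin-finite (suc (k e)))
  ; src      = λ (e , x) → pathSrc (inj₁ (src e)) (λ j → inj₂ (e , j)) x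
  ; tgt      = λ (e , x) → pathTgt (λ j → inj₂ (e , j)) (inj₁ (tgt e)) x
  }
  where open Graph G

module _ (G : Graph) (k : Graph.E G → ℕ) where
  private
    module G = Graph G
    G′ = subdivide G k
    module G′ = Graph G′
    module S = Subgraph (whole G)
    module S′ = Subgraph (whole G′)

  spread-pairing : (c : G.E → ℤ) (φ : G′.V → ℤ) → G′.⟨∂ c ∘ proj₁ , φ ⟩ ≡ G.⟨∂ c , φ ∘ inj₁ ⟩
  spread-pairing c φ = trans
    (∑-Σ G.E-finite (λ e → Fin-finite (suc (k e))) G′.E-finite (λ x → c (proj₁ x) ℤ.* dφ x))
    (∑-cong G.E-finite (λ e → trans (∑-*ˡ (Fin-finite (suc (k e))) (c e) (λ x → dφ (e , x)))
      (cong (c e ℤ.*_) (trans (∑-Fin (suc (k e)) (λ x → dφ (e , x)))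
        (path-telescope φ (inj₁ (G.src e)) (λ j → inj₂ (e , j)) (inj₁ (G.tgt e)))))))
    where
    dφ : G′.E → ℤ
    dφ x = φ (G′.tgt x) ℤ.- φ (G′.src x)

  constant-on-path : (c : G′.E → ℤ) → (∀ v → G′.∂ c v ≡ 0ℤ) → ∀ e x → c (e , x) ≡ c (e , zero)
  constant-on-path c ∂c e = constant (λ x → c (e , x)) step
    where
    constant : {n : ℕ} (h : Fin (suc n) → ℤ) → (∀ j → h (inject₁ j) ≡ h (suc j)) → ∀ x → h x ≡ h zero
    constant h p zero = refl
    constant {suc n} h p (suc x) = trans (constant (h ∘ suc) (p ∘ suc) x) (sym (p zero))

    split : ∀ x y z → x ℤ.* (y ℤ.- z) ≡ x ℤ.* y ℤ.+ -1ℤ ℤ.* (x ℤ.* z)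
    split = solve-∀
    cancel : ∀ x y → x ℤ.+ -1ℤ ℤ.* y ≡ 0ℤ → x ≡ y
    cancel x y p = trans (sym (shift x y)) (trans (cong (ℤ._+ y) p) (ℤ.+-identityˡ y))
      where
      shift : ∀ x y → (x ℤ.+ -1ℤ ℤ.* y) ℤ.+ y ≡ x
      shift = solve-∀

    step : ∀ j → c (e , inject₁ j) ≡ c (e , suc j)
    step j = cancel _ _ (trans (sym boundary) (∂c v))
      where
      v : G′.V
      v = inj₂ (e , j)
      δ′ : G′.V → G′.V → ℤ
      δ′ = δ G′.V-finite
      vanish : ∀ x {u} → v ≢ u → c x ℤ.* δ′ v u ≡ 0ℤ
      vanish x ne = trans (cong (c x ℤ.*_) (δ-≢ G′.V-finite ne)) (ℤ.*-zeroʳ (c x))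
      survive : ∀ x {u} → v ≡ u → c x ℤ.* δ′ v u ≡ c x
      survive x eq = trans (cong (c x ℤ.*_) (δ-≡ G′.V-finite eq)) (ℤ.*-identityʳ (c x))
      only-tgt : ∀ x → v ≡ G′.tgt x → x ≡ (e , inject₁ j)
      only-tgt (e₁ , x) eq with pathTgt-view {A = G′.V} (λ i → inj₂ (e₁ , i)) (inj₁ (G.tgt e₁)) x
      ... | inj₂ eq′ with trans eq eq′
      ... | ()
      only-tgt (e₁ , x) eq | inj₁ (i , refl , eq′) with trans eq eq′
      ... | refl = refl
      only-src : ∀ x → v ≡ G′.src x → x ≡ (e , suc j)
      only-src (e₁ , suc x) refl = refl
      boundary : G′.∂ c v ≡ c (e , inject₁ j) ℤ.+ -1ℤ ℤ.* c (e , suc j)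
      boundary = trans (∑-cong G′.E-finite (λ x → split (c x) (δ′ v (G′.tgt x)) (δ′ v (G′.src x))))
        (trans (∑-+ G′.E-finite (λ x → c x ℤ.* δ′ v (G′.tgt x)) (λ x → -1ℤ ℤ.* (c x ℤ.* δ′ v (G′.src x))))
        (cong₂ ℤ._+_
          (trans (∑-single G′.E-finite (e , inject₁ j) (λ x → c x ℤ.* δ′ v (G′.tgt x)) (λ x ne → vanish x (ne ∘ only-tgt x)))
                 (survive (e , inject₁ j) (sym (pathTgt-inject₁ (λ i → inj₂ (e , i)) (inj₁ (G.tgt e)) j))))
          (trans (∑-*ˡ G′.E-finite -1ℤ (λ x → c x ℤ.* δ′ v (G′.src x)))
                 (cong (-1ℤ ℤ.*_) (trans
                   (∑-single G′.E-finite (e , suc j) (λ x → c x ℤ.* δ′ v (G′.src x)) (λ x ne → vanish x (ne ∘ only-src x)))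
                   (survive (e , suc j) refl))))))

  subdivide-connected : S.IsConnected → S′.IsConnected
  subdivide-connected isC = record
    { nonEmpty = inj₁ (proj₁ (Subgraph.IsConnected.nonEmpty isC)) , tt
    ; path     = λ {u} {v} _ _ → symmetric S′.Adjacent (home u) ◅◅ original (anchor u) (anchor v) ◅◅ home v
    }
    where
    Connects : G′.V → G′.V → Set
    Connects = EqClosure S′.Adjacent
    along : ∀ e → Connects (inj₁ (G.src e)) (inj₁ (G.tgt e)) × (∀ j → Connects (inj₁ (G.src e)) (inj₂ (e , j)))
    along e = path-connects S′.Adjacent (inj₁ (G.src e)) (λ j → inj₂ (e , j)) (inj₁ (G.tgt e))
      (λ x → fwd ((e , x) , tt , refl , refl) ◅ ε)
    anchor : G′.V → G.V
    anchor (inj₁ v)       = v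
    anchor (inj₂ (e , j)) = G.src e
    home : ∀ v → Connects (inj₁ (anchor v)) v
    home (inj₁ v)       = ε
    home (inj₂ (e , j)) = proj₂ (along e) j
    transport : ∀ {u v} → EqClosure S.Adjacent u v → Connects (inj₁ u) (inj₁ v)
    transport ε = ε
    transport (fwd (e , _ , refl , refl) ◅ p) = proj₁ (along e) ◅◅ transport p
    transport (bwd (e , _ , refl , refl) ◅ p) = symmetric S′.Adjacent (proj₁ (along e)) ◅◅ transport p
    original : ∀ u v → Connects (inj₁ u) (inj₁ v)
    original u v = transport (Subgraph.IsConnected.path isC tt tt)

  spread : LeftModule.Carrierᴹ S.H₁ → LeftModule.Carrierᴹ S′.H₁
  spread (c , p , q) = c ∘ proj₁ ,
    G′.pairing⇒cycle (c ∘ proj₁) (λ φ → trans (spread-pairing c φ) (G.cycle⇒pairing c p (φ ∘ inj₁))) ,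
    λ e ne → contradiction tt ne

  spread-linComb : {n : ℕ} (x : Fin n → ℤ) (v : Fin n → LeftModule.Carrierᴹ S.H₁) (e : G′.E) →
                   proj₁ (linComb S′.H₁ x (spread ∘ v)) e ≡ proj₁ (linComb S.H₁ x v) (proj₁ e)
  spread-linComb {zero}  x v e = refl
  spread-linComb {suc n} x v e = cong (ℤ._+_ (x zero ℤ.* proj₁ (v zero) (proj₁ e))) (spread-linComb (x ∘ suc) (v ∘ suc) e)

  subdivide-rank : {n : ℕ} → HasRank S.H₁ n → HasRank S′.H₁ n
  subdivide-rank (v , basis) = spread ∘ v , record
    { spanning    = λ (c , p , q) →
        let (x , eq) = IsBasis.spanning basis (collapse c p)
        in x , λ (e , y) → trans (constant-on-path c p e y) (trans (eq e) (sym (spread-linComb x v (e , y))))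
    ; independent = λ x eq → IsBasis.independent basis x (λ e → trans (sym (spread-linComb x v (e , zero))) (eq (e , zero)))
    }
    where
    extend : (G.V → ℤ) → G′.V → ℤ
    extend φ (inj₁ v) = φ v
    extend φ (inj₂ _) = 0ℤ
    collapse : (c : G′.E → ℤ) → (∀ v → G′.∂ c v ≡ 0ℤ) → LeftModule.Carrierᴹ S.H₁
    collapse c p = (λ e → c (e , zero)) ,
      G.pairing⇒cycle (λ e → c (e , zero)) (λ φ → trans (sym (spread-pairing (λ e → c (e , zero)) (extend φ)))
        (trans (∑-cong G′.E-finite (λ (e , y) → cong (ℤ._* (extend φ (G′.tgt (e , y)) ℤ.- extend φ (G′.src (e , y)))) (sym (constant-on-path c p e y))))
               (G′.cycle⇒pairing c p (extend φ)))) ,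
      λ e ne → contradiction tt ne

  subdivide-genus : {g : ℕ} → HasGenus g G → HasGenus g G′
  subdivide-genus h = record
    { isConnected = subdivide-connected (HasGenus.isConnected h)
    ; rank        = subdivide-rank (HasGenus.rank h)
    }

module _ {g : ℕ} (𝐆 : GenusGraph g) where
  open GenusGraph 𝐆
  open Graph graph

  -- An r-tuple of distinct directed edges, no two of which may be opposite
  -- directions of the same edge.
  record NonLoopTuple (r : ℕ) : Set where
    field
      edge     : Fin r → DirectedEdge
      distinct : Injective _≡_ _≡_ (proj₁ ∘ edge)
      nonLoop  : ∀ i → tail (edge i) ≢ head (edge i)

  interiorVertices : {r : ℕ} → NonLoopTuple r → (Fin r → ℕ) → E → ℕ
  interiorVertices e⃗ m e with Fin.any? (λ i → Finite._≟_ E-finite (proj₁ (NonLoopTuple.edge e⃗ i)) e)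
  ... | yes (i , _) = ℕ.pred (m i)
  ... | no _        = 0

  -- Meaningful for positive m.  The directions of the edges do not affect
  -- the resulting graph.
  subdivision : {r : ℕ} → NonLoopTuple r → (Fin r → ℕ) → GenusGraph g
  subdivision e⃗ m = record
    { graph    = subdivide graph (interiorVertices e⃗ m)
    ; hasGenus = subdivide-genus graph (interiorVertices e⃗ m) hasGenus
    }

record Contraction {g : ℕ} (G H : GenusGraph g) : Set where
  field
    morphism      : Morphism (GenusGraph.graph G) (GenusGraph.graph H)
    isContraction : Morphism.IsContraction morphism

infix 4 _≈ᶜ_

_≈ᶜ_ : {g : ℕ} {G H : GenusGraph g} → Contraction G H → Contraction G H → Set
φ ≈ᶜ ψ = Contraction.morphism φ ≗ᴹ Contraction.morphism ψ

idᶜ : {g : ℕ} (G : GenusGraph g) → Contraction G G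
idᶜ G = record
  { morphism      = idᴹ (GenusGraph.graph G)
  ; isContraction = id-isContraction (GenusGraph.graph G)
  }

infixr 9 _∘ᶜ_

_∘ᶜ_ : {g : ℕ} {G H K : GenusGraph g} → Contraction H K → Contraction G H → Contraction G K
ψ ∘ᶜ φ = record
  { morphism      = Contraction.morphism ψ ∘ᴹ Contraction.morphism φ
  ; isContraction = ∘-isContraction (Contraction.isContraction ψ) (Contraction.isContraction φ)
  }

record Rep (R : Ring c ℓr) (g : ℕ) (a ℓ : Level) : Set (c ⊔ ℓr ⊔ lsuc (0ℓ ⊔ a ⊔ ℓ)) where
  field
    obj : GenusGraph g → LeftModule R a ℓ

  ∣_∣ : GenusGraph g → Set a
  ∣ G ∣ = LeftModule.Carrierᴹ (obj G)

  infix 4 _⊢_≈_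
  _⊢_≈_ : (G : GenusGraph g) → ∣ G ∣ → ∣ G ∣ → Set ℓ
  G ⊢ x ≈ y = LeftModule._≈ᴹ_ (obj G) x y

  field
    map        : {G H : GenusGraph g} → Contraction G H → ∣ H ∣ → ∣ G ∣
    map-linear : {G H : GenusGraph g} (φ : Contraction G H) → IsLinear (obj H) (obj G) (map φ)
    map-cong   : {G H : GenusGraph g} {φ ψ : Contraction G H} → φ ≈ᶜ ψ → ∀ x → G ⊢ map φ x ≈ map ψ x
    map-id     : {G : GenusGraph g} → ∀ x → G ⊢ map (idᶜ G) x ≈ x
    map-∘      : {G H K : GenusGraph g} (ψ : Contraction H K) (φ : Contraction G H) →
                 ∀ x → G ⊢ map (ψ ∘ᶜ φ) x ≈ map φ (map ψ x)

module _ {R : Ring c ℓr} {g : ℕ} where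

  infix 4 _≅_ _⊆_

  record _≅_ (M : Rep R g a ℓ) (N : Rep R g a′ ℓ′) : Set (c ⊔ a ⊔ a′ ⊔ ℓ ⊔ ℓ′ ⊔ lsuc 0ℓ) where
    private
      module M = Rep M
      module N = Rep N
    field
      to      : ∀ G → M.∣ G ∣ → N.∣ G ∣
      isIso   : ∀ G → IsLinearIso (M.obj G) (N.obj G) (to G)
      natural : ∀ {G H} (φ : Contraction G H) x → G N.⊢ to G (M.map φ x) ≈ N.map φ (to H x)

  record SubRep (M : Rep R g a ℓ) : Set (c ⊔ a ⊔ lsuc (0ℓ ⊔ ℓ)) where
    open Rep M
    field
      at      : ∀ G → Submodule (obj G)

    Mem : ∀ G → ∣ G ∣ → Set ℓ
    Mem G = Submodule.Mem (at G)

    field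
      map-mem : ∀ {G H} (φ : Contraction G H) {x} → Mem H x → Mem G (map φ x)

  _⊆_ : {M : Rep R g a ℓ} → SubRep M → SubRep M → Set (a ⊔ ℓ ⊔ lsuc 0ℓ)
  A ⊆ B = ∀ G {x} → SubRep.Mem A G x → SubRep.Mem B G x

  -- B / (A ∩ B), used when A ⊆ B.
  subquotient : {M : Rep R g a ℓ} → SubRep M → SubRep M → Rep R g (a ⊔ ℓ) ℓ
  subquotient {M = M} B A = record
    { obj        = obj′
    ; map        = λ φ x → map φ (proj₁ x) , B.map-mem φ (proj₂ x)
    ; map-linear = λ {G} {H} φ → record
      { +ᴹ-isGroupHomomorphism = record
        { isMonoidHomomorphism = record
          { isMagmaHomomorphism = record
            { isRelHomomorphism = record { cong = λ {x} {y} x~y →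
                Submodule.resp (A.at G)
                  (≈-trans G (+ᴹ-homo φ _ _) (LeftModule.+ᴹ-congˡ (obj G) (-ᴹ-homo φ _)))
                  (A.map-mem φ x~y) }
            ; homo              = λ x y → ↓ (+ᴹ-homo φ _ _)
            }
          ; ε-homo              = ↓ (0ᴹ-homo φ)
          }
        ; ⁻¹-homo              = λ x → ↓ (-ᴹ-homo φ _)
        }
      ; *ₗ-homo                = λ r x → ↓ (*ₗ-homo φ r _)
      }
    ; map-cong   = λ φ≈ψ x → ↓ (map-cong φ≈ψ (proj₁ x))
    ; map-id     = λ x → ↓ (map-id (proj₁ x))
    ; map-∘      = λ ψ φ x → ↓ (map-∘ ψ φ (proj₁ x))
    }
    where
    open Rep M
    module A = SubRep A
    module B = SubRep B
    obj′ : GenusGraph g → LeftModule R _ _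
    obj′ G = quotient (submodule (obj G) (B.at G)) (restrictTo (B.at G) (A.at G))
    ↓ : ∀ {G x y} → G ⊢ x ≈ y → A.Mem G (LeftModule._+ᴹ_ (obj G) x (LeftModule.-ᴹ_ (obj G) y))
    ↓ {G} = quotient-≈ (obj G) (A.at G)
    ≈-trans : ∀ G {x y z} → G ⊢ x ≈ y → G ⊢ y ≈ z → G ⊢ x ≈ z
    ≈-trans G = LeftModule.≈ᴹ-trans (obj G)
    module _ {G H : GenusGraph g} (φ : Contraction G H) where
      open ModuleMorphisms.LeftModuleMorphisms.IsLeftModuleHomomorphism (map-linear φ) public
        using (+ᴹ-homo; -ᴹ-homo; 0ᴹ-homo; *ₗ-homo)

  ⨁ : {n : ℕ} → (Fin n → Rep R g a ℓ) → Rep R g a ℓ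
  ⨁ {n = n} M = record
    { obj        = λ G → Πᴹ (Fin n) (λ i → Rep.obj (M i) G)
    ; map        = λ φ x i → Rep.map (M i) φ (x i)
    ; map-linear = λ φ → record
      { +ᴹ-isGroupHomomorphism = record
        { isMonoidHomomorphism = record
          { isMagmaHomomorphism = record
            { isRelHomomorphism = record { cong = λ p i → ⟦⟧-cong φ i (p i) }
            ; homo              = λ x y i → +ᴹ-homo φ i (x i) (y i)
            }
          ; ε-homo              = λ i → 0ᴹ-homo φ i
          }
        ; ⁻¹-homo              = λ x i → -ᴹ-homo φ i (x i)
        }
      ; *ₗ-homo                = λ r x i → *ₗ-homo φ i r (x i)
      }
    ; map-cong   = λ φ≈ψ x i → Rep.map-cong (M i) φ≈ψ (x i)
    ; map-id     = λ x i → Rep.map-id (M i) (x i)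
    ; map-∘      = λ ψ φ x i → Rep.map-∘ (M i) ψ φ (x i)
    }
    where
    module _ {G H : GenusGraph g} (φ : Contraction G H) (i : Fin n) where
      open ModuleMorphisms.LeftModuleMorphisms.IsLeftModuleHomomorphism (Rep.map-linear (M i) φ) public
        using (⟦⟧-cong; +ᴹ-homo; -ᴹ-homo; 0ᴹ-homo; *ₗ-homo)

  record FinitelyGenerated≤ (d : ℕ) (M : Rep R g a ℓ) : Set (c ⊔ a ⊔ ℓ ⊔ lsuc 0ℓ) where
    open Rep M
    field
      size      : ℕ
      source    : Fin size → GenusGraph g
      bounded   : ∀ i → Graph.#E (GenusGraph.graph (source i)) ℕ.≤ d
      generator : ∀ i → ∣ source i ∣
      generates : ∀ G → Spans (obj G) {I = Σ[ i ∈ Fin size ] Contraction G (source i)}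
                                      (λ (i , φ) → map φ (generator i))

  record IsSmall (d : ℕ) (M : Rep R g a ℓ) : Set (c ⊔ ℓr ⊔ lsuc (0ℓ ⊔ a ⊔ ℓ)) where
    field
      ambient  : Rep R g a ℓ
      ambient≤ : FinitelyGenerated≤ d ambient
      B A      : SubRep ambient
      A⊆B      : A ⊆ B
      iso      : M ≅ subquotient B A

  record Filtration (M : Rep R g a ℓ) : Set (c ⊔ a ⊔ lsuc (0ℓ ⊔ ℓ)) where
    open Rep M
    field
      length    : ℕ
      step      : Fin (suc length) → SubRep M
      bottom    : ∀ G x → SubRep.Mem (step zero) G x → G ⊢ x ≈ LeftModule.0ᴹ (obj G)
      top       : ∀ G x → SubRep.Mem (step (fromℕ length)) G x
      ascending : ∀ i → step (inject₁ i) ⊆ step (suc i)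

    gr : Rep R g (a ⊔ ℓ) ℓ
    gr = ⨁ (λ i → subquotient (step (suc i)) (step (inject₁ i)))

  IsSmallish : ℕ → Rep R g a ℓ → Set (c ⊔ ℓr ⊔ lsuc (0ℓ ⊔ a ⊔ ℓ))
  IsSmallish d M = Σ[ F ∈ Filtration M ] IsSmall d (Filtration.gr F)

-- Classically the apartness of a Heyting field is the negation of _≈_, so
-- that a Heyting field is just a field.
ringOf : {ℓ₁ ℓ₂ : Level} → HeytingField c ℓ₁ ℓ₂ → Ring c ℓ₁
ringOf k = CommutativeRing.ring (HeytingCommutativeRing.commutativeRing (HeytingField.heytingCommutativeRing k))

-- A list of terms, each given by its coefficient and its exponents.
Polynomial : ℕ → Set
Polynomial r = List (ℚ × (Fin r → ℕ))

-- A bound on the exponents that occur, hence on the total degree of the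
-- represented polynomial; conversely every polynomial of total degree at
-- most d has such a representation.
TotalDegree≤ : {r : ℕ} → ℕ → Polynomial r → Set
TotalDegree≤ d = All (λ (_ , α) → RawMonoidDefs.sum ℕ.+-0-rawMonoid α ℕ.≤ d)

eval : {r : ℕ} → Polynomial r → (Fin r → ℚ) → ℚ
eval f t = foldr (λ (q , α) s → q ℚ.* product (λ i → t i ^ α i) ℚ.+ s) 0ℚ f
  where open RawSemiringDefs ℚ.+-*-rawSemiring using (product; _^_)

fromℕ-ℚ : ℕ → ℚ
fromℕ-ℚ n = (ℤ.+ n) ℚ./ 1

module Submission where

-- A contraction out of a subdivision G(k) is recorded by its values on the
-- vertices of G, the edges of G(k) it keeps together with their images, and
-- the numbers of collapsed edges between consecutive kept ones.  All but these
-- gaps, of which a path with κ kept edges has κ + 1, take finitely many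
-- values.  Collapsing one edge of a longer subdivision increases one gap by 1
-- and is monotone for the lexicographic order.  So, if the module is presented
-- as B / A inside a finitely generated one, the labels of the vectors that are
-- leading for B (or for A) form an upset of gap vectors, and dim B / A counts
-- the labels that are leading for B but not for A.  By Dickson's lemma the
-- slices of upsets are eventually constant, which makes the count a finite sum
-- of products of coefficients of x ^ c / (1 - x) ^ q, where q is at most κ + 1,
-- and these are eventually polynomial of degree q - 1.

open import Defs
open import Axiom.ExcludedMiddle using (ExcludedMiddle)
open import Algebra.Apartness.Bundles using (HeytingField)
open import Algebra.Bundles using (Ring; CommutativeRing; CommutativeMonoid)
import Algebra.Definitions.RawSemiring as RawSemiringDefs
open import Algebra.Module.Bundles using (LeftModule)
import Algebra.Module.Morphism.Structures as ModuleMorphisms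
import Algebra.Properties.CommutativeMonoid.Sum as CommutativeMonoidSum
import Algebra.Properties.CommutativeSemigroup as CommutativeSemigroupProperties
import Algebra.Properties.Semiring.Exp as SemiringExp
open import Data.Empty using (⊥)
open import Data.Fin.Base as Fin using (Fin; zero; suc; toℕ; fromℕ; fromℕ<; inject₁; punchIn; _↑ˡ_; _↑ʳ_)
import Data.Fin.Properties as Fin
open import Data.Integer.Base as ℤ using (ℤ; 0ℤ)
import Data.Integer.Properties as ℤ
open import Data.List.Base as List using (List; []; _∷_; _++_; map; length; concat; concatMap; filter; allFin; cartesianProduct; cartesianProductWith)
import Data.List.Properties as List
open import Data.List.Membership.Propositional using (_∈_)
import Data.List.Membership.Propositional.Properties as ∈
open import Data.List.Relation.Unary.All as All using (All; []; _∷_)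
import Data.List.Relation.Unary.All.Properties as All
open import Data.List.Relation.Unary.AllPairs as AllPairs using (AllPairs; []; _∷_)
import Data.List.Relation.Unary.AllPairs.Properties as AllPairs
open import Data.List.Relation.Unary.Any as Any using (Any; here; there)
import Data.List.Relation.Unary.Any.Properties as Any
open import Data.Maybe.Base using (Maybe; just; nothing)
open import Data.Nat.Base as ℕ hiding (_^_) renaming (_⊔_ to _⊔ⁿ_)
open import Data.Nat.ListAction using (sum)
open import Data.Nat.ListAction.Properties using (sum-++)
open import Data.Nat.Properties as ℕ hiding (_≟_)
open import Data.Nat.Tactic.RingSolver using () renaming (solve-∀ to solveℕ)
open import Data.Product using (Σ; Σ-syntax; ∃; _×_; _,_; proj₁; proj₂)
open import Data.Rational.Base as ℚ using (ℚ; 1ℚ)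
import Data.Rational.Properties as ℚ
open import Data.Rational.Solver using (module +-*-Solver)
open import Data.Rational.Unnormalised.Base using (mkℚᵘ; *≡*)
import Data.Rational.Unnormalised.Properties as ℚᵘ
open import Data.Sign.Base as Sign using (Sign)
open import Data.Sum.Base using (_⊎_; inj₁; inj₂; map₂)
open import Data.Unit.Base using (⊤; tt)
open import Data.Vec.Base as Vec using (Vec; []; _∷_)
import Data.Vec.Properties as Vec
open import Data.Vec.Relation.Binary.Pointwise.Inductive using (Pointwise; []; _∷_)
open import Function.Base using (_∘_; id)
open import Function.Bundles using (Inverse)
open import Level using (Level; _⊔_)
open import Relation.Binary.Construct.Closure.Equivalence using (EqClosure; symmetric)
open import Relation.Binary.Construct.Closure.ReflexiveTransitive using (ε; _◅_; _◅◅_)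
open import Relation.Binary.Construct.Closure.Symmetric using (fwd; bwd)
open import Relation.Binary.PropositionalEquality as ≡ using (_≡_; _≢_; refl; sym; trans; cong; cong₂; subst; module ≡-Reasoning)
open import Relation.Nullary using (¬_; Dec; yes; no; contradiction)

-- The ambient module need not be free: distinct labels may carry dependent vectors, and many labels
-- carry none. The count survives because only leading behaviour is compared. The spans of the
-- initial segments of the ordered labels filter the module, and a label raises the dimension of B
-- modulo A on these spans exactly when its vector is leading for B but not for A. A vector that
-- depends on earlier ones is leading for both, since 0 lies in A, and so adds nothing.
--
-- The leading labels have to be described for all subdivisions at once. This is possible because a
-- gap vector together with its marks determines the lengths of all paths: the gap vectors of one
-- type share a single set for all subdivisions, and a choice of lengths merely selects some of
-- them. The degree is at most d because every kept edge lies over an edge of its own in a graph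
-- with at most d edges.
--
-- Smallness is given for the graded module as a whole, so each layer of the filtration is cut out
-- of the same ambient module, and the dimensions of the layers are added.

private
  variable
    c ℓr a ℓ a′ ℓ′ p q s t u w : Level
    n : ℕ

-- Eventually polynomial functions

module ℕ∑ = CommutativeMonoidSum +-0-commutativeMonoid
module ℚ∏ = CommutativeMonoidSum ℚ.*-1-commutativeMonoid
module ℚ^ = SemiringExp (CommutativeRing.semiring ℚ.+-*-commutativeRing)

-- Fractions in `ℚ` are normalised, which blocks computation; the identity is checked on
-- unnormalised fractions with denominator 1 and carried back.
fromℕ-ℚ-+ : ∀ m n → fromℕ-ℚ (m + n) ≡ fromℕ-ℚ m ℚ.+ fromℕ-ℚ n
fromℕ-ℚ-+ m n = ℚ.toℚᵘ-injective (ℚᵘ.≃-trans (ℚ.toℚᵘ-fromℚᵘ (mkℚᵘ (ℤ.+ (m + n)) 0))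
  (ℚᵘ.≃-trans (*≡* (cong (ℤ._* ℤ.+ 1) (sym (cong₂ ℤ._+_ (ℤ.*-identityʳ (ℤ.+ m)) (ℤ.*-identityʳ (ℤ.+ n))))))
  (ℚᵘ.≃-sym (ℚᵘ.≃-trans (ℚ.toℚᵘ-homo-+ (fromℕ-ℚ m) (fromℕ-ℚ n))
    (ℚᵘ.+-cong (ℚ.toℚᵘ-fromℚᵘ (mkℚᵘ (ℤ.+ m) 0)) (ℚ.toℚᵘ-fromℚᵘ (mkℚᵘ (ℤ.+ n) 0)))))))

fromℕ-ℚ-* : ∀ m n → fromℕ-ℚ (m * n) ≡ fromℕ-ℚ m ℚ.* fromℕ-ℚ n
fromℕ-ℚ-* m n = ℚ.toℚᵘ-injective (ℚᵘ.≃-trans (ℚ.toℚᵘ-fromℚᵘ (mkℚᵘ (ℤ.+ (m * n)) 0))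
  (ℚᵘ.≃-trans (*≡* (cong (ℤ._* ℤ.+ 1) (ℤ.pos-* m n)))
  (ℚᵘ.≃-sym (ℚᵘ.≃-trans (ℚ.toℚᵘ-homo-* (fromℕ-ℚ m) (fromℕ-ℚ n))
    (ℚᵘ.*-cong (ℚ.toℚᵘ-fromℚᵘ (mkℚᵘ (ℤ.+ m) 0)) (ℚ.toℚᵘ-fromℚᵘ (mkℚᵘ (ℤ.+ n) 0)))))))

module _ {r : ℕ} where
  open RawSemiringDefs ℚ.+-*-rawSemiring using (product; _^_)

  monomial : (Fin r → ℕ) → (Fin r → ℚ) → ℚ
  monomial α t = product (λ i → t i ^ α i)

  monomial-+ : ∀ α β t → monomial (λ i → α i + β i) t ≡ monomial α t ℚ.* monomial β t
  monomial-+ α β t = trans (ℚ∏.sum-cong-≗ (λ i → ℚ^.^-homo-* (t i) (α i) (β i)))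
    (ℚ∏.∑-distrib-+ (λ i → t i ^ α i) (λ i → t i ^ β i))

  monomial-0 : ∀ t → monomial (λ _ → 0) t ≡ 1ℚ
  monomial-0 t = ℚ∏.sum-replicate-zero r

unit : {r : ℕ} → Fin r → Fin r → ℕ
unit zero    zero    = 1
unit zero    (suc j) = 0
unit (suc i) zero    = 0
unit (suc i) (suc j) = unit i j

sum-unit : {r : ℕ} (i : Fin r) → ℕ∑.sum (unit i) ≡ 1
sum-unit {suc r} zero    = cong suc (ℕ∑.sum-replicate-zero r)
sum-unit {suc r} (suc i) = sum-unit i

monomial-unit : {r : ℕ} (i : Fin r) (t : Fin r → ℚ) → monomial (unit i) t ≡ t i
monomial-unit {suc r} zero t = trans (cong₂ ℚ._*_ (ℚ.*-identityʳ (t zero)) (monomial-0 (t ∘ suc))) (ℚ.*-identityʳ (t zero))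
monomial-unit {suc r} (suc i) t = trans (ℚ.*-identityˡ _) (monomial-unit i (t ∘ suc))

module _ {r : ℕ} where
  infixl 6 _+ᴾ_
  infixl 7 _*ᴾ_

  constant : ℚ → Polynomial r
  constant q = (q , λ _ → 0) ∷ []

  variableᴾ : Fin r → Polynomial r
  variableᴾ i = (1ℚ , unit i) ∷ []

  _+ᴾ_ : Polynomial r → Polynomial r → Polynomial r
  _+ᴾ_ = _++_

  multiplyTerms : ℚ × (Fin r → ℕ) → ℚ × (Fin r → ℕ) → ℚ × (Fin r → ℕ)
  multiplyTerms (p , α) (q , β) = p ℚ.* q , λ i → α i + β i

  _*ᴾ_ : Polynomial r → Polynomial r → Polynomial r
  []      *ᴾ g = []
  (x ∷ f) *ᴾ g = map (multiplyTerms x) g +ᴾ f *ᴾ g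

  eval-constant : ∀ q t → eval (constant q) t ≡ q
  eval-constant q t = trans (ℚ.+-identityʳ _) (trans (cong (q ℚ.*_) (monomial-0 t)) (ℚ.*-identityʳ q))

  eval-variable : ∀ i t → eval (variableᴾ i) t ≡ t i
  eval-variable i t = trans (ℚ.+-identityʳ _) (trans (ℚ.*-identityˡ _) (monomial-unit i t))

  eval-+ : ∀ f g t → eval (f +ᴾ g) t ≡ eval f t ℚ.+ eval g t
  eval-+ []            g t = sym (ℚ.+-identityˡ _)
  eval-+ ((q , α) ∷ f) g t = trans (cong (q ℚ.* monomial α t ℚ.+_) (eval-+ f g t)) (sym (ℚ.+-assoc (q ℚ.* monomial α t) _ _))

  eval-multiplyTerms : ∀ q α g t → eval (map (multiplyTerms (q , α)) g) t ≡ q ℚ.* monomial α t ℚ.* eval g t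
  eval-multiplyTerms q α []            t = sym (ℚ.*-zeroʳ (q ℚ.* monomial α t))
  eval-multiplyTerms q α ((p , β) ∷ g) t = trans
    (cong₂ ℚ._+_ (cong (q ℚ.* p ℚ.*_) (monomial-+ α β t)) (eval-multiplyTerms q α g t))
    (rearrange q p (monomial α t) (monomial β t) (eval g t))
    where
    open +-*-Solver
    rearrange : ∀ q p a b s → q ℚ.* p ℚ.* (a ℚ.* b) ℚ.+ q ℚ.* a ℚ.* s ≡ q ℚ.* a ℚ.* (p ℚ.* b ℚ.+ s)
    rearrange = solve 5 (λ q p a b s → q :* p :* (a :* b) :+ q :* a :* s := q :* a :* (p :* b :+ s)) refl

  eval-* : ∀ f g t → eval (f *ᴾ g) t ≡ eval f t ℚ.* eval g t
  eval-* []            g t = sym (ℚ.*-zeroˡ (eval g t))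
  eval-* ((q , α) ∷ f) g t = trans (eval-+ (map (multiplyTerms (q , α)) g) (f *ᴾ g) t)
    (trans (cong₂ ℚ._+_ (eval-multiplyTerms q α g t) (eval-* f g t)) (sym (ℚ.*-distribʳ-+ (eval g t) (q ℚ.* monomial α t) (eval f t))))

  constant-degree : ∀ q → TotalDegree≤ 0 (constant q)
  constant-degree q = ≤-reflexive (ℕ∑.sum-replicate-zero r) ∷ []

  variable-degree : ∀ i → TotalDegree≤ 1 (variableᴾ i)
  variable-degree i = ≤-reflexive (sum-unit i) ∷ []

  TotalDegree≤-mono : ∀ {d d′} {f : Polynomial r} → d ≤ d′ → TotalDegree≤ d f → TotalDegree≤ d′ f
  TotalDegree≤-mono d≤d′ = All.map (λ p → ≤-trans p d≤d′)

  +ᴾ-degree : ∀ {d} {f g : Polynomial r} → TotalDegree≤ d f → TotalDegree≤ d g → TotalDegree≤ d (f +ᴾ g)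
  +ᴾ-degree = All.++⁺

  *ᴾ-degree : ∀ {d d′} {f g : Polynomial r} → TotalDegree≤ d f → TotalDegree≤ d′ g → TotalDegree≤ (d + d′) (f *ᴾ g)
  *ᴾ-degree []       q = []
  *ᴾ-degree {f = (_ , α) ∷ _} (p ∷ ps) q = All.++⁺
    (All.map⁺ (All.map (λ {(_ , β)} b → ≤-trans (≤-reflexive (ℕ∑.∑-distrib-+ α β)) (+-mono-≤ p b)) q))
    (*ᴾ-degree ps q)

-- Positivity is a separate condition because a subdivided edge has `suc (pred (m i))` edges, which
-- is `m i` only for positive `m i`.
record EventuallyPolynomial {r : ℕ} (d : ℕ) (f : (Fin r → ℕ) → ℕ) : Set where
  field
    polynomial : Polynomial r
    degree≤    : TotalDegree≤ d polynomial
    threshold  : ℕ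
    agrees     : ∀ m → (∀ i → 0 < m i) → (∀ i → threshold ≤ m i) → fromℕ-ℚ (f m) ≡ eval polynomial (fromℕ-ℚ ∘ m)

module _ {r : ℕ} where
  open EventuallyPolynomial

  EP-const : ∀ n → EventuallyPolynomial {r} 0 (λ _ → n)
  EP-const n = record
    { polynomial = constant (fromℕ-ℚ n)
    ; degree≤    = constant-degree (fromℕ-ℚ n)
    ; threshold  = 0
    ; agrees     = λ m _ _ → sym (eval-constant (fromℕ-ℚ n) (fromℕ-ℚ ∘ m))
    }

  EP-cong : ∀ {d} {f g : (Fin r → ℕ) → ℕ} (N : ℕ) → (∀ m → (∀ i → 0 < m i) → (∀ i → N ≤ m i) → f m ≡ g m) →
            EventuallyPolynomial d f → EventuallyPolynomial d g
  EP-cong N f≡g F = record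
    { polynomial = polynomial F
    ; degree≤    = degree≤ F
    ; threshold  = threshold F ⊔ⁿ N
    ; agrees     = λ m pos large → trans (cong fromℕ-ℚ (sym (f≡g m pos (λ i → ≤-trans (m≤n⊔m _ N) (large i)))))
        (agrees F m pos (λ i → ≤-trans (m≤m⊔n _ N) (large i)))
    }

  EP-mono : ∀ {d d′} {f : (Fin r → ℕ) → ℕ} → d ≤ d′ → EventuallyPolynomial d f → EventuallyPolynomial d′ f
  EP-mono d≤d′ F = record
    { polynomial = polynomial F
    ; degree≤    = TotalDegree≤-mono d≤d′ (degree≤ F)
    ; threshold  = threshold F
    ; agrees     = agrees F
    }

  EP-+ : ∀ {d} {f g : (Fin r → ℕ) → ℕ} → EventuallyPolynomial d f → EventuallyPolynomial d g →
         EventuallyPolynomial d (λ m → f m + g m)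
  EP-+ {f = f} {g} F G = record
    { polynomial = polynomial F +ᴾ polynomial G
    ; degree≤    = +ᴾ-degree (degree≤ F) (degree≤ G)
    ; threshold  = threshold F ⊔ⁿ threshold G
    ; agrees     = λ m pos large → trans (fromℕ-ℚ-+ (f m) (g m)) (trans
        (cong₂ ℚ._+_ (agrees F m pos (λ i → ≤-trans (m≤m⊔n _ _) (large i))) (agrees G m pos (λ i → ≤-trans (m≤n⊔m _ _) (large i))))
        (sym (eval-+ (polynomial F) (polynomial G) _)))
    }

  EP-* : ∀ {d d′} {f g : (Fin r → ℕ) → ℕ} → EventuallyPolynomial d f → EventuallyPolynomial d′ g →
         EventuallyPolynomial (d + d′) (λ m → f m * g m)
  EP-* {f = f} {g} F G = record
    { polynomial = polynomial F *ᴾ polynomial G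
    ; degree≤    = *ᴾ-degree (degree≤ F) (degree≤ G)
    ; threshold  = threshold F ⊔ⁿ threshold G
    ; agrees     = λ m pos large → trans (fromℕ-ℚ-* (f m) (g m)) (trans
        (cong₂ ℚ._*_ (agrees F m pos (λ i → ≤-trans (m≤m⊔n _ _) (large i))) (agrees G m pos (λ i → ≤-trans (m≤n⊔m _ _) (large i))))
        (sym (eval-* (polynomial F) (polynomial G) _)))
    }

  EP-∸ : (i : Fin r) (c : ℕ) → EventuallyPolynomial 1 (λ m → m i ∸ c)
  EP-∸ i c = record
    { polynomial = variableᴾ i +ᴾ constant (ℚ.- fromℕ-ℚ c)
    ; degree≤    = +ᴾ-degree (variable-degree i) (TotalDegree≤-mono z≤n (constant-degree (ℚ.- fromℕ-ℚ c)))
    ; threshold  = c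
    ; agrees     = λ m _ large → trans (cancel (fromℕ-ℚ (m i ∸ c)) (fromℕ-ℚ c)) (sym
        (trans (eval-+ (variableᴾ i) (constant (ℚ.- fromℕ-ℚ c)) _)
        (cong₂ ℚ._+_ (trans (eval-variable i _) (trans (cong fromℕ-ℚ (sym (m∸n+n≡m (large i)))) (fromℕ-ℚ-+ (m i ∸ c) c)))
                     (eval-constant (ℚ.- fromℕ-ℚ c) (fromℕ-ℚ ∘ m)))))
    }
    where
    open +-*-Solver
    cancel : ∀ x y → x ≡ x ℚ.+ y ℚ.+ ℚ.- y
    cancel = solve 2 (λ x y → x := x :+ y :+ :- y) refl

  -- Keeps the counting inside ℕ: `q !` times a binomial coefficient is a product of linear factors,
  -- and the denominator enters only in the polynomial.
  EP-÷ : ∀ {d} u .{{_ : NonZero u}} {f : (Fin r → ℕ) → ℕ} → EventuallyPolynomial d (λ m → u * f m) → EventuallyPolynomial d f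
  EP-÷ u {f} F = record
    { polynomial = constant u⁻¹ *ᴾ polynomial F
    ; degree≤    = *ᴾ-degree (constant-degree u⁻¹) (degree≤ F)
    ; threshold  = threshold F
    ; agrees     = λ m pos large → sym (trans (eval-* (constant u⁻¹) (polynomial F) _)
        (trans (cong₂ ℚ._*_ (eval-constant u⁻¹ (fromℕ-ℚ ∘ m)) (trans (sym (agrees F m pos large)) (fromℕ-ℚ-* u (f m))))
        (trans (sym (ℚ.*-assoc u⁻¹ (fromℕ-ℚ u) _)) (trans (cong (ℚ._* fromℕ-ℚ (f m)) (ℚ.*-inverseˡ (fromℕ-ℚ u))) (ℚ.*-identityˡ _)))))
    }
    where
    instance
      u≠0 : ℚ.NonZero (fromℕ-ℚ u)
      u≠0 = ℚ.pos⇒nonZero (fromℕ-ℚ u) {{ℚ.normalize-pos u 1}}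
    u⁻¹ : ℚ
    u⁻¹ = ℚ.1/ fromℕ-ℚ u

-- Counting gap vectors

-- The coefficients of 1 / (1 - x) ^ q.
geometric : ℕ → ℕ → ℕ
geometric zero    zero    = 1
geometric zero    (suc k) = 0
geometric (suc q) zero    = geometric q zero
geometric (suc q) (suc k) = geometric q (suc k) + geometric (suc q) k

-- The coefficients of x ^ c / (1 - x) ^ q.
β : ℕ → ℕ → ℕ → ℕ
β zero    q k       = geometric q k
β (suc c) q zero    = 0
β (suc c) q (suc k) = β c q k

geometric-0 : ∀ q → geometric q 0 ≡ 1
geometric-0 zero    = refl
geometric-0 (suc q) = geometric-0 q

geometric-1 : ∀ k → geometric 1 k ≡ 1
geometric-1 zero    = refl
geometric-1 (suc k) = geometric-1 k

-- Compares the coefficients of x ^ (k + 1) in (1 - x) F = x ^ (c + 1) / (1 - x) ^ q for F = x ^ (c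
-- + 1) / (1 - x) ^ (q + 1).
β-step : ∀ c q k → β (suc c) (suc q) (suc k) ≡ β c q k + β (suc c) (suc q) k
β-step zero    q zero    = sym (+-identityʳ _)
β-step zero    q (suc k) = refl
β-step (suc c) q zero    = refl
β-step (suc c) q (suc k) = β-step c q k

β-≥ : ∀ c q {k} → c ≤ k → β c q k ≡ geometric q (k ∸ c)
β-≥ zero    q _         = refl
β-≥ (suc c) q (s≤s c≤k) = β-≥ c q c≤k

-- The rising factorial (n + 1) (n + 2) ... (n + q), of degree q in n.
rising : ℕ → ℕ → ℕ
rising zero    n = 1
rising (suc q) n = rising q n * (n + suc q)

rising-0 : ∀ q → rising q 0 ≡ q !
rising-0 zero    = refl
rising-0 (suc q) = trans (cong (_* suc q) (rising-0 q)) (*-comm (q !) (suc q))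

rising-suc : ∀ q n → rising (suc q) n ≡ suc n * rising q (suc n)
rising-suc zero    n = rearrange n
  where
  rearrange : ∀ n → 1 * (n + 1) ≡ suc n * 1
  rearrange = solveℕ
rising-suc (suc q) n = trans (cong (_* (n + suc (suc q))) (rising-suc q n)) (rearrange n q (rising q (suc n)))
  where
  rearrange : ∀ n q x → suc n * x * (n + suc (suc q)) ≡ suc n * (x * (suc n + suc q))
  rearrange = solveℕ

-- The recursion of `geometric` is Pascal's rule; in the inductive step both summands are multiples
-- of `rising q (suc n)`.
geometric-rising : ∀ q n → q ! * geometric (suc q) n ≡ rising q n
geometric-rising zero    n       = trans (+-identityʳ _) (geometric-1 n)
geometric-rising (suc q) zero    = trans (cong (suc q ! *_) (geometric-0 (suc (suc q)))) (trans (*-identityʳ (suc q !)) (sym (rising-0 (suc q))))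
geometric-rising (suc q) (suc n) = begin
  suc q ! * (geometric (suc q) (suc n) + geometric (suc (suc q)) n)               ≡⟨ split (suc q) (q !) (geometric (suc q) (suc n)) (geometric (suc (suc q)) n) ⟩
  suc q * (q ! * geometric (suc q) (suc n)) + suc q ! * geometric (suc (suc q)) n ≡⟨ cong₂ _+_ (cong (suc q *_) (geometric-rising q (suc n))) (geometric-rising (suc q) n) ⟩
  suc q * rising q (suc n) + rising (suc q) n                                     ≡⟨ cong (suc q * rising q (suc n) +_) (rising-suc q n) ⟩
  suc q * rising q (suc n) + suc n * rising q (suc n)                             ≡⟨ join q n (rising q (suc n)) ⟩
  rising q (suc n) * (suc n + suc q)                                              ∎
  where
  open ≡-Reasoning
  split : ∀ a b x y → a * b * (x + y) ≡ a * (b * x) + a * b * y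
  split = solveℕ
  join : ∀ q n x → suc q * x + suc n * x ≡ x * (suc n + suc q)
  join = solveℕ

EP-rising : {r : ℕ} (i : Fin r) (c q : ℕ) → EventuallyPolynomial q (λ m → rising q (m i ∸ c))
EP-rising i c zero    = EP-const 1
EP-rising i c (suc q) = EP-mono (≤-reflexive (+-comm q 1))
  (EP-* (EP-rising i c q) (EP-+ (EP-∸ i c) (EP-mono z≤n (EP-const (suc q)))))

-- For `q = 0` the series is the monomial x ^ c, whose coefficients vanish past c; truncated
-- subtraction assigns this case degree 0.
EP-β : {r : ℕ} (i : Fin r) (c q : ℕ) → EventuallyPolynomial (q ∸ 1) (λ m → β c q (m i))
EP-β i c zero = EP-cong (suc c) (λ m _ large → sym (vanish c (large i))) (EP-const 0)
  where
  vanish : ∀ c {k} → suc c ≤ k → β c 0 k ≡ 0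
  vanish zero    (s≤s _)   = refl
  vanish (suc c) (s≤s c<k) = vanish c c<k
EP-β i c (suc q) = EP-÷ (q !) {{q !≢0}} (EP-cong c
  (λ m _ large → sym (trans (cong (q ! *_) (β-≥ c (suc q) (large i))) (geometric-rising q (m i ∸ c))))
  (EP-rising i c q))

-- Finite sums of products of sequences β c q, one factor for each variable;
-- the sum of the numbers q - 1 in every product is bounded by the index d.
data Quasi : {s : ℕ} → ℕ → (Vec ℕ s → ℕ) → Set where
  base : ∀ {d f} → Quasi {0} d f
  null : ∀ {s d f} → (∀ ks → f ks ≡ 0) → Quasi {s} d f
  plus : ∀ {s d f g h} → Quasi d g → Quasi d h → (∀ ks → f ks ≡ g ks + h ks) → Quasi {s} d f
  times : ∀ {s d d′ f g} c q → Quasi {s} d g → (∀ k ks → f (k ∷ ks) ≡ β c q k * g ks) → (q ∸ 1) + d ≤ d′ → Quasi {suc s} d′ f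

Quasi-cong : ∀ {s d} {f f′ : Vec ℕ s → ℕ} → (∀ ks → f′ ks ≡ f ks) → Quasi d f → Quasi d f′
Quasi-cong e base                = base
Quasi-cong e (null p)            = null (λ ks → trans (e ks) (p ks))
Quasi-cong e (plus F G p)        = plus F G (λ ks → trans (e ks) (p ks))
Quasi-cong e (times c q F p ≤d) = times c q F (λ k ks → trans (e (k ∷ ks)) (p k ks)) ≤d

Quasi-mono : ∀ {s d d′} {f : Vec ℕ s → ℕ} → d ≤ d′ → Quasi d f → Quasi d′ f
Quasi-mono d≤d′ base                = base
Quasi-mono d≤d′ (null p)            = null p
Quasi-mono d≤d′ (plus F G p)        = plus (Quasi-mono d≤d′ F) (Quasi-mono d≤d′ G) p
Quasi-mono d≤d′ (times c q F p ≤d) = times c q F p (≤-trans ≤d d≤d′)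

module _ {s : ℕ} where
  shift : (Vec ℕ (suc s) → ℕ) → Vec ℕ (suc s) → ℕ
  shift f (zero ∷ ks)  = 0
  shift f (suc k ∷ ks) = f (k ∷ ks)

  -- On generating series this is multiplication by x / (1 - x) in the first variable, as `shift` is
  -- multiplication by x.
  cumulate : (Vec ℕ (suc s) → ℕ) → Vec ℕ (suc s) → ℕ
  cumulate f (zero ∷ ks)  = 0
  cumulate f (suc k ∷ ks) = f (k ∷ ks) + cumulate f (k ∷ ks)

  -- The sum over `suc t + k′ = k`: a gap of t letters, one kept letter, and k′ letters left in the
  -- word.
  convolve : (ℕ → Vec ℕ (suc s) → ℕ) → Vec ℕ (suc s) → ℕ
  convolve g (zero ∷ ks)  = 0
  convolve g (suc k ∷ ks) = g 0 (k ∷ ks) + convolve (g ∘ suc) (k ∷ ks)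

  Quasi-shift : ∀ {d f} → Quasi d f → Quasi d (shift f)
  Quasi-shift (null p)     = null (λ { (zero ∷ ks) → refl ; (suc k ∷ ks) → p (k ∷ ks) })
  Quasi-shift (plus F G p) = plus (Quasi-shift F) (Quasi-shift G) (λ { (zero ∷ ks) → refl ; (suc k ∷ ks) → p (k ∷ ks) })
  Quasi-shift (times c q F p ≤d) = times (suc c) q F (λ { zero ks → refl ; (suc k) ks → p k ks }) ≤d

  Quasi-cumulate : ∀ {d f} → Quasi d f → Quasi (suc d) (cumulate f)
  Quasi-cumulate {f = f} (null p) = null (λ { (k ∷ ks) → all k ks })
    where
    all : ∀ k ks → cumulate f (k ∷ ks) ≡ 0
    all zero    ks = refl
    all (suc k) ks = cong₂ _+_ (p (k ∷ ks)) (all k ks)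
  Quasi-cumulate {f = f} (plus {g = g} {h} F G p) = plus (Quasi-cumulate F) (Quasi-cumulate G) (λ { (k ∷ ks) → all k ks })
    where
    interchange : ∀ a b c d → a + b + (c + d) ≡ a + c + (b + d)
    interchange = solveℕ
    all : ∀ k ks → cumulate f (k ∷ ks) ≡ cumulate g (k ∷ ks) + cumulate h (k ∷ ks)
    all zero    ks = refl
    all (suc k) ks = trans (cong₂ _+_ (p (k ∷ ks)) (all k ks)) (interchange (g (k ∷ ks)) (h (k ∷ ks)) _ _)
  Quasi-cumulate {d} {f} (times {d = d₁} {g = g} c q F p ≤d) = times (suc c) (suc q) F all
    (≤-trans (+-monoˡ-≤ d₁ {q} (m≤n+m∸n q 1)) (s≤s ≤d))
    where
    all : ∀ k ks → cumulate f (k ∷ ks) ≡ β (suc c) (suc q) k * g ks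
    all zero    ks = refl
    all (suc k) ks = trans (cong₂ _+_ (p k ks) (all k ks))
      (trans (sym (*-distribʳ-+ (g ks) (β c q k) (β (suc c) (suc q) k))) (cong (_* g ks) (sym (β-step c q k))))

  Quasi-convolve : ∀ {d} T (g : ℕ → Vec ℕ (suc s) → ℕ) → (∀ t → Quasi d (g t)) →
                   (∀ {t} → T ≤ t → ∀ ks → g t ks ≡ g T ks) → Quasi (suc d) (convolve g)
  Quasi-convolve zero g G stable = Quasi-cong (λ { (k ∷ ks) → all g k ks (λ t → stable {t} z≤n) }) (Quasi-cumulate (G 0))
    where
    all : ∀ g′ k ks → (∀ t ks → g′ t ks ≡ g 0 ks) → convolve g′ (k ∷ ks) ≡ cumulate (g 0) (k ∷ ks)
    all g′ zero    ks e = refl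
    all g′ (suc k) ks e = cong₂ _+_ (e 0 (k ∷ ks)) (all (g′ ∘ suc) k ks (e ∘ suc))
  Quasi-convolve (suc T) g G stable = Quasi-cong (λ { (zero ∷ ks) → refl ; (suc k ∷ ks) → refl })
    (Quasi-shift (plus (Quasi-mono (n≤1+n _) (G 0)) (Quasi-convolve T (g ∘ suc) (G ∘ suc) (stable ∘ s≤s)) (λ _ → refl)))

  -- The last gap of a word is all that remains of it, so its length selects the slice. Values
  -- before `T` are picked out by monomials (q = 0) and the constant tail by x ^ T / (1 - x) (q =
  -- 1); neither raises the degree.
  Quasi-head : ∀ {d} T (g : ℕ → Vec ℕ s → ℕ) → (∀ t → Quasi d (g t)) →
               (∀ {t} → T ≤ t → ∀ ks → g t ks ≡ g T ks) → Quasi d (λ ks → g (Vec.head ks) (Vec.tail ks))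
  Quasi-head zero g G stable = times 0 1 (G 0)
    (λ k ks → trans (stable z≤n ks) (sym (trans (cong (_* g 0 ks) (geometric-1 k)) (*-identityˡ _)))) ≤-refl
  Quasi-head (suc T) g G stable = plus
    (times {f = λ ks → β 0 0 (Vec.head ks) * g 0 (Vec.tail ks)} 0 0 (G 0) (λ _ _ → refl) ≤-refl)
    (Quasi-shift (Quasi-head T (g ∘ suc) (G ∘ suc) (stable ∘ s≤s)))
    (λ { (zero ∷ ks) → sym (trans (+-identityʳ _) (+-identityʳ _)) ; (suc k ∷ ks) → refl })

-- The lengths `l j` stay abstract because a path length is either one of the variables or the
-- constant 1.
EP-Quasi : ∀ {r s d} {g : Vec ℕ s → ℕ} (l : Fin s → (Fin r → ℕ) → ℕ) →
           (∀ j c q → EventuallyPolynomial (q ∸ 1) (λ m → β c q (l j m))) →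
           Quasi d g → EventuallyPolynomial d (λ m → g (Vec.tabulate (λ j → l j m)))
EP-Quasi {g = g} l h base = EP-mono z≤n (EP-const (g []))
EP-Quasi l h (null p)     = EP-cong 0 (λ m _ _ → sym (p _)) (EP-mono z≤n (EP-const 0))
EP-Quasi l h (plus F G p) = EP-cong 0 (λ m _ _ → sym (p _)) (EP-+ (EP-Quasi l h F) (EP-Quasi l h G))
EP-Quasi l h (times c q F p ≤d) = EP-cong 0 (λ m _ _ → sym (p (l zero m) _))
  (EP-mono ≤d (EP-* (h zero c q) (EP-Quasi (l ∘ suc) (h ∘ suc) F)))

-- Eventual constancy in each gap once the gaps before it are fixed, which is what `Quasi-head` and
-- `Quasi-convolve` consume one mark at a time.
Tame : {n : ℕ} → (Vec ℕ n → ℕ) → Set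
Tame {zero}  f = ⊤
Tame {suc n} f = (∀ t → Tame (λ a → f (t ∷ a))) × Σ[ T ∈ ℕ ] (∀ {t} → T ≤ t → ∀ a → f (t ∷ a) ≡ f (T ∷ a))

module _ {A : Set} where
  splittings : (ℕ → ℕ → List A) → ℕ → List A
  splittings F zero    = []
  splittings F (suc k) = F 0 k ++ splittings (F ∘ suc) k

module _ {D : Set} where
  kept : List (Maybe D) → ℕ
  kept []             = 0
  kept (just _ ∷ ms)  = suc (kept ms)
  kept (nothing ∷ ms) = kept ms

  -- The gaps in front of the marks of a sequence of words, where `nothing`
  -- marks the end of a word, `just` marks one of its letters, and the lengths
  -- of the words are given.
  gapVectors : {s : ℕ} (ms : List (Maybe D)) → Vec ℕ s → List (Vec ℕ (length ms))
  gapVectors []             []       = [] ∷ []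
  gapVectors []             (k ∷ ks) = []
  gapVectors (m ∷ ms)       []       = []
  gapVectors (nothing ∷ ms) (k ∷ ks) = map (k ∷_) (gapVectors ms ks)
  gapVectors (just _ ∷ ms)  (k ∷ ks) = splittings (λ t k′ → map (t ∷_) (gapVectors ms (k′ ∷ ks))) k

  count : {s : ℕ} (ms : List (Maybe D)) → (Vec ℕ (length ms) → ℕ) → Vec ℕ s → ℕ
  count ms f ks = sum (map f (gapVectors ms ks))

  count-cong : {s : ℕ} (ms : List (Maybe D)) {f g : Vec ℕ (length ms) → ℕ} → (∀ a → f a ≡ g a) →
               (ks : Vec ℕ s) → count ms f ks ≡ count ms g ks
  count-cong ms e ks = cong sum (List.map-cong e (gapVectors ms ks))

  private
    count-slice : {s : ℕ} (m : Maybe D) (ms : List (Maybe D)) (f : Vec ℕ (length (m ∷ ms)) → ℕ) (t : ℕ) (ks : Vec ℕ s) →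
                  sum (map f (map (t ∷_) (gapVectors ms ks))) ≡ count ms (λ a → f (t ∷ a)) ks
    count-slice m ms f t ks = cong sum (sym (List.map-∘ (gapVectors ms ks)))

    count-splittings : {s : ℕ} (d : D) (ms : List (Maybe D)) (F : ℕ → Vec ℕ (length ms) → Vec ℕ (length (just d ∷ ms)))
                       (f : Vec ℕ (length (just d ∷ ms)) → ℕ) (k : ℕ) (ks : Vec ℕ s) →
                       sum (map f (splittings (λ t k′ → map (F t) (gapVectors ms (k′ ∷ ks))) k)) ≡
                       convolve (λ t → count ms (f ∘ F t)) (k ∷ ks)
    count-splittings d ms F f zero    ks = refl
    count-splittings d ms F f (suc k) ks = trans (cong sum (List.map-++ f (map (F 0) (gapVectors ms (k ∷ ks))) _))
      (trans (sum-++ (map f (map (F 0) (gapVectors ms (k ∷ ks)))) _)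
      (cong₂ _+_ (cong sum (sym (List.map-∘ (gapVectors ms (k ∷ ks))))) (count-splittings d ms (F ∘ suc) f k ks)))

  -- A `just` mark is handled by `Quasi-convolve` and costs one degree, an end mark by `Quasi-head`
  -- and costs none, so the degree is the number of kept letters.
  Quasi-count : {s : ℕ} (ms : List (Maybe D)) (f : Vec ℕ (length ms) → ℕ) → Tame f → Quasi {s} (kept ms) (count ms f)
  Quasi-count {zero}  ms             f tame = base
  Quasi-count {suc s} []             f tame = null (λ { (k ∷ ks) → refl })
  Quasi-count {suc s} (nothing ∷ ms) f (slices , T , stable) = Quasi-cong (λ { (k ∷ ks) → count-slice nothing ms f k ks })
    (Quasi-head T (λ t → count ms (λ a → f (t ∷ a))) (λ t → Quasi-count ms _ (slices t)) (λ T≤t → count-cong ms (stable T≤t)))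
  Quasi-count {suc s} (just d ∷ ms)  f (slices , T , stable) = Quasi-cong (λ { (k ∷ ks) → count-splittings d ms _∷_ f k ks })
    (Quasi-convolve T (λ t → count ms (λ a → f (t ∷ a))) (λ t → Quasi-count ms _ (slices t)) (λ T≤t → count-cong ms (stable T≤t)))

-- Upsets of gap vectors

data Bump : Vec ℕ n → Vec ℕ n → Set where
  here  : ∀ {t} {a : Vec ℕ n} → Bump (t ∷ a) (suc t ∷ a)
  there : ∀ {t} {a b : Vec ℕ n} → Bump a b → Bump (t ∷ a) (t ∷ b)

Upset : (Vec ℕ n → Set u) → Set u
Upset U = ∀ {a b} → Bump a b → U a → U b

Upset-slice : {U : Vec ℕ (suc n) → Set u} → Upset U → ∀ t → Upset (λ a → U (t ∷ a))
Upset-slice up t b = up (there b)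

Upset-head : {U : Vec ℕ (suc n) → Set u} → Upset U → ∀ {t t′} a → t ≤ t′ → U (t ∷ a) → U (t′ ∷ a)
Upset-head {U = U} up {t} a t≤t′ x = subst (λ s → U (s ∷ a)) (m∸n+n≡m t≤t′) (iterate _)
  where
  iterate : ∀ s → U (s + t ∷ a)
  iterate zero    = x
  iterate (suc s) = up here (iterate s)

Upset-≤ : {U : Vec ℕ n → Set u} → Upset U → ∀ {a b} → Pointwise _≤_ a b → U a → U b
Upset-≤ up []         x = x
Upset-≤ up (_∷_ {ys = b} t≤t′ ps) x = Upset-head up b t≤t′ (Upset-≤ (Upset-slice up _) ps x)

module _ (em : {ℓ : Level} → ExcludedMiddle ℓ) where

  indicator : Set u → ℕ
  indicator P with em {P = P}
  ... | yes _ = 1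
  ... | no _  = 0

  indicator-cong : {P : Set u} {Q : Set w} → (P → Q) → (Q → P) → indicator P ≡ indicator Q
  indicator-cong {P = P} {Q} f g with em {P = P} | em {P = Q}
  ... | yes _ | yes _  = refl
  ... | no _  | no _   = refl
  ... | yes p | no ¬q  = contradiction (f p) ¬q
  ... | no ¬p | yes q  = contradiction (g q) ¬p

  Generators : (Vec ℕ n → Set u) → Set u
  Generators {n} U = Σ[ gs ∈ List (Vec ℕ n) ] All U gs × (∀ a → U a → Any (λ g → Pointwise _≤_ g a) gs)

  -- The union of all slices is an upset in one dimension less. Each of its finitely many generators
  -- occurs in some slice, and the slice at the largest such index contains them all.
  slices-stabilise : (∀ {u} (U : Vec ℕ n → Set u) → Upset U → Generators U) →
                     (U : Vec ℕ (suc n) → Set u) → Upset U → Σ[ T ∈ ℕ ] (∀ t a → U (t ∷ a) → U (T ∷ a))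
  slices-stabilise {n} dickson U up with dickson (λ a → Σ[ t ∈ ℕ ] U (t ∷ a)) (λ { b (t , x) → t , up (there b) x })
  ... | gs , inU , gen = proj₁ (bound gs inU) , λ t a x → reach a (gen a (t , x)) (proj₂ (bound gs inU))
    where
    bound : (gs : List (Vec ℕ n)) → All (λ g → Σ[ t ∈ ℕ ] U (t ∷ g)) gs → Σ[ T ∈ ℕ ] All (λ g → U (T ∷ g)) gs
    bound []       []             = 0 , []
    bound (g ∷ gs) ((t , x) ∷ xs) with bound gs xs
    ... | T , ys = t ⊔ⁿ T , Upset-head up g (m≤m⊔n t T) x ∷ All.map (λ {g′} → Upset-head up g′ (m≤n⊔m t T)) ys
    reach : ∀ {T} a {gs} → Any (λ g → Pointwise _≤_ g a) gs → All (λ g → U (T ∷ g)) gs → U (T ∷ a)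
    reach a (here g≤a) (x ∷ _)  = Upset-≤ up (≤-refl ∷ g≤a) x
    reach a (there p)  (_ ∷ xs) = reach a p xs

  -- Slices up to the stabilisation index have generators by induction on n, and those of the slice
  -- at that index also serve all later slices.
  dickson : (U : Vec ℕ n → Set u) → Upset U → Generators U
  dickson {zero} U up with em {P = U []}
  ... | yes x = [] ∷ [] , x ∷ [] , λ { [] _ → here [] }
  ... | no ¬x = [] , [] , λ { [] x → contradiction x ¬x }
  dickson {suc n} U up with slices-stabilise dickson U up
  ... | T , stable = proj₁ (upTo T) , proj₁ (proj₂ (upTo T)) , gen
    where
    upTo : ∀ T → Σ[ gs ∈ List (Vec ℕ (suc n)) ] All U gs ×
                 (∀ t a → t ≤ T → U (t ∷ a) → Any (λ g → Pointwise _≤_ g (t ∷ a)) gs)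
    upTo T with dickson (λ a → U (T ∷ a)) (Upset-slice up T)
    upTo zero | gs , inU , gen = map (zero ∷_) gs , All.map⁺ inU ,
      λ { zero a z≤n x → Any.map⁺ (Any.map (≤-refl ∷_) (gen a x)) }
    upTo (suc T) | gs , inU , gen with upTo T
    ... | hs , inU′ , gen′ = map (suc T ∷_) gs ++ hs , All.++⁺ (All.map⁺ inU) inU′ , split
      where
      split : ∀ t a → t ≤ suc T → U (t ∷ a) → Any (λ g → Pointwise _≤_ g (t ∷ a)) (map (suc T ∷_) gs ++ hs)
      split t a t≤ x with m≤n⇒m<n∨m≡n t≤
      ... | inj₁ (s≤s t≤T) = Any.++⁺ʳ _ (gen′ t a t≤T x)
      ... | inj₂ refl      = Any.++⁺ˡ (Any.map⁺ (Any.map (≤-refl ∷_) (gen a x)))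
    gen : ∀ a → U a → Any (λ g → Pointwise _≤_ g a) (proj₁ (upTo T))
    gen (t ∷ a) x with ≤-total t T
    ... | inj₁ t≤T = proj₂ (proj₂ (upTo T)) t a t≤T x
    ... | inj₂ T≤t = Any.map (λ { (p ∷ ps) → ≤-trans p T≤t ∷ ps })
                       (proj₂ (proj₂ (upTo T)) T a ≤-refl (stable t a x))

  -- The slices of an upset increase with the first coordinate and stop growing at some index, so
  -- beyond both indices neither condition depends on that coordinate.
  Tame-difference : (U : Vec ℕ n → Set u) (W : Vec ℕ n → Set w) → Upset U → Upset W →
                    Tame (λ a → indicator (U a × ¬ W a))
  Tame-difference {zero}  U W upU upW = tt
  Tame-difference {suc n} U W upU upW with slices-stabilise dickson U upU | slices-stabilise dickson W upW
  ... | T , stable | T′ , stable′ = (λ t → Tame-difference _ _ (Upset-slice upU t) (Upset-slice upW t)) , T ⊔ⁿ T′ ,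
    λ {t} T≤t a → indicator-cong
      (λ (x , ¬y) → Upset-head upU a (m≤m⊔n T T′) (stable t a x) , λ y → ¬y (Upset-head upW a T≤t y))
      (λ (x , ¬y) → Upset-head upU a T≤t x , λ y → ¬y (Upset-head upW a (m≤n⊔m T T′) (stable′ t a y)))

-- Relative bases and leading vectors

append : {A : Set a} {m n : ℕ} → (Fin m → A) → (Fin n → A) → Fin (m + n) → A
append {m = zero}  v w         = w
append {m = suc m} v w zero    = v zero
append {m = suc m} v w (suc i) = append (v ∘ suc) w i

append-elim : {A : Set a} {P : A → Set p} {m n : ℕ} {v : Fin m → A} {w : Fin n → A} →
              (∀ i → P (v i)) → (∀ j → P (w j)) → ∀ k → P (append v w k)
append-elim {m = zero}  f g         = g
append-elim {m = suc m} f g zero    = f zero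
append-elim {P = P} {m = suc m} f g (suc k) = append-elim {P = P} (f ∘ suc) g k

↑-elim : {m n : ℕ} {P : Fin (m + n) → Set p} → (∀ i → P (i ↑ˡ n)) → (∀ j → P (m ↑ʳ j)) → ∀ k → P k
↑-elim {m = zero}  f g         = g
↑-elim {m = suc m} f g zero    = f zero
↑-elim {m = suc m} {P = P} f g (suc k) = ↑-elim {m = m} {P = P ∘ suc} (f ∘ suc) g k

module _ {R : Ring c ℓr} (P : LeftModule R a ℓ) where
  open Ring R using (0#; 1#) renaming (Carrier to K; _≈_ to _≈ᴷ_; _*_ to _*ᴷ_; -_ to -ᴷ_)
  private module R = Ring R
  open LeftModule P
  open CommutativeSemigroupProperties (CommutativeMonoid.commutativeSemigroup +ᴹ-commutativeMonoid) using (interchange)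

  -- Membership may live at any level, unlike in `Submodule`, because spans and images are defined
  -- by existential statements.
  record IsSubspace (S : Carrierᴹ → Set s) : Set (c ⊔ a ⊔ ℓ ⊔ s) where
    field
      resp   : ∀ {x y} → x ≈ᴹ y → S x → S y
      0-mem  : S 0ᴹ
      +-mem  : ∀ {x y} → S x → S y → S (x +ᴹ y)
      *ₗ-mem : ∀ r {x} → S x → S (r *ₗ x)

  Submodule⇒IsSubspace : (N : Submodule P) → IsSubspace (Submodule.Mem N)
  Submodule⇒IsSubspace N = record { Submodule N }

  0-isSubspace : IsSubspace (_≈ᴹ 0ᴹ)
  0-isSubspace = record
    { resp   = λ x≈y x≈0 → ≈ᴹ-trans (≈ᴹ-sym x≈y) x≈0
    ; 0-mem  = ≈ᴹ-refl
    ; +-mem  = λ x≈0 y≈0 → ≈ᴹ-trans (+ᴹ-cong x≈0 y≈0) (+ᴹ-identityˡ 0ᴹ)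
    ; *ₗ-mem = λ r x≈0 → ≈ᴹ-trans (*ₗ-congˡ x≈0) (*ₗ-zeroʳ r)
    }

  linComb-mem : {S : Carrierᴹ → Set s} → IsSubspace S → ∀ {n} (x : Fin n → K) {v : Fin n → Carrierᴹ} → (∀ i → S (v i)) → S (linComb P x v)
  linComb-mem sub {zero}  x h = IsSubspace.0-mem sub
  linComb-mem sub {suc n} x h = IsSubspace.+-mem sub (IsSubspace.*ₗ-mem sub (x zero) (h zero)) (linComb-mem sub (x ∘ suc) (h ∘ suc))

  linComb-append : ∀ {m n} (x : Fin m → K) (y : Fin n → K) v w →
                   linComb P (append x y) (append v w) ≈ᴹ linComb P x v +ᴹ linComb P y w
  linComb-append {zero}  x y v w = ≈ᴹ-sym (+ᴹ-identityˡ _)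
  linComb-append {suc m} x y v w = ≈ᴹ-trans (+ᴹ-congˡ (linComb-append (x ∘ suc) y (v ∘ suc) w)) (≈ᴹ-sym (+ᴹ-assoc _ _ _))

  linComb-split : ∀ {m n} (x : Fin (m + n) → K) (v : Fin m → Carrierᴹ) w →
                  linComb P x (append v w) ≈ᴹ linComb P (x ∘ (_↑ˡ n)) v +ᴹ linComb P (x ∘ (m ↑ʳ_)) w
  linComb-split {zero}  x v w = ≈ᴹ-sym (+ᴹ-identityˡ _)
  linComb-split {suc m} x v w = ≈ᴹ-trans (+ᴹ-congˡ (linComb-split {m} (x ∘ suc) (v ∘ suc) w)) (≈ᴹ-sym (+ᴹ-assoc _ _ _))

  linComb-zero : ∀ {n} {x : Fin n → K} v → (∀ i → x i ≈ᴷ 0#) → linComb P x v ≈ᴹ 0ᴹ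
  linComb-zero {zero}  v h = ≈ᴹ-refl
  linComb-zero {suc n} v h = ≈ᴹ-trans (+ᴹ-cong (≈ᴹ-trans (*ₗ-congʳ (h zero)) (*ₗ-zeroˡ _)) (linComb-zero (v ∘ suc) (h ∘ suc))) (+ᴹ-identityˡ _)

  data ⟨_⟩ (Q : Carrierᴹ → Set q) : Carrierᴹ → Set (c ⊔ a ⊔ ℓ ⊔ q) where
    gen   : ∀ {x} → Q x → ⟨ Q ⟩ x
    null  : ⟨ Q ⟩ 0ᴹ
    plus  : ∀ {x y} → ⟨ Q ⟩ x → ⟨ Q ⟩ y → ⟨ Q ⟩ (x +ᴹ y)
    scale : ∀ r {x} → ⟨ Q ⟩ x → ⟨ Q ⟩ (r *ₗ x)
    cast  : ∀ {x y} → x ≈ᴹ y → ⟨ Q ⟩ x → ⟨ Q ⟩ y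

  span-isSubspace : (Q : Carrierᴹ → Set q) → IsSubspace ⟨ Q ⟩
  span-isSubspace Q = record { resp = cast ; 0-mem = null ; +-mem = plus ; *ₗ-mem = scale }

  span-least : {Q : Carrierᴹ → Set q} {S : Carrierᴹ → Set s} → IsSubspace S → (∀ {x} → Q x → S x) → ∀ {x} → ⟨ Q ⟩ x → S x
  span-least sub f (gen x)     = f x
  span-least sub f null        = IsSubspace.0-mem sub
  span-least sub f (plus x y)  = IsSubspace.+-mem sub (span-least sub f x) (span-least sub f y)
  span-least sub f (scale r x) = IsSubspace.*ₗ-mem sub r (span-least sub f x)
  span-least sub f (cast e x)  = IsSubspace.resp sub e (span-least sub f x)

  span-map : {Q : Carrierᴹ → Set q} {Q′ : Carrierᴹ → Set s} → (∀ {x} → Q x → Q′ x) → ∀ {x} → ⟨ Q ⟩ x → ⟨ Q′ ⟩ x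
  span-map {Q′ = Q′} f = span-least (span-isSubspace Q′) (gen ∘ f)

  span-∪ : {Q Q′ : Carrierᴹ → Set q} {v : Carrierᴹ} → (∀ {x} → Q′ x → Q x ⊎ x ≈ᴹ v) →
           ∀ {x} → ⟨ Q′ ⟩ x → Σ[ r ∈ K ] Σ[ w ∈ Carrierᴹ ] ⟨ Q ⟩ w × x ≈ᴹ r *ₗ v +ᴹ w
  span-∪ {v = v} f (gen {x} g) with f g
  ... | inj₁ h   = 0# , x , gen h , ≈ᴹ-sym (≈ᴹ-trans (+ᴹ-congʳ (*ₗ-zeroˡ v)) (+ᴹ-identityˡ x))
  ... | inj₂ x≈v = 1# , 0ᴹ , null , ≈ᴹ-trans x≈v (≈ᴹ-sym (≈ᴹ-trans (+ᴹ-identityʳ _) (*ₗ-identityˡ v)))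
  span-∪ {v = v} f null = 0# , 0ᴹ , null , ≈ᴹ-sym (≈ᴹ-trans (+ᴹ-congʳ (*ₗ-zeroˡ v)) (+ᴹ-identityˡ 0ᴹ))
  span-∪ {v = v} f (plus x y) with span-∪ f x | span-∪ f y
  ... | r , w , g , e | r′ , w′ , g′ , e′ = r R.+ r′ , w +ᴹ w′ , plus g g′ ,
    ≈ᴹ-trans (+ᴹ-cong e e′) (≈ᴹ-trans (interchange _ _ _ _) (+ᴹ-congʳ (≈ᴹ-sym (*ₗ-distribʳ v r r′))))
  span-∪ {v = v} f (scale t x) with span-∪ f x
  ... | r , w , g , e = t *ᴷ r , t *ₗ w , scale t g ,
    ≈ᴹ-trans (*ₗ-congˡ e) (≈ᴹ-trans (*ₗ-distribˡ t _ _) (+ᴹ-congʳ (≈ᴹ-sym (*ₗ-assoc t r v))))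
  span-∪ f (cast e x) with span-∪ f x
  ... | r , w , g , e′ = r , w , g , ≈ᴹ-trans (≈ᴹ-sym e) e′

  -- A basis of C modulo A, expressed inside the module without forming the quotient.
  record RelativeBasis (C : Carrierᴹ → Set p) (A : Carrierᴹ → Set s) (n : ℕ) : Set (c ⊔ ℓr ⊔ a ⊔ ℓ ⊔ p ⊔ s) where
    field
      vec         : Fin n → Carrierᴹ
      vec-mem     : ∀ i → C (vec i)
      spanning    : ∀ {x} → C x → Σ[ r ∈ (Fin n → K) ] Σ[ y ∈ Carrierᴹ ] A y × x ≈ᴹ y +ᴹ linComb P r vec
      independent : ∀ r → A (linComb P r vec) → ∀ i → r i ≈ᴷ 0#

  open RelativeBasis

  RelativeBasis-cong : {C : Carrierᴹ → Set p} {C′ : Carrierᴹ → Set q} {A : Carrierᴹ → Set s} {n : ℕ} →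
                       (∀ {x} → C x → C′ x) → (∀ {x} → C′ x → C x) → RelativeBasis C A n → RelativeBasis C′ A n
  RelativeBasis-cong f g b = record { vec = vec b ; vec-mem = f ∘ vec-mem b ; spanning = spanning b ∘ g ; independent = independent b }

  RelativeBasis-trivial : {C : Carrierᴹ → Set p} {A : Carrierᴹ → Set s} → (∀ {x} → C x → A x) → RelativeBasis C A 0
  RelativeBasis-trivial C⊆A = record
    { vec         = λ ()
    ; vec-mem     = λ ()
    ; spanning    = λ {x} x∈C → (λ ()) , x , C⊆A x∈C , ≈ᴹ-sym (+ᴹ-identityʳ x)
    ; independent = λ _ _ ()
    }

  -- A relation modulo A is also one modulo B, where the second block vanishes; this kills the first
  -- coefficients and leaves a relation among the second block.
  RelativeBasis-trans : {C : Carrierᴹ → Set p} {B : Carrierᴹ → Set q} {A : Carrierᴹ → Set s} {m n : ℕ} →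
                        IsSubspace B → IsSubspace A → (∀ {x} → A x → B x) → (∀ {x} → B x → C x) →
                        RelativeBasis C B m → RelativeBasis B A n → RelativeBasis C A (m + n)
  RelativeBasis-trans {C = C} {B} {A} {m} {n} subB subA A⊆B B⊆C b b′ = record
    { vec         = append (vec b) (vec b′)
    ; vec-mem     = append-elim {P = C} (vec-mem b) (B⊆C ∘ vec-mem b′)
    ; spanning    = λ x∈C →
        let (r , y , y∈B , e) = spanning b x∈C
            (r′ , z , z∈A , e′) = spanning b′ y∈B
        in append r r′ , z , z∈A , ≈ᴹ-trans e (≈ᴹ-trans (+ᴹ-congʳ e′) (≈ᴹ-trans (+ᴹ-assoc z _ _)
             (+ᴹ-congˡ (≈ᴹ-trans (+ᴹ-comm _ _) (≈ᴹ-sym (linComb-append r r′ (vec b) (vec b′)))))))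
    ; independent = indep
    }
    where
    module B = IsSubspace subB
    cancel : ∀ x y → (x +ᴹ y) +ᴹ (-ᴷ 1#) *ₗ y ≈ᴹ x
    cancel x y = ≈ᴹ-trans (+ᴹ-assoc x y _) (≈ᴹ-trans (+ᴹ-congˡ (≈ᴹ-trans (+ᴹ-congʳ (≈ᴹ-sym (*ₗ-identityˡ y)))
      (≈ᴹ-trans (≈ᴹ-sym (*ₗ-distribʳ y 1# (-ᴷ 1#))) (≈ᴹ-trans (*ₗ-congʳ (R.-‿inverseʳ 1#)) (*ₗ-zeroˡ y))))) (+ᴹ-identityʳ x))
    indep : ∀ r → A (linComb P r (append (vec b) (vec b′))) → ∀ i → r i ≈ᴷ 0#
    indep r h = ↑-elim {m = m} {P = λ i → r i ≈ᴷ 0#} r₁≈0 (independent b′ (r ∘ (m ↑ʳ_)) (IsSubspace.resp subA e₂ h))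
      where
      e₁ : linComb P r (append (vec b) (vec b′)) ≈ᴹ linComb P (r ∘ (_↑ˡ n)) (vec b) +ᴹ linComb P (r ∘ (m ↑ʳ_)) (vec b′)
      e₁ = linComb-split r (vec b) (vec b′)
      r₁≈0 : ∀ i → r (i ↑ˡ n) ≈ᴷ 0#
      r₁≈0 = independent b (r ∘ (_↑ˡ n)) (B.resp (≈ᴹ-trans (+ᴹ-congʳ e₁) (cancel _ _))
        (B.+-mem (A⊆B h) (B.*ₗ-mem (-ᴷ 1#) (linComb-mem subB (r ∘ (m ↑ʳ_)) (vec-mem b′)))))
      e₂ : linComb P r (append (vec b) (vec b′)) ≈ᴹ linComb P (r ∘ (m ↑ʳ_)) (vec b′)
      e₂ = ≈ᴹ-trans e₁ (≈ᴹ-trans (+ᴹ-congʳ (linComb-zero (vec b) r₁≈0)) (+ᴹ-identityˡ _))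

  -- Some element of S has leading term v, the vectors in `Q` counting as lower. The coefficient of
  -- v is normalised to 1, as is possible over a field.
  Leading : (S : Carrierᴹ → Set s) (Q : Carrierᴹ → Set q) → Carrierᴹ → Set (c ⊔ a ⊔ ℓ ⊔ s ⊔ q)
  Leading S Q v = Σ[ w ∈ Carrierᴹ ] ⟨ Q ⟩ w × S (v +ᴹ w)

  Leading-map : {S : Carrierᴹ → Set s} {Q : Carrierᴹ → Set q} {Q′ : Carrierᴹ → Set p} → IsSubspace S →
                (∀ {x} → Q x → Q′ x) → ∀ {v v′} → v ≈ᴹ v′ → Leading S Q v → Leading S Q′ v′
  Leading-map sub f e (w , g , h) = w , span-map f g , IsSubspace.resp sub (+ᴹ-congʳ e) h

  module Flag (zeroOrUnit : ∀ r → r ≈ᴷ 0# ⊎ Σ[ r′ ∈ K ] r′ *ᴷ r ≈ᴷ 1#)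
              {C : Carrierᴹ → Set p} {A : Carrierᴹ → Set s} (subC : IsSubspace C) (subA : IsSubspace A) (A⊆C : ∀ {x} → A x → C x) where
    private
      module C = IsSubspace subC
      module A = IsSubspace subA

    infixl 6 _-[_]_

    _-[_]_ : Carrierᴹ → K → Carrierᴹ → Carrierᴹ
    x -[ r ] y = x +ᴹ (-ᴷ r) *ₗ y

    add-back : ∀ x r y → x ≈ᴹ (x -[ r ] y) +ᴹ r *ₗ y
    add-back x r y = ≈ᴹ-sym (≈ᴹ-trans (+ᴹ-assoc x _ _) (≈ᴹ-trans (+ᴹ-congˡ
      (≈ᴹ-trans (≈ᴹ-sym (*ₗ-distribʳ y (-ᴷ r) r)) (≈ᴹ-trans (*ₗ-congʳ (R.-‿inverseˡ r)) (*ₗ-zeroˡ y)))) (+ᴹ-identityʳ x)))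

    eliminate : ∀ r v u w → (r *ₗ v +ᴹ u) -[ r ] (v +ᴹ w) ≈ᴹ u -[ r ] w
    eliminate r v u w = ≈ᴹ-trans (+ᴹ-congˡ (*ₗ-distribˡ (-ᴷ r) v w)) (≈ᴹ-trans (interchange _ _ _ _)
      (≈ᴹ-trans (+ᴹ-congʳ (≈ᴹ-trans (≈ᴹ-sym (*ₗ-distribʳ v r (-ᴷ r))) (≈ᴹ-trans (*ₗ-congʳ (R.-‿inverseʳ r)) (*ₗ-zeroˡ v)))) (+ᴹ-identityˡ _)))

    normalise : ∀ {r r′} v u → r′ *ᴷ r ≈ᴷ 1# → r′ *ₗ (r *ₗ v +ᴹ u) ≈ᴹ v +ᴹ r′ *ₗ u
    normalise {r} {r′} v u e = ≈ᴹ-trans (*ₗ-distribˡ r′ _ u)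
      (+ᴹ-congʳ (≈ᴹ-trans (≈ᴹ-sym (*ₗ-assoc r′ r v)) (≈ᴹ-trans (*ₗ-congʳ e) (*ₗ-identityˡ v))))

    module _ {Q Q′ : Carrierᴹ → Set q} {v : Carrierᴹ} (v∈ : Q′ v) (Q⊆Q′ : ∀ {x} → Q x → Q′ x) (Q′⊆ : ∀ {x} → Q′ x → Q x ⊎ x ≈ᴹ v) {n : ℕ}
             (b : RelativeBasis (λ x → C x × ⟨ Q ⟩ x) A n) where

      -- The new basis vector is an element `v +ᴹ w` of C with leading term v. Subtracting a
      -- multiple of it brings an element of C into the span of `Q`; a relation modulo A with
      -- invertible coefficient at it would make v leading for A.
      adjoin : Leading C Q v → ¬ Leading A Q v → RelativeBasis (λ x → C x × ⟨ Q′ ⟩ x) A (suc n)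
      adjoin (w , g , h) ¬lead = record
        { vec         = λ { zero → v +ᴹ w ; (suc i) → vec b i }
        ; vec-mem     = λ { zero → h , plus (gen v∈) (span-map Q⊆Q′ g) ; (suc i) → proj₁ (vec-mem b i) , span-map Q⊆Q′ (proj₂ (vec-mem b i)) }
        ; spanning    = λ {x} (x∈C , x∈Q′) →
            let (r , u , u∈Q , e) = span-∪ Q′⊆ x∈Q′
                (r′ , y , y∈A , e′) = spanning b (C.+-mem x∈C (C.*ₗ-mem (-ᴷ r) h) ,
                  cast (≈ᴹ-sym (≈ᴹ-trans (+ᴹ-congʳ e) (eliminate r v u w))) (plus u∈Q (scale (-ᴷ r) g)))
            in (λ { zero → r ; (suc i) → r′ i }) , y , y∈A ,
               ≈ᴹ-trans (add-back x r (v +ᴹ w)) (≈ᴹ-trans (+ᴹ-congʳ e′) (≈ᴹ-trans (+ᴹ-assoc _ _ _) (+ᴹ-congˡ (+ᴹ-comm _ _))))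
        ; independent = λ r h′ → indep r h′ (r₀≈0 r h′)
        }
        where
        r₀≈0 : ∀ r → A (r zero *ₗ (v +ᴹ w) +ᴹ linComb P (r ∘ suc) (vec b)) → r zero ≈ᴷ 0#
        r₀≈0 r h′ with zeroOrUnit (r zero)
        ... | inj₁ r≈0 = r≈0
        ... | inj₂ (r′ , e) = contradiction
          (w +ᴹ r′ *ₗ linComb P (r ∘ suc) (vec b) ,
           plus g (scale r′ (linComb-mem (span-isSubspace Q) (r ∘ suc) (proj₂ ∘ vec-mem b))) ,
           A.resp (≈ᴹ-trans (normalise (v +ᴹ w) _ e) (+ᴹ-assoc v w _)) (A.*ₗ-mem r′ h′)) ¬lead
        indep : ∀ r → A (r zero *ₗ (v +ᴹ w) +ᴹ linComb P (r ∘ suc) (vec b)) → r zero ≈ᴷ 0# → ∀ i → r i ≈ᴷ 0#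
        indep r h′ r≈0 zero    = r≈0
        indep r h′ r≈0 (suc i) = independent b (r ∘ suc)
          (A.resp (≈ᴹ-trans (+ᴹ-congʳ (≈ᴹ-trans (*ₗ-congʳ r≈0) (*ₗ-zeroˡ _))) (+ᴹ-identityˡ _)) h′) i

      -- An element of C whose coefficient at v is invertible makes v leading for C, hence for A,
      -- and then a multiple of an element of A removes v. With coefficient 0 there is nothing to
      -- remove.
      keep : (Leading C Q v → Leading A Q v) → RelativeBasis (λ x → C x × ⟨ Q′ ⟩ x) A n
      keep lead = record
        { vec         = vec b
        ; vec-mem     = λ i → proj₁ (vec-mem b i) , span-map Q⊆Q′ (proj₂ (vec-mem b i))
        ; spanning    = λ {x} (x∈C , x∈Q′) → span x∈C (span-∪ Q′⊆ x∈Q′)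
        ; independent = independent b
        }
        where
        span : ∀ {x} → C x → Σ[ r ∈ K ] Σ[ u ∈ Carrierᴹ ] ⟨ Q ⟩ u × x ≈ᴹ r *ₗ v +ᴹ u →
               Σ[ r ∈ (Fin n → K) ] Σ[ y ∈ Carrierᴹ ] A y × x ≈ᴹ y +ᴹ linComb P r (vec b)
        span {x} x∈C (r , u , u∈Q , e) with zeroOrUnit r
        ... | inj₁ r≈0 = spanning b (x∈C , cast (≈ᴹ-sym (≈ᴹ-trans e (≈ᴹ-trans (+ᴹ-congʳ (≈ᴹ-trans (*ₗ-congʳ r≈0) (*ₗ-zeroˡ v))) (+ᴹ-identityˡ u)))) u∈Q)
        ... | inj₂ (r⁻¹ , inv) with lead (r⁻¹ *ₗ u , scale r⁻¹ u∈Q , C.resp (≈ᴹ-trans (*ₗ-congˡ e) (normalise v u inv)) (C.*ₗ-mem r⁻¹ x∈C))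
        ... | w , g , h with spanning b (C.+-mem x∈C (C.*ₗ-mem (-ᴷ r) (A⊆C h)) ,
                  cast (≈ᴹ-sym (≈ᴹ-trans (+ᴹ-congʳ e) (eliminate r v u w))) (plus u∈Q (scale (-ᴷ r) g)))
        ... | r′ , y , y∈A , e′ = r′ , y +ᴹ r *ₗ (v +ᴹ w) , A.+-mem y∈A (A.*ₗ-mem r h) ,
          ≈ᴹ-trans (add-back x r (v +ᴹ w)) (≈ᴹ-trans (+ᴹ-congʳ e′) (≈ᴹ-trans (+ᴹ-assoc _ _ _) (≈ᴹ-trans (+ᴹ-congˡ (+ᴹ-comm _ _)) (≈ᴹ-sym (+ᴹ-assoc _ _ _)))))

    module _ (em : {ℓ : Level} → ExcludedMiddle ℓ) {X : Set} (_<_ : X → X → Set) (<-asym : ∀ {x y} → x < y → ¬ (y < x))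
             (Labels : X → Carrierᴹ → Set q) (unique : ∀ {x v w} → Labels x v → Labels x w → v ≈ᴹ w) where

      Below : X → Carrierᴹ → Set q
      Below x v = Σ[ y ∈ X ] y < x × Labels y v

      LeadingLabel : (S : Carrierᴹ → Set t) → X → Set (c ⊔ a ⊔ ℓ ⊔ t ⊔ q)
      LeadingLabel S x = Σ[ v ∈ Carrierᴹ ] Labels x v × Leading S (Below x) v

      contribution : X → ℕ
      contribution x = indicator em (LeadingLabel C x × ¬ LeadingLabel A x)

      private
        Marked : (X → Set) → Carrierᴹ → Set q
        Marked Done v = Σ[ x ∈ X ] Done x × Labels x v

        module Step (Done : X → Set) {x : X} {L : List X} (x< : All (x <_) L) (below : ∀ {y} → Done y → y < x)
                    (covers : ∀ {y v} → Labels y v → Done y ⊎ y ∈ x ∷ L) where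
          Done⇒Below : ∀ {v} → Marked Done v → Below x v
          Done⇒Below (y , d , l) = y , below d , l

          -- By asymmetry a label below x is neither x nor a later entry of the list, so if it
          -- carries a vector it has already been processed.
          Below⇒Done : ∀ {v} → Below x v → Marked Done v
          Below⇒Done (y , y<x , l) with covers l
          ... | inj₁ d              = y , d , l
          ... | inj₂ (here ≡.refl)  = contradiction y<x (<-asym y<x)
          ... | inj₂ (there y∈)     = contradiction y<x (<-asym (All.lookup x< y∈))

          Done′ : X → Set
          Done′ y = Done y ⊎ y ≡ x

          weaken : ∀ {v} → Marked Done v → Marked Done′ v
          weaken (y , d , l) = y , inj₁ d , l

          leading : {S : Carrierᴹ → Set t} → IsSubspace S → ∀ {v} → Labels x v → LeadingLabel S x → Leading S (Marked Done) v
          leading sub l (v′ , l′ , h) = Leading-map sub Below⇒Done (unique l′ l) h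

          strengthen : ∀ {v} → Labels x v → ∀ {w} → Marked Done′ w → Marked Done w ⊎ w ≈ᴹ v
          strengthen l (y , inj₁ d , l′)      = inj₁ (y , d , l′)
          strengthen l (y , inj₂ ≡.refl , l′) = inj₂ (unique l′ l)

          step : ∀ {n} → RelativeBasis (λ v → C v × ⟨ Marked Done ⟩ v) A n →
                 RelativeBasis (λ v → C v × ⟨ Marked Done′ ⟩ v) A (contribution x + n)
          step {n} b with em {P = LeadingLabel C x × ¬ LeadingLabel A x}
          ... | yes (leadC@(v , l , _) , ¬leadA) = adjoin (x , inj₂ ≡.refl , l) weaken (strengthen l) b (leading subC l leadC)
            (λ h → ¬leadA (v , l , Leading-map subA Done⇒Below ≈ᴹ-refl h))
          ... | no ¬both with em {P = Σ[ v ∈ Carrierᴹ ] Labels x v}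
          ... | no ¬l = RelativeBasis-cong (λ (p , h) → p , span-map weaken h)
            (λ (p , h) → p , span-map (λ { (y , inj₁ d , l) → y , d , l ; (y , inj₂ ≡.refl , l) → contradiction (_ , l) ¬l }) h) b
          ... | yes (v , l) = keep (x , inj₂ ≡.refl , l) weaken (strengthen l) b lead
            where
            lead : Leading C (Marked Done) v → Leading A (Marked Done) v
            lead h with em {P = LeadingLabel A x}
            ... | yes h′ = leading subA l h′
            ... | no ¬h  = contradiction ((v , l , Leading-map subC Done⇒Below ≈ᴹ-refl h) , ¬h) ¬both

        go : (Done : X → Set) (L : List X) {n : ℕ} → AllPairs _<_ L → All (λ x → ∀ {y} → Done y → y < x) L →
             (∀ {y v} → Labels y v → Done y ⊎ y ∈ L) → RelativeBasis (λ v → C v × ⟨ Marked Done ⟩ v) A n →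
             RelativeBasis (λ v → C v × ⟨ (λ w → Σ[ x ∈ X ] Labels x w) ⟩ v) A (sum (map contribution L) + n)
        go Done [] [] [] covers b = RelativeBasis-cong
          (λ (p , h) → p , span-map (λ (y , _ , l) → y , l) h)
          (λ (p , h) → p , span-map (λ (y , l) → y , done l , l) h) b
          where
          done : ∀ {y v} → Labels y v → Done y
          done l with covers l
          ... | inj₁ d = d
        go Done (x ∷ L) {n} (x< ∷ ordered) (below ∷ belows) covers b =
          ≡.subst (RelativeBasis _ A) (assoc (contribution x) (sum (map contribution L)) n)
            (go S.Done′ L ordered
              (All.zipWith (λ { (x<z , bel) (inj₁ d) → bel d ; (x<z , bel) (inj₂ ≡.refl) → x<z }) (x< , belows))
              covers′ (S.step b))
          where
          module S = Step Done x< below covers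
          assoc : ∀ i j k → j + (i + k) ≡ i + j + k
          assoc i j k = ≡.trans (≡.sym (ℕ.+-assoc j i k)) (≡.cong (_+ k) (ℕ.+-comm j i))
          covers′ : ∀ {y v} → Labels y v → S.Done′ y ⊎ y ∈ L
          covers′ l with covers l
          ... | inj₁ d             = inj₁ (inj₁ d)
          ... | inj₂ (here ≡.refl) = inj₁ (inj₂ ≡.refl)
          ... | inj₂ (there y∈)    = inj₂ y∈

      -- With no labels the span is zero and lies in A; with all labels it is everything. In
      -- between, each label changes the rank by its contribution.
      flagBasis : (L : List X) → AllPairs _<_ L → (∀ {x v} → Labels x v → x ∈ L) → (∀ v → ⟨ (λ w → Σ[ x ∈ X ] Labels x w) ⟩ v) →
                  RelativeBasis C A (sum (map contribution L))
      flagBasis L ordered complete spans = ≡.subst (RelativeBasis C A) (ℕ.+-identityʳ _)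
        (RelativeBasis-cong proj₁ (λ {v} p → p , spans v)
          (go (λ _ → ⊥) L ordered (All.universal (λ _ ()) L) (inj₂ ∘ complete)
            (RelativeBasis-trivial (λ (_ , h) → span-least subA (λ ()) h))))

-- Words with gaps

infix 4 _<ˡ_

data _<ˡ_ : Vec ℕ n → Vec ℕ n → Set where
  first : ∀ {t t′} {a b : Vec ℕ n} → t < t′ → t ∷ a <ˡ t′ ∷ b
  later : ∀ {t} {a b : Vec ℕ n} → a <ˡ b → t ∷ a <ˡ t ∷ b

<ˡ-asym : {a b : Vec ℕ n} → a <ˡ b → ¬ (b <ˡ a)
<ˡ-asym (first p) (first q) = <-asym p q
<ˡ-asym (first p) (later q) = <-irrefl refl p
<ˡ-asym (later p) (first q) = <-irrefl refl q
<ˡ-asym (later p) (later q) = <ˡ-asym p q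

-- The effect on the gaps of inserting a letter at position p.
insertGap : ℕ → Vec ℕ n → Vec ℕ n
insertGap p []      = []
insertGap p (t ∷ a) with p ≤? t
... | yes _ = suc t ∷ a
... | no _  = t ∷ insertGap (p ∸ suc t) a

insertGap-≤ : ∀ {p t} (a : Vec ℕ n) → p ≤ t → insertGap p (t ∷ a) ≡ suc t ∷ a
insertGap-≤ {p = p} {t} a p≤t with p ≤? t
... | yes _ = refl
... | no p≰t = contradiction p≤t p≰t

insertGap-> : ∀ p t (a : Vec ℕ n) → insertGap (suc t + p) (t ∷ a) ≡ t ∷ insertGap p a
insertGap-> p t a with suc t + p ≤? t
... | yes q = contradiction q (m+n≮m t p)
... | no _  = cong (λ q → t ∷ insertGap q a) (m+n∸m≡n (suc t) p)

-- At the first gap where the vectors differ, the larger gap takes in every position that the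
-- smaller one does, so an insertion there cannot reverse the comparison.
insertGap-mono : ∀ p {a b : Vec ℕ n} → a <ˡ b → insertGap p a <ˡ insertGap p b
insertGap-mono p (first {t = t} {t′} t<t′) with p ≤? t | p ≤? t′
... | yes _   | yes _   = first (s≤s t<t′)
... | yes p≤t | no p≰t′ = contradiction (≤-trans p≤t (<⇒≤ t<t′)) p≰t′
... | no _    | yes _   = first (m<n⇒m<1+n t<t′)
... | no _    | no _    = first t<t′
insertGap-mono p (later {t = t} a<b) with p ≤? t
... | yes _ = later a<b
... | no _  = later (insertGap-mono (p ∸ suc t) a<b)

-- The number of insertion positions. A gap of t letters has t + 1 of them and so has a word of t
-- letters, so it is applied both to gap vectors and to vectors of word lengths.
wordSize : Vec ℕ n → ℕ
wordSize []      = 0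
wordSize (t ∷ a) = suc t + wordSize a

-- The position chosen is the start of the enlarged gap.
Bump⇒insertGap : {a b : Vec ℕ n} → Bump a b → Σ[ p ∈ ℕ ] p < wordSize a × insertGap p a ≡ b
Bump⇒insertGap {a = t ∷ a} here = 0 , s≤s z≤n , insertGap-≤ a z≤n
Bump⇒insertGap {a = t ∷ a} (there b) with Bump⇒insertGap b
... | p , p< , eq = suc t + p , s≤s (+-monoʳ-< t p<) , trans (insertGap-> p t a) (cong (t ∷_) eq)

module _ {A : Set} where
  ∈-splittings⁺ : ∀ (F : ℕ → ℕ → List A) t k {x} → x ∈ F t k → x ∈ splittings F (suc t + k)
  ∈-splittings⁺ F zero    k x∈ = ∈.∈-++⁺ˡ x∈
  ∈-splittings⁺ F (suc t) k x∈ = ∈.∈-++⁺ʳ (F 0 (suc t + k)) (∈-splittings⁺ (F ∘ suc) t k x∈)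

  ∈-splittings⁻ : ∀ (F : ℕ → ℕ → List A) k {x} → x ∈ splittings F k → Σ[ t ∈ ℕ ] Σ[ k′ ∈ ℕ ] suc t + k′ ≡ k × x ∈ F t k′
  ∈-splittings⁻ F (suc k) x∈ with ∈.∈-++⁻ (F 0 k) x∈
  ... | inj₁ x∈F = 0 , k , refl , x∈F
  ... | inj₂ x∈s with ∈-splittings⁻ (F ∘ suc) k x∈s
  ... | t , k′ , eq , x∈F = suc t , k′ , cong suc eq , x∈F

module _ {D : Set} where
  Fits : {s : ℕ} (ms : List (Maybe D)) → Vec ℕ (length ms) → Vec ℕ s → Set
  Fits []             []      []       = ⊤
  Fits []             []      (k ∷ ks) = ⊥
  Fits (m ∷ ms)       (t ∷ a) []       = ⊥
  Fits (nothing ∷ ms) (t ∷ a) (k ∷ ks) = t ≡ k × Fits ms a ks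
  Fits (just _ ∷ ms)  (t ∷ a) (k ∷ ks) = Σ[ k′ ∈ ℕ ] suc t + k′ ≡ k × Fits ms a (k′ ∷ ks)

  Fits⇒∈ : ∀ {s} ms a (ks : Vec ℕ s) → Fits ms a ks → a ∈ gapVectors ms ks
  Fits⇒∈ []             []      []       f = here refl
  Fits⇒∈ (nothing ∷ ms) (t ∷ a) (k ∷ ks) (refl , f) = ∈.∈-map⁺ (k ∷_) (Fits⇒∈ ms a ks f)
  Fits⇒∈ (just _ ∷ ms)  (t ∷ a) (k ∷ ks) (k′ , refl , f) =
    ∈-splittings⁺ (λ t k′ → map (t ∷_) (gapVectors ms (k′ ∷ ks))) t k′ (∈.∈-map⁺ (t ∷_) (Fits⇒∈ ms a (k′ ∷ ks) f))

  ∈⇒Fits : ∀ {s} ms a (ks : Vec ℕ s) → a ∈ gapVectors ms ks → Fits ms a ks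
  ∈⇒Fits []             []      []       a∈ = tt
  ∈⇒Fits (nothing ∷ ms) (t ∷ a) (k ∷ ks) a∈ with ∈.∈-map⁻ (k ∷_) a∈
  ... | a , a∈′ , refl = refl , ∈⇒Fits ms a ks a∈′
  ∈⇒Fits (just _ ∷ ms)  (t ∷ a) (k ∷ ks) a∈ with ∈-splittings⁻ (λ t k′ → map (t ∷_) (gapVectors ms (k′ ∷ ks))) k a∈
  ... | t , k′ , eq , a∈′ with ∈.∈-map⁻ (t ∷_) a∈′
  ... | a , a∈″ , refl = k′ , eq , ∈⇒Fits ms a (k′ ∷ ks) a∈″

  -- A word's length is the sum of its gaps plus the number of its kept letters. Hence leading gap
  -- vectors can be collected over all subdivisions without recording the lengths.
  Fits-unique : ∀ {s} ms a (ks ks′ : Vec ℕ s) → Fits ms a ks → Fits ms a ks′ → ks ≡ ks′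
  Fits-unique []             []      []       []         f f′ = refl
  Fits-unique (nothing ∷ ms) (t ∷ a) (k ∷ ks) (k′ ∷ ks′) (refl , f) (refl , f′) = cong (t ∷_) (Fits-unique ms a ks ks′ f f′)
  Fits-unique (just _ ∷ ms)  (t ∷ a) (_ ∷ ks) (_ ∷ ks′) (k , refl , f) (k′ , refl , f′) with Fits-unique ms a (k ∷ ks) (k′ ∷ ks′) f f′
  ... | refl = refl

  Fits-wordSize : ∀ {s} ms a (ks : Vec ℕ s) → Fits ms a ks → wordSize a ≡ wordSize ks
  Fits-wordSize []             []      []       f = refl
  Fits-wordSize (nothing ∷ ms) (t ∷ a) (k ∷ ks) (refl , f) = cong (suc t +_) (Fits-wordSize ms a ks f)
  Fits-wordSize (just _ ∷ ms)  (t ∷ a) (_ ∷ ks) (k , refl , f) =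
    trans (cong (suc t +_) (Fits-wordSize ms a (k ∷ ks) f)) (rearrange t k (wordSize ks))
    where
    rearrange : ∀ t k x → suc t + (suc k + x) ≡ suc (suc t + k) + x
    rearrange = solveℕ

  sorted : ∀ {s} (ms : List (Maybe D)) (ks : Vec ℕ s) → AllPairs _<ˡ_ (gapVectors ms ks)
  sorted []             []       = [] ∷ []
  sorted []             (k ∷ ks) = []
  sorted (m ∷ ms)       []       = []
  sorted (nothing ∷ ms) (k ∷ ks) = AllPairs.map⁺ (AllPairs.map later (sorted ms ks))
  sorted (just _ ∷ ms)  (k ∷ ks) = blocks id (λ t → ≤-refl) k
    where
    -- `splittings` recurses on the shifted family `F ∘ suc`, so the first gap of each block is
    -- tracked by a strictly increasing function h.
    blocks-≥ : (h : ℕ → ℕ) → (∀ t → h t < h (suc t)) → ∀ t₀ → t₀ ≤ h 0 → ∀ k →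
               All (λ a → t₀ ≤ Vec.head a) (splittings (λ t k′ → map (h t ∷_) (gapVectors ms (k′ ∷ ks))) k)
    blocks-≥ h inc t₀ ≥t₀ zero    = []
    blocks-≥ h inc t₀ ≥t₀ (suc k) = All.++⁺ (All.map⁺ (All.universal (λ _ → ≥t₀) _))
      (blocks-≥ (h ∘ suc) (inc ∘ suc) t₀ (≤-trans ≥t₀ (<⇒≤ (inc 0))) k)
    blocks : (h : ℕ → ℕ) → (∀ t → h t < h (suc t)) → ∀ k →
             AllPairs _<ˡ_ (splittings (λ t k′ → map (h t ∷_) (gapVectors ms (k′ ∷ ks))) k)
    blocks h inc zero    = []
    blocks h inc (suc k) = AllPairs.++⁺ (AllPairs.map⁺ (AllPairs.map later (sorted ms (k ∷ ks)))) (blocks (h ∘ suc) (inc ∘ suc) k)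
      (All.map⁺ (All.universal (λ a → All.map (λ { {t ∷ b} p → first p }) (blocks-≥ (h ∘ suc) (inc ∘ suc) (suc (h 0)) (inc 0) k)) _))

module _ (D : Set) where
  Code : Set
  Code = Σ[ ms ∈ List (Maybe D) ] Vec ℕ (length ms)

module _ {D : Set} where
  -- Prefixes a collapsed letter. The empty code has no gap to enlarge, but `encodeWord` never
  -- produces it.
  widen : Code D → Code D
  widen ([]     , [])    = [] , []
  widen (m ∷ ms , t ∷ a) = m ∷ ms , suc t ∷ a

  mark : Maybe D → Code D → Code D
  mark m (ms , a) = m ∷ ms , 0 ∷ a

  insertCode : ℕ → Code D → Code D
  insertCode p (ms , a) = ms , insertGap p a

  insertCode-0 : ∀ c → insertCode 0 c ≡ widen c
  insertCode-0 ([]     , [])    = refl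
  insertCode-0 (m ∷ ms , t ∷ a) = cong (m ∷ ms ,_) (insertGap-≤ a z≤n)

  insertCode-widen : ∀ p c → insertCode (suc p) (widen c) ≡ widen (insertCode p c)
  insertCode-widen p ([]     , [])    = refl
  insertCode-widen p (m ∷ ms , t ∷ a) with p ≤? t
  ... | yes p≤t = cong (m ∷ ms ,_) (insertGap-≤ a (s≤s p≤t))
  ... | no p≰t with suc p ≤? suc t
  ... | yes (s≤s p≤t) = contradiction p≤t p≰t
  ... | no _          = refl

  insertCode-mark : ∀ p m c → insertCode (suc p) (mark m c) ≡ mark m (insertCode p c)
  insertCode-mark p m (ms , a) = cong (m ∷ ms ,_) (insertGap-> p 0 a)

  widen-injective : ∀ {c c′} → widen c ≡ widen c′ → c ≡ c′
  widen-injective {[] , []}    {[] , []}     eq   = refl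
  widen-injective {[] , []}    {_ ∷ _ , _ ∷ _} ()
  widen-injective {_ ∷ _ , _ ∷ _} {[] , []}    ()
  widen-injective {_ ∷ _ , _ ∷ _} {_ ∷ _ , _ ∷ _} refl = refl

  widen≢mark : ∀ c {m c′} → widen c ≢ mark m c′
  widen≢mark ([]     , [])    ()
  widen≢mark (m ∷ ms , t ∷ a) ()

  mark-injective : ∀ {m m′ c c′} → mark m c ≡ mark m′ c′ → m ≡ m′ × c ≡ c′
  mark-injective refl = refl , refl

module _ {V D : Set} where
  Word : Set
  Word = List (V ⊎ D)

  -- The vertex to which a collapsed letter is sent is forgotten; for walks `encodeWord-injective`
  -- recovers it.
  encodeWord : Word → Code D → Code D
  encodeWord []           c = mark nothing c
  encodeWord (inj₁ _ ∷ w) c = widen (encodeWord w c)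
  encodeWord (inj₂ d ∷ w) c = mark (just d) (encodeWord w c)

  encode : {s : ℕ} → (Fin s → Word) → Code D
  encode {zero}  b = [] , []
  encode {suc s} b = encodeWord (b zero) (encode (b ∘ suc))

  encode-cong : {s : ℕ} {b b′ : Fin s → Word} → (∀ i → b i ≡ b′ i) → encode b ≡ encode b′
  encode-cong {zero}  e = refl
  encode-cong {suc s} e = cong₂ encodeWord (e zero) (encode-cong (e ∘ suc))

  data Insert : ℕ → Word → Word → Set where
    here  : ∀ {v w} → Insert 0 w (inj₁ v ∷ w)
    there : ∀ {p x w w′} → Insert p w w′ → Insert (suc p) (x ∷ w) (x ∷ w′)

  encodeWord-insert : ∀ {p w w′} → Insert p w w′ → ∀ c → encodeWord w′ c ≡ insertCode p (encodeWord w c)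
  encodeWord-insert {w = w} here c = sym (insertCode-0 (encodeWord w c))
  encodeWord-insert (there {p} {inj₁ v} {w} i) c = trans (cong widen (encodeWord-insert i c)) (sym (insertCode-widen p (encodeWord w c)))
  encodeWord-insert (there {p} {inj₂ d} {w} i) c = trans (cong (mark (just d)) (encodeWord-insert i c)) (sym (insertCode-mark p (just d) (encodeWord w c)))

  encodeWord-later : ∀ p w c → encodeWord w (insertCode p c) ≡ insertCode (suc (length w) + p) (encodeWord w c)
  encodeWord-later p []           c = sym (insertCode-mark p nothing c)
  encodeWord-later p (inj₁ _ ∷ w) c = trans (cong widen (encodeWord-later p w c)) (sym (insertCode-widen _ (encodeWord w c)))
  encodeWord-later p (inj₂ d ∷ w) c = trans (cong (mark (just d)) (encodeWord-later p w c)) (sym (insertCode-mark _ (just d) (encodeWord w c)))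

  record Change {s : ℕ} (j : Fin s) (p : ℕ) (b b′ : Fin s → Word) : Set where
    field
      inserted : Insert p (b j) (b′ j)
      same     : ∀ i → i ≢ j → b′ i ≡ b i

  Fits-encodeWord : ∀ {s} w (c : Code D) (ks : Vec ℕ s) → Fits (proj₁ c) (proj₂ c) ks →
                    Fits (proj₁ (encodeWord w c)) (proj₂ (encodeWord w c)) (length w ∷ ks)
  Fits-encodeWord []           c ks f = refl , f
  Fits-encodeWord (inj₁ _ ∷ w) c ks f = widen-fits (encodeWord w c) (Fits-encodeWord w c ks f)
    where
    widen-fits : ∀ (c : Code D) {k} → Fits (proj₁ c) (proj₂ c) (k ∷ ks) → Fits (proj₁ (widen c)) (proj₂ (widen c)) (suc k ∷ ks)
    widen-fits ([]           , [])    ()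
    widen-fits (nothing ∷ ms , t ∷ a) (refl , f)      = refl , f
    widen-fits (just _ ∷ ms  , t ∷ a) (k′ , refl , f) = k′ , refl , f
  Fits-encodeWord (inj₂ _ ∷ w) c ks f = length w , refl , Fits-encodeWord w c ks f

  Fits-encode : ∀ {s} (b : Fin s → Word) → Fits (proj₁ (encode b)) (proj₂ (encode b)) (Vec.tabulate (length ∘ b))
  Fits-encode {zero}  b = tt
  Fits-encode {suc s} b = Fits-encodeWord (b zero) (encode (b ∘ suc)) _ (Fits-encode (b ∘ suc))

  module _ (start end : V ⊎ D → V) (start-V : ∀ v → start (inj₁ v) ≡ v) where

    data Walk : V → Word → Set where
      []  : ∀ {v} → Walk v []
      _∷_ : ∀ x {w} → Walk (end x) w → Walk (start x) (x ∷ w)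

    -- In a walk a collapsed letter stays at the current vertex, which is known from the starting
    -- vertex and the kept edges passed so far.
    encodeWord-injective : ∀ {v w w′ c c′} → Walk v w → Walk v w′ → encodeWord w c ≡ encodeWord w′ c′ → w ≡ w′ × c ≡ c′
    encodeWord-injective p q eq = go p q refl eq
      where
      -- The indices `start x` of `Walk` are not constructor forms, so the common starting vertex is
      -- supplied as an equation.
      go : ∀ {v v′ w w′ c c′} → Walk v w → Walk v′ w′ → v ≡ v′ → encodeWord w c ≡ encodeWord w′ c′ → w ≡ w′ × c ≡ c′
      go []           []           e eq = refl , proj₂ (mark-injective eq)
      go []           (_∷_ (inj₁ _) {w} p) e eq = contradiction (sym eq) (widen≢mark (encodeWord w _))
      go []           (inj₂ _ ∷ p) e eq with mark-injective eq
      ... | () , _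
      go (_∷_ (inj₁ _) {w} p) []           e eq = contradiction eq (widen≢mark (encodeWord w _))
      go (inj₂ _ ∷ p) []           e eq with mark-injective eq
      ... | () , _
      go (inj₁ u ∷ p) (inj₁ u′ ∷ q) e eq with trans (sym (start-V u)) (trans e (start-V u′))
      ... | refl with go p q refl (widen-injective eq)
      ... | refl , refl = refl , refl
      go (_∷_ (inj₁ _) {w} p) (inj₂ _ ∷ q) e eq = contradiction eq (widen≢mark (encodeWord w _))
      go (inj₂ _ ∷ p) (_∷_ (inj₁ _) {w} q) e eq = contradiction (sym eq) (widen≢mark (encodeWord w _))
      go (inj₂ d ∷ p) (inj₂ d′ ∷ q) e eq with mark-injective eq
      ... | refl , eq′ with go p q refl eq′
      ... | refl , refl = refl , refl

    encode-injective : ∀ {s} {b b′ : Fin s → Word} (v : Fin s → V) → (∀ i → Walk (v i) (b i)) → (∀ i → Walk (v i) (b′ i)) →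
                       encode b ≡ encode b′ → ∀ i → b i ≡ b′ i
    encode-injective v p q eq zero = proj₁ (encodeWord-injective (p zero) (q zero) eq)
    encode-injective v p q eq (suc i) = encode-injective (v ∘ suc) (p ∘ suc) (q ∘ suc) (proj₂ (encodeWord-injective (p zero) (q zero) eq)) i

-- The word and the position in it depend only on the lengths, so that a single contraction realises
-- the insertion for all targets at once.
locate : {s : ℕ} (l : Fin s → ℕ) (p : ℕ) → p < wordSize (Vec.tabulate l) →
         Σ[ j ∈ Fin s ] Σ[ q ∈ ℕ ] q ≤ l j × (∀ {V D : Set} (b b′ : Fin s → List (V ⊎ D)) → (∀ i → length (b i) ≡ l i) → Change j q b b′ → encode b′ ≡ insertCode p (encode b))
locate {suc s} l p p< with p ≤? l zero
... | yes p≤ = zero , p , p≤ , λ b b′ _ ch → trans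
        (cong (encodeWord (b′ zero)) (encode-cong (λ i → Change.same ch (suc i) (λ ()))))
        (encodeWord-insert (Change.inserted ch) (encode (b ∘ suc)))
... | no p≰ with locate (l ∘ suc) (p ∸ suc (l zero)) (+-cancelˡ-< (suc (l zero)) _ _ (subst (_< _) (sym (m+[n∸m]≡n (≰⇒> p≰))) p<))
... | j , q , q≤ , h = suc j , q , q≤ , λ b b′ len ch → trans
        (cong₂ encodeWord (Change.same ch zero (λ ()))
          (h (b ∘ suc) (b′ ∘ suc) (len ∘ suc) (record { inserted = Change.inserted ch ; same = λ i ne → Change.same ch (suc i) (λ { refl → ne refl }) })))
        (trans (encodeWord-later _ (b zero) (encode (b ∘ suc)))
          (cong (λ x → insertCode x (encode b)) (trans (cong (λ x → suc x + (p ∸ suc (l zero))) (len zero)) (m+[n∸m]≡n (≰⇒> p≰)))))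

-- Collapsing an edge of a path

-- A map from a path with n′ to a path with n interior vertices which
-- collapses at most one edge.
data Step : ℕ → ℕ → Set where
  same : ∀ {n} → Step n n
  drop : ∀ {n} → Fin (suc (suc n)) → Step (suc n) n

keptEdge : ∀ {n′ n} → Step n′ n → Fin (suc n) → Fin (suc n′)
keptEdge same     = id
keptEdge (drop p) = punchIn p

pathSrc-map : ∀ {A B : Set} {n} (h : A → B) s (f : Fin n → A) x → h (pathSrc s f x) ≡ pathSrc (h s) (h ∘ f) x
pathSrc-map h s f zero    = refl
pathSrc-map h s f (suc x) = refl

pathTgt-map : ∀ {A B : Set} {n} (h : A → B) (f : Fin n → A) t x → h (pathTgt f t x) ≡ pathTgt (h ∘ f) (h t) x
pathTgt-map {n = zero}  h f t zero    = refl
pathTgt-map {n = suc n} h f t zero    = refl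
pathTgt-map {n = suc n} h f t (suc x) = pathTgt-map h (f ∘ suc) t x

keptVertex : ∀ {n′ n} → Step n′ n → Fin n → Fin n′
keptVertex same j = j
keptVertex (drop zero)            j       = suc j
keptVertex (drop {suc n} (suc p)) zero    = zero
keptVertex (drop {suc n} (suc p)) (suc j) = suc (keptVertex (drop p) j)

SameOrInserted : ∀ {V D : Set} {n′ n} → Step n′ n → List (V ⊎ D) → List (V ⊎ D) → Set
SameOrInserted same     w w′ = w′ ≡ w
SameOrInserted (drop p) w w′ = Insert (toℕ p) w w′

module _ {A : Set} where
  vertexImage : ∀ {n′ n} → Step n′ n → A → (Fin n → A) → A → Fin n′ → A
  vertexImage same                   s f t j       = f j
  vertexImage (drop zero)            s f t j       = pathSrc s f j
  -- For `n = 0` this is `t`: of two edges the second is collapsed, and the only interior vertex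
  -- goes to the far end.
  vertexImage (drop (suc p))         s f t zero    = pathTgt f t zero
  vertexImage (drop {suc n} (suc p)) s f t (suc j) = vertexImage (drop p) (f zero) (f ∘ suc) t j

  edgeImage : ∀ {n′ n} → Step n′ n → A → (Fin n → A) → A → Fin (suc n′) → A ⊎ Fin (suc n)
  edgeImage same                   s f t x       = inj₂ x
  edgeImage (drop zero)            s f t zero    = inj₁ s
  edgeImage (drop zero)            s f t (suc x) = inj₂ x
  edgeImage (drop (suc p))         s f t zero    = inj₂ zero
  edgeImage (drop {zero} (suc p))  s f t (suc x) = inj₁ t
  edgeImage (drop {suc n} (suc p)) s f t (suc x) = map₂ suc (edgeImage (drop p) (f zero) (f ∘ suc) t x)

  startOf endOf : ∀ {n} → A → (Fin n → A) → A → A ⊎ Fin (suc n) → A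
  startOf s f t (inj₁ a) = a
  startOf s f t (inj₂ x) = pathSrc s f x
  endOf s f t (inj₁ a) = a
  endOf s f t (inj₂ x) = pathTgt f t x

  startOf-suc : ∀ {n} s (f : Fin (suc n) → A) t y → startOf s f t (map₂ suc y) ≡ startOf (f zero) (f ∘ suc) t y
  startOf-suc s f t (inj₁ a)       = refl
  startOf-suc s f t (inj₂ zero)    = refl
  startOf-suc s f t (inj₂ (suc x)) = refl

  endOf-suc : ∀ {n} s (f : Fin (suc n) → A) t y → endOf s f t (map₂ suc y) ≡ endOf (f zero) (f ∘ suc) t y
  endOf-suc s f t (inj₁ a) = refl
  endOf-suc s f t (inj₂ x) = refl

  startOf-edgeImage : ∀ {n′ n} (st : Step n′ n) s f t x → startOf s f t (edgeImage st s f t x) ≡ pathSrc s (vertexImage st s f t) x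
  startOf-edgeImage same s f t x = refl
  startOf-edgeImage (drop zero) s f t zero = refl
  startOf-edgeImage (drop zero) s f t (suc x) = refl
  startOf-edgeImage (drop (suc p)) s f t zero = refl
  startOf-edgeImage (drop {zero} (suc p)) s f t (suc zero) = refl
  startOf-edgeImage (drop {suc n} (suc p)) s f t (suc x) = trans (startOf-suc s f t (edgeImage (drop p) (f zero) (f ∘ suc) t x))
    (trans (startOf-edgeImage (drop p) (f zero) (f ∘ suc) t x) (shifted x))
    where
    shifted : ∀ x → pathSrc (f zero) (vertexImage (drop p) (f zero) (f ∘ suc) t) x ≡ vertexImage (drop (suc p)) s f t x
    shifted zero    = refl
    shifted (suc x) = refl

  endOf-edgeImage : ∀ {n′ n} (st : Step n′ n) s f t x → endOf s f t (edgeImage st s f t x) ≡ pathTgt (vertexImage st s f t) t x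
  endOf-edgeImage same s f t x = refl
  endOf-edgeImage (drop zero) s f t zero = refl
  endOf-edgeImage (drop zero) s f t (suc x) = refl
  endOf-edgeImage (drop (suc p)) s f t zero = refl
  endOf-edgeImage (drop {zero} (suc p)) s f t (suc zero) = refl
  endOf-edgeImage (drop {suc n} (suc p)) s f t (suc x) = trans (endOf-suc s f t (edgeImage (drop p) (f zero) (f ∘ suc) t x))
    (endOf-edgeImage (drop p) (f zero) (f ∘ suc) t x)

  edgeImage-keptEdge : ∀ {n′ n} (st : Step n′ n) s f t y → edgeImage st s f t (keptEdge st y) ≡ inj₂ y
  edgeImage-keptEdge same s f t y = refl
  edgeImage-keptEdge (drop zero) s f t y = refl
  edgeImage-keptEdge (drop (suc p)) s f t zero = refl
  edgeImage-keptEdge (drop {suc n} (suc p)) s f t (suc y) = cong (map₂ suc) (edgeImage-keptEdge (drop p) (f zero) (f ∘ suc) t y)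

  vertexImage-keptVertex : ∀ {n′ n} (st : Step n′ n) s f t j → vertexImage st s f t (keptVertex st j) ≡ f j
  vertexImage-keptVertex same s f t j = refl
  vertexImage-keptVertex (drop zero) s f t j = refl
  vertexImage-keptVertex (drop {suc n} (suc p)) s f t zero = refl
  vertexImage-keptVertex (drop {suc n} (suc p)) s f t (suc j) = vertexImage-keptVertex (drop p) (f zero) (f ∘ suc) t j

  map₂-suc⁻ : ∀ {n} (z : A ⊎ Fin n) {y} → map₂ suc z ≡ inj₂ y → Σ[ y′ ∈ Fin n ] z ≡ inj₂ y′ × y ≡ suc y′
  map₂-suc⁻ (inj₂ y′) refl = y′ , refl , refl

  keptEdge-unique : ∀ {n′ n} (st : Step n′ n) s f t x {y} → edgeImage st s f t x ≡ inj₂ y → keptEdge st y ≡ x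
  keptEdge-unique same s f t x refl = refl
  keptEdge-unique (drop zero) s f t (suc x) refl = refl
  keptEdge-unique (drop (suc p)) s f t zero refl = refl
  keptEdge-unique (drop {suc n} (suc p)) s f t (suc x) eq with map₂-suc⁻ (edgeImage (drop p) (f zero) (f ∘ suc) t x) eq
  ... | y′ , eq′ , refl = cong suc (keptEdge-unique (drop p) (f zero) (f ∘ suc) t x eq′)

  -- A vertex equals the chosen preimage of its image or is joined to it by a
  -- collapsed edge.
  module _ {B : Set} (sec : A → B) where
    Joined : ∀ {n′ n} → Step n′ n → A → (Fin n → A) → A → B → (Fin n′ → B) → B → Fin n′ → Set
    Joined st s f t s′ f′ t′ j = (f′ j ≡ sec v) ⊎ Σ[ x ∈ Fin _ ] edgeImage st s f t x ≡ inj₁ v ×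
      ((pathSrc s′ f′ x ≡ f′ j × pathTgt f′ t′ x ≡ sec v) ⊎ (pathSrc s′ f′ x ≡ sec v × pathTgt f′ t′ x ≡ f′ j))
      where v = vertexImage st s f t j

    joined : ∀ {n′ n} (st : Step n′ n) s f t s′ f′ t′ → sec s ≡ s′ → (∀ j → sec (f j) ≡ f′ (keptVertex st j)) → sec t ≡ t′ →
             ∀ j → Joined st s f t s′ f′ t′ j
    joined same s f t s′ f′ t′ es ef et j = inj₁ (sym (ef j))
    joined (drop zero) s f t s′ f′ t′ es ef et zero = inj₂ (zero , refl , inj₂ (sym es , refl))
    joined (drop zero) s f t s′ f′ t′ es ef et (suc j) = inj₁ (sym (ef j))
    joined (drop {zero} (suc zero)) s f t s′ f′ t′ es ef et zero = inj₂ (suc zero , refl , inj₁ (refl , sym et))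
    joined (drop {suc n} (suc p)) s f t s′ f′ t′ es ef et zero = inj₁ (sym (ef zero))
    joined (drop {suc n} (suc p)) s f t s′ f′ t′ es ef et (suc j)
      with joined (drop p) (f zero) (f ∘ suc) t (f′ zero) (f′ ∘ suc) t′ (ef zero) (ef ∘ suc) et j
    ... | inj₁ eq = inj₁ eq
    ... | inj₂ (zero , eq , ends)  = inj₂ (suc zero , cong (map₂ suc) eq , ends)
    ... | inj₂ (suc x , eq , ends) = inj₂ (suc (suc x) , cong (map₂ suc) eq , ends)

  module _ {V D : Set} where
    word-edgeImage : ∀ {n′ n} (st : Step n′ n) s f t (h : A ⊎ Fin (suc n) → V ⊎ D) (g : A → V) → (∀ a → h (inj₁ a) ≡ inj₁ (g a)) →
                     SameOrInserted st (List.tabulate (h ∘ inj₂)) (List.tabulate (h ∘ edgeImage st s f t))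
    word-edgeImage same s f t h g e = refl
    word-edgeImage (drop zero) s f t h g e rewrite e s = here
    word-edgeImage (drop {zero} (suc zero)) s f t h g e rewrite e t = there here
    word-edgeImage (drop {suc n} (suc p)) s f t h g e = there (word-edgeImage (drop p) (f zero) (f ∘ suc) t (h ∘ map₂ suc) g e)

-- Contractions between subdivisions of one graph

module _ (G : Graph) (k′ k : Graph.E G → ℕ) (st : ∀ e → Step (k′ e) (k e)) where
  private
    module G = Graph G
    G′ H : Graph
    G′ = subdivide G k′
    H = subdivide G k
    module G′ = Graph G′
    module H = Graph H

    inner : ∀ e → Fin (k e) → H.V
    inner e j = inj₂ (e , j)

    inner′ : ∀ e → Fin (k′ e) → G′.V
    inner′ e j = inj₂ (e , j)

    vertex : ∀ e → Fin (k′ e) → H.V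
    vertex e = vertexImage (st e) (inj₁ (G.src e)) (inner e) (inj₁ (G.tgt e))

    edge : ∀ e → Fin (suc (k′ e)) → H.V ⊎ Fin (suc (k e))
    edge e = edgeImage (st e) (inj₁ (G.src e)) (inner e) (inj₁ (G.tgt e))

    cell : ∀ e → H.V ⊎ Fin (suc (k e)) → H.Cell
    cell e (inj₁ v) = inj₁ v
    cell e (inj₂ y) = inj₂ ((e , y) , Sign.+)

    onV : G′.V → H.V
    onV (inj₁ v)       = inj₁ v
    onV (inj₂ (e , j)) = vertex e j

    onE-src : ∀ ex → H.start (cell (proj₁ ex) (edge (proj₁ ex) (proj₂ ex))) ≡ onV (G′.src ex)
    onE-src (e , x) = trans (start-cell (edge e x)) (trans (startOf-edgeImage (st e) _ (inner e) _ x)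
      (sym (pathSrc-map onV (inj₁ (G.src e)) (inner′ e) x)))
      where
      start-cell : ∀ y → H.start (cell e y) ≡ startOf (inj₁ (G.src e)) (inner e) (inj₁ (G.tgt e)) y
      start-cell (inj₁ v) = refl
      start-cell (inj₂ y) = refl

    onE-tgt : ∀ ex → H.end (cell (proj₁ ex) (edge (proj₁ ex) (proj₂ ex))) ≡ onV (G′.tgt ex)
    onE-tgt (e , x) = trans (end-cell (edge e x)) (trans (endOf-edgeImage (st e) _ (inner e) _ x)
      (sym (pathTgt-map onV (inner′ e) (inj₁ (G.tgt e)) x)))
      where
      end-cell : ∀ y → H.end (cell e y) ≡ endOf (inj₁ (G.src e)) (inner e) (inj₁ (G.tgt e)) y
      end-cell (inj₁ v) = refl
      end-cell (inj₂ y) = refl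

  stepMorphism : Morphism G′ H
  stepMorphism = record
    { onV     = onV
    ; onE     = λ (e , x) → cell e (edge e x)
    ; onE-src = onE-src
    ; onE-tgt = onE-tgt
    }

  private
    module σ = Morphism stepMorphism

    edgeFibre : ∀ ey → Σ[ ex ∈ G′.E ] σ.MapsOnto ex ey × (∀ {ex′} → σ.MapsOnto ex′ ey → ex ≡ ex′)
    edgeFibre (e , y) = (e , keptEdge (st e) y) , (Sign.+ , cong (cell e) (edgeImage-keptEdge (st e) _ (inner e) _ y)) ,
      λ {(e′ , x)} (s , eq) → unique e′ x (edge e′ x) refl eq
      where
      unique : ∀ e′ x z → edge e′ x ≡ z → ∀ {s} → cell e′ z ≡ inj₂ ((e , y) , s) → (e , keptEdge (st e) y) ≡ (e′ , x)
      unique e′ x (inj₂ y) eq refl = cong (e ,_) (keptEdge-unique (st e) _ (inner e) _ x eq)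

    nonEmpty : ∀ w → ∃ (Subgraph.inV (σ.fibre w))
    nonEmpty (inj₁ v)       = inj₁ v , refl
    nonEmpty (inj₂ (e , j)) = inj₂ (e , keptVertex (st e) j) , vertexImage-keptVertex (st e) _ (inner e) _ j

    module _ (w : H.V) where
      module S = Subgraph (σ.fibre w)

      section : H.V → G′.V
      section (inj₁ v)       = inj₁ v
      section (inj₂ (e , j)) = inj₂ (e , keptVertex (st e) j)

      toSection : ∀ u → onV u ≡ w → EqClosure S.Adjacent u (section w)
      toSection (inj₁ v) refl = ε
      toSection (inj₂ (e , j)) eq
        with joined section (st e) (inj₁ (G.src e)) (inner e) (inj₁ (G.tgt e)) (inj₁ (G.src e)) (inner′ e) (inj₁ (G.tgt e)) refl (λ _ → refl) refl j
      ... | inj₁ eq′ = subst (EqClosure S.Adjacent _) (trans eq′ (cong section eq)) ε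
      ... | inj₂ (x , collapsed , inj₁ (p , q)) =
        fwd ((e , x) , cong (cell e) (trans collapsed (cong inj₁ eq)) , p , trans q (cong section eq)) ◅ ε
      ... | inj₂ (x , collapsed , inj₂ (p , q)) =
        bwd ((e , x) , cong (cell e) (trans collapsed (cong inj₁ eq)) , trans p (cong section eq) , q) ◅ ε

      -- Every path keeps an edge, and a cycle is constant along a path.
      acyclic : (c : G′.E → ℤ) → (∀ v → G′.∂ c v ≡ 0ℤ) → (∀ ex → ¬ S.inE ex → c ex ≡ 0ℤ) → ∀ ex → c ex ≡ 0ℤ
      acyclic c ∂c supp (e , x) = trans (constant-on-path G k′ c ∂c e x)
        (trans (sym (constant-on-path G k′ c ∂c e (keptEdge (st e) zero)))
          (supp (e , keptEdge (st e) zero) λ eq → contradiction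
            (trans (sym (cong (cell e) (edgeImage-keptEdge (st e) _ (inner e) _ zero))) eq) (λ ())))

  stepMorphism-isContraction : σ.IsContraction
  stepMorphism-isContraction = record
    { edgeFibre   = edgeFibre
    ; vertexFibre = λ w → record
      { isConnected = record
        { nonEmpty = nonEmpty w
        ; path     = λ p q → toSection w _ p ◅◅ symmetric (Subgraph.Adjacent (σ.fibre w)) (toSection w _ q)
        }
      ; acyclic = trivial⇒rank-0 (σ.fibre w) (acyclic w)
      }
    }

  module _ {K : Graph} (φ : Morphism H K) where
    private
      module φ = Morphism φ
      module K = Graph K

    word-step : ∀ e → SameOrInserted (st e) (List.tabulate (λ y → φ.onE (e , y)))
                        (List.tabulate (λ x → Morphism.onE (φ ∘ᴹ stepMorphism) (e , x)))
    word-step e = subst (λ w → SameOrInserted (st e) w (List.tabulate (h ∘ edge e))) (List.tabulate-cong (λ y → K.act-+ (φ.onE (e , y))))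
      (word-edgeImage (st e) _ (inner e) _ h φ.onV (λ a → refl))
      where
      h : H.V ⊎ Fin (suc (k e)) → K.Cell
      h = φ.onCell ∘ cell e

-- Codes of contractions

tabulate-injective : ∀ {A : Set} {n} {f g : Fin n → A} → List.tabulate f ≡ List.tabulate g → ∀ i → f i ≡ g i
tabulate-injective {n = suc n} eq zero    = List.∷-injectiveˡ eq
tabulate-injective {n = suc n} eq (suc i) = tabulate-injective (List.∷-injectiveʳ eq) i

lookup-injective : ∀ {A : Set} {xs : List A} → AllPairs _≢_ xs → ∀ {i j} → List.lookup xs i ≡ List.lookup xs j → i ≡ j
lookup-injective (x≢ ∷ _)  {zero}  {zero}  eq = refl
lookup-injective {xs = x ∷ xs} (x≢ ∷ _) {zero}  {suc j} eq = contradiction eq (All.lookup x≢ (∈.∈-lookup j))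
lookup-injective {xs = x ∷ xs} (x≢ ∷ _) {suc i} {zero} eq = contradiction (sym eq) (All.lookup x≢ (∈.∈-lookup i))
lookup-injective (_ ∷ u)   {suc i} {suc j} eq = cong suc (lookup-injective u eq)

unique-length : ∀ {A : Set} (F : Finite A) {xs : List A} → AllPairs _≢_ xs → length xs ≤ Finite.size F
unique-length F {xs} u = Fin.injective⇒≤ {f = to ∘ List.lookup xs} (λ eq → lookup-injective u (to-injective eq))
  where
  open Inverse (Finite.enum F)
  to-injective : ∀ {x y} → to x ≡ to y → x ≡ y
  to-injective {x} {y} eq = trans (sym (strictlyInverseʳ x)) (trans (cong from eq) (strictlyInverseʳ y))

module _ {V E : Set} where
  keptEdges : List (V ⊎ (E × Sign)) → List E
  keptEdges []                 = []
  keptEdges (inj₁ _ ∷ w)       = keptEdges w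
  keptEdges (inj₂ (e , _) ∷ w) = e ∷ keptEdges w

  keptEdges-++ : ∀ w w′ → keptEdges (w ++ w′) ≡ keptEdges w ++ keptEdges w′
  keptEdges-++ []                 w′ = refl
  keptEdges-++ (inj₁ _ ∷ w)       w′ = keptEdges-++ w w′
  keptEdges-++ (inj₂ (e , _) ∷ w) w′ = cong (e ∷_) (keptEdges-++ w w′)

  kept-encodeWord : ∀ w (c : Code (E × Sign)) → kept (proj₁ (encodeWord w c)) ≡ length (keptEdges w) + kept (proj₁ c)
  kept-encodeWord []           c = refl
  kept-encodeWord (inj₁ _ ∷ w) c = trans (kept-widen (encodeWord w c)) (kept-encodeWord w c)
    where
    kept-widen : ∀ c → kept (proj₁ (widen c)) ≡ kept (proj₁ c)
    kept-widen ([]     , [])    = refl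
    kept-widen (m ∷ ms , t ∷ a) = refl
  kept-encodeWord (inj₂ _ ∷ w) c = cong suc (kept-encodeWord w c)

  kept-encode : ∀ {s} (b : Fin s → List (V ⊎ (E × Sign))) → kept (proj₁ (encode b)) ≡ length (keptEdges (concat (List.tabulate b)))
  kept-encode {zero}  b = refl
  kept-encode {suc s} b = trans (kept-encodeWord (b zero) (encode (b ∘ suc)))
    (trans (cong (length (keptEdges (b zero)) +_) (kept-encode (b ∘ suc)))
    (sym (trans (cong length (keptEdges-++ (b zero) _)) (List.length-++ (keptEdges (b zero))))))

  DifferentEdges : V ⊎ (E × Sign) → V ⊎ (E × Sign) → Set
  DifferentEdges x y = ∀ {e s s′} → x ≡ inj₂ (e , s) → y ≢ inj₂ (e , s′)

  keptEdges-unique : ∀ {w} → AllPairs DifferentEdges w → AllPairs _≢_ (keptEdges w)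
  keptEdges-unique [] = []
  keptEdges-unique {inj₁ _ ∷ w} (_ ∷ u) = keptEdges-unique u
  keptEdges-unique {inj₂ (e , s) ∷ w} (d ∷ u) = fresh d ∷ keptEdges-unique u
    where
    fresh : ∀ {w} → All (DifferentEdges (inj₂ (e , s))) w → All (e ≢_) (keptEdges w)
    fresh [] = []
    fresh {inj₁ _ ∷ w}        (_ ∷ ds) = fresh ds
    fresh {inj₂ (e′ , s′) ∷ w} (d ∷ ds) = (λ { refl → d refl refl }) ∷ fresh ds

  -- Each word contributes one end mark. With the bound on kept letters this leaves finitely many
  -- sequences of marks.
  marks-length : ∀ {s} (b : Fin s → List (V ⊎ (E × Sign))) → length (proj₁ (encode b)) ≡ kept (proj₁ (encode b)) + s
  marks-length {zero}  b = refl
  marks-length {suc s} b = word (b zero)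
    where
    rest = encode (b ∘ suc)
    word : ∀ w → length (proj₁ (encodeWord w rest)) ≡ kept (proj₁ (encodeWord w rest)) + suc s
    word []           = trans (cong suc (marks-length (b ∘ suc))) (sym (ℕ.+-suc _ s))
    word (inj₁ _ ∷ w) with encodeWord w rest | word w
    ... | []     , []    | eq = eq
    ... | m ∷ ms , t ∷ a | eq = eq
    word (inj₂ _ ∷ w) = cong suc (word w)

module _ {g : ℕ} (𝐆 : GenusGraph g) where
  private
    module 𝐆 = GenusGraph 𝐆
    module G = Graph 𝐆.graph
    module enumE = Inverse (Finite.enum G.E-finite)
    module enumV = Inverse (Finite.enum G.V-finite)

  subdivided : (G.E → ℕ) → GenusGraph g
  subdivided k = record
    { graph    = subdivide 𝐆.graph k
    ; hasGenus = subdivide-genus 𝐆.graph k 𝐆.hasGenus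
    }

  pathLengths : (G.E → ℕ) → Fin G.#E → ℕ
  pathLengths k i = suc (k (enumE.from i))

  module _ {H : Graph} (k : G.E → ℕ) (φ : Morphism (subdivide 𝐆.graph k) H) where
    private
      module H = Graph H
      module φ = Morphism φ

    word : G.E → List H.Cell
    word e = List.tabulate (λ x → φ.onE (e , x))

    words : Fin G.#E → List H.Cell
    words = word ∘ enumE.from

    vertexTable : List H.V
    vertexTable = List.tabulate (λ v → φ.onV (inj₁ (enumV.from v)))

    code : Code H.DirectedEdge
    code = encode words

    words-length : ∀ i → length (words i) ≡ pathLengths k i
    words-length i = List.length-tabulate (λ x → φ.onE (enumE.from i , x))

    code-fits : Fits (proj₁ code) (proj₂ code) (Vec.tabulate (pathLengths k))
    code-fits = subst (Fits (proj₁ code) (proj₂ code)) (Vec-tabulate-cong words-length) (Fits-encode words)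
      where
      Vec-tabulate-cong : ∀ {n} {f g : Fin n → ℕ} → (∀ i → f i ≡ g i) → Vec.tabulate f ≡ Vec.tabulate g
      Vec-tabulate-cong {zero}  e = refl
      Vec-tabulate-cong {suc n} e = cong₂ _∷_ (e zero) (Vec-tabulate-cong (e ∘ suc))

    -- A contraction has just one edge over each edge of H, so no edge of H occurs twice among the
    -- letters of all words together.
    kept-≤ : φ.IsContraction → kept (proj₁ code) ≤ H.#E
    kept-≤ isC = subst (_≤ H.#E) (sym (kept-encode words)) (unique-length H.E-finite (keptEdges-unique
      (AllPairs.concat⁺
        (All.tabulate⁺ (λ i → AllPairs.tabulate⁺ (λ {x} {y} x≢y →
          different {enumE.from i , x} {enumE.from i , y} (λ { refl → x≢y refl }))))
        (AllPairs.tabulate⁺ (λ {i} {j} i≢j → All.tabulate⁺ (λ x → All.tabulate⁺ (λ y →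
          different {enumE.from i , x} {enumE.from j , y} (λ eq → i≢j (from-injective (cong proj₁ eq))))))))))
      where
      from-injective : ∀ {i j} → enumE.from i ≡ enumE.from j → i ≡ j
      from-injective {i} {j} eq = trans (sym (enumE.strictlyInverseˡ i)) (trans (cong enumE.to eq) (enumE.strictlyInverseˡ j))
      different : ∀ {ex ey} → ex ≢ ey → DifferentEdges (φ.onE ex) (φ.onE ey)
      different ne {e} {s} {s′} p q with φ.IsContraction.edgeFibre isC e
      ... | ez , _ , unique = ne (trans (sym (unique (s , p))) (unique (s′ , q)))

    walk : ∀ e → Walk H.start H.end (λ _ → refl) (φ.onV (inj₁ (G.src e))) (word e)
    walk e = along (φ.onV (inj₁ (G.src e))) (λ j → φ.onV (inj₂ (e , j))) (φ.onV (inj₁ (G.tgt e))) (λ x → φ.onE (e , x))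
      (λ x → trans (φ.onE-src (e , x)) (pathSrc-map φ.onV _ (λ j → inj₂ (e , j)) x))
      (λ x → trans (φ.onE-tgt (e , x)) (pathTgt-map φ.onV (λ j → inj₂ (e , j)) _ x))
      where
      W = Walk H.start H.end (λ _ → refl)
      along : ∀ {n} s (f : Fin n → H.V) t (c : Fin (suc n) → H.Cell) → (∀ x → H.start (c x) ≡ pathSrc s f x) →
              (∀ x → H.end (c x) ≡ pathTgt f t x) → W s (List.tabulate c)
      along {zero}  s f t c p q = subst (λ v → W v _) (p zero) (c zero ∷ [])
      along {suc n} s f t c p q = subst (λ v → W v _) (p zero) (c zero ∷ subst (λ v → W v _) (sym (q zero))
        (along (f zero) (f ∘ suc) t (c ∘ suc) (λ { zero → p (suc zero) ; (suc x) → p (suc (suc x)) }) (q ∘ suc)))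

  module _ {H : Graph} (k : G.E → ℕ) (φ ψ : Morphism (subdivide 𝐆.graph k) H) where
    private
      module H = Graph H
      module φ = Morphism φ
      module ψ = Morphism ψ

    -- The vertex table gives the starting vertex of each walk, after which the code determines its
    -- cells; interior vertices are sources of later edges of their path.
    code-injective : vertexTable k φ ≡ vertexTable k ψ → code k φ ≡ code k ψ → φ ≗ᴹ ψ
    code-injective eqV eqC = record { onV-≗ = onV-≗ ; onE-≗ = λ (e , x) → onE-≗ e x }
      where
      onV-old : ∀ v → φ.onV (inj₁ v) ≡ ψ.onV (inj₁ v)
      onV-old v = subst (λ u → φ.onV (inj₁ u) ≡ ψ.onV (inj₁ u)) (enumV.strictlyInverseʳ v) (tabulate-injective eqV (enumV.to v))
      words-≡ : ∀ i → words k φ i ≡ words k ψ i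
      words-≡ = encode-injective H.start H.end (λ _ → refl) (λ i → φ.onV (inj₁ (G.src (enumE.from i))))
        (walk k φ ∘ enumE.from)
        (λ i → subst (λ v → Walk H.start H.end (λ _ → refl) v (words k ψ i)) (sym (onV-old _)) (walk k ψ (enumE.from i))) eqC
      onE-≗ : ∀ e x → φ.onE (e , x) ≡ ψ.onE (e , x)
      onE-≗ e = tabulate-injective {f = λ x → φ.onE (e , x)} {g = λ x → ψ.onE (e , x)} (subst (λ e → word k φ e ≡ word k ψ e) (enumE.strictlyInverseʳ e) (words-≡ (enumE.to e)))
      onV-≗ : ∀ v → φ.onV v ≡ ψ.onV v
      onV-≗ (inj₁ v)       = onV-old v
      onV-≗ (inj₂ (e , j)) = trans (sym (φ.onE-src (e , suc j))) (trans (cong H.start (onE-≗ e (suc j))) (ψ.onE-src (e , suc j)))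

  stepContraction : (k′ k : G.E → ℕ) → (∀ e → Step (k′ e) (k e)) → Contraction (subdivided k′) (subdivided k)
  stepContraction k′ k st = record
    { morphism      = stepMorphism 𝐆.graph k′ k st
    ; isContraction = stepMorphism-isContraction 𝐆.graph k′ k st
    }

  -- Precomposition keeps the vertex table and the marks and changes the gaps by the same f for
  -- every target, so pulling back along this one contraction moves all labels coherently.
  record ActsBy (f : ∀ {n} → Vec ℕ n → Vec ℕ n) (k′ k : G.E → ℕ) : Set₁ where
    field
      contraction : Contraction (subdivided k′) (subdivided k)
      onVertices  : ∀ {H : Graph} (φ : Morphism (subdivide 𝐆.graph k) H) →
                    vertexTable k′ (φ ∘ᴹ Contraction.morphism contraction) ≡ vertexTable k φ
      onCode      : ∀ {H : Graph} (φ : Morphism (subdivide 𝐆.graph k) H) →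
                    code k′ (φ ∘ᴹ Contraction.morphism contraction) ≡ (proj₁ (code k φ) , f (proj₂ (code k φ)))

  -- Pointwise equal `k′` and `k` need not be equal as functions, so the two subdivisions are
  -- compared by a contraction that collapses nothing.
  reindex : (k′ k : G.E → ℕ) → (∀ e → k′ e ≡ k e) → ActsBy id k′ k
  reindex k′ k k≗ = record
    { contraction = stepContraction k′ k st
    ; onVertices  = λ φ → refl
    ; onCode      = λ φ → encode-cong (λ i → unchanged (k≗ (enumE.from i)) (word-step 𝐆.graph k′ k st φ (enumE.from i)))
    }
    where
    st′ : ∀ {n′ n} → n′ ≡ n → Step n′ n
    st′ refl = same
    st : ∀ e → Step (k′ e) (k e)
    st e = st′ (k≗ e)
    unchanged : ∀ {V D : Set} {n′ n} (eq : n′ ≡ n) {w w′ : List (V ⊎ D)} → SameOrInserted (st′ eq) w w′ → w′ ≡ w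
    unchanged refl p = p

  insertion : (k : G.E → ℕ) (p : ℕ) → p < wordSize (Vec.tabulate (pathLengths k)) → Σ[ k′ ∈ (G.E → ℕ) ] ActsBy (insertGap p) k′ k
  insertion k p p< with locate (pathLengths k) p p<
  ... | j , q , q≤ , located = k′ , record
    { contraction = stepContraction k′ k st
    ; onVertices  = λ φ → refl
    ; onCode      = λ φ → located (words k φ) (words k′ (φ ∘ᴹ stepMorphism 𝐆.graph k′ k st)) (words-length k φ) record
      { inserted = inserted e₀ (e₀ ≟ e₀) refl (word-step 𝐆.graph k′ k st φ e₀)
      ; same     = λ i i≢j → untouched (enumE.from i) (enumE.from i ≟ e₀) (i≢j ∘ from-injective) (word-step 𝐆.graph k′ k st φ (enumE.from i))
      }
    }
    where
    open Finite G.E-finite using (_≟_)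
    e₀ : G.E
    e₀ = enumE.from j
    from-injective : ∀ {i} → enumE.from i ≡ e₀ → i ≡ j
    from-injective {i} eq = trans (sym (enumE.strictlyInverseˡ i)) (trans (cong enumE.to eq) (enumE.strictlyInverseˡ j))
    grow : ∀ {e} → Dec (e ≡ e₀) → ℕ → ℕ
    grow (yes _) n = suc n
    grow (no _)  n = n
    k′ : G.E → ℕ
    k′ e = grow (e ≟ e₀) (k e)
    -- The decision is a parameter, so that its type and `grow` reduce together when it is matched.
    stepAt : ∀ e (d : Dec (e ≡ e₀)) → Step (grow d (k e)) (k e)
    stepAt e (yes refl) = drop (fromℕ< (s≤s q≤))
    stepAt e (no _)     = same
    st : ∀ e → Step (k′ e) (k e)
    st e = stepAt e (e ≟ e₀)
    inserted : ∀ {V D : Set} {w w′ : List (V ⊎ D)} e (d : Dec (e ≡ e₀)) → e ≡ e₀ → SameOrInserted (stepAt e d) w w′ → Insert q w w′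
    inserted e (yes refl) _ i = subst (λ q → Insert q _ _) (Fin.toℕ-fromℕ< (s≤s q≤)) i
    inserted e (no ne)   eq _ = contradiction eq ne
    untouched : ∀ {V D : Set} {w w′ : List (V ⊎ D)} e (d : Dec (e ≡ e₀)) → e ≢ e₀ → SameOrInserted (stepAt e d) w w′ → w′ ≡ w
    untouched e (yes eq) ne _ = contradiction eq ne
    untouched e (no _)   _  i = i

-- Subrepresentations of a finitely generated representation

elements : {A : Set} → Finite A → List A
elements F = List.tabulate (Inverse.from (Finite.enum F))

∈-elements : {A : Set} (F : Finite A) (x : A) → x ∈ elements F
∈-elements F x = subst (_∈ elements F) (Inverse.strictlyInverseʳ (Finite.enum F) x) (∈.∈-tabulate⁺ (Inverse.to (Finite.enum F) x))

listsUpTo : {A : Set} → ℕ → List A → List (List A)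
listsUpTo zero    xs = [] ∷ []
listsUpTo (suc n) xs = [] ∷ cartesianProductWith _∷_ xs (listsUpTo n xs)

∈-listsUpTo : {A : Set} {n : ℕ} {xs : List A} → (∀ x → x ∈ xs) → (w : List A) → length w ≤ n → w ∈ listsUpTo n xs
∈-listsUpTo {n = zero}  h []      z≤n       = here refl
∈-listsUpTo {n = suc n} h []      _         = here refl
∈-listsUpTo {n = suc n} h (x ∷ w) (s≤s len) = there (∈.∈-cartesianProductWith⁺ _∷_ (h x) (∈-listsUpTo h w len))

directedEdges : (H : Graph) → List (Graph.DirectedEdge H)
directedEdges H = cartesianProduct (elements (Graph.E-finite H)) (Sign.+ ∷ Sign.- ∷ [])

∈-directedEdges : (H : Graph) (d : Graph.DirectedEdge H) → d ∈ directedEdges H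
∈-directedEdges H (e , s) = ∈.∈-cartesianProduct⁺ (∈-elements (Graph.E-finite H) e) (∈-signs s)
  where
  ∈-signs : ∀ s → s ∈ Sign.+ ∷ Sign.- ∷ []
  ∈-signs Sign.+ = here refl
  ∈-signs Sign.- = there (here refl)

possibleMarks : (H : Graph) → List (Maybe (Graph.DirectedEdge H))
possibleMarks H = nothing ∷ map just (directedEdges H)

∈-possibleMarks : (H : Graph) (m : Maybe (Graph.DirectedEdge H)) → m ∈ possibleMarks H
∈-possibleMarks H nothing  = here refl
∈-possibleMarks H (just d) = there (∈.∈-map⁺ just (∈-directedEdges H d))

sum-concat-tabulate : {A : Set} {n : ℕ} (f : A → ℕ) (F : Fin n → List A) →
                      sum (map f (concat (List.tabulate F))) ≡ ℕ∑.sum (λ i → sum (map f (F i)))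
sum-concat-tabulate {n = zero}  f F = refl
sum-concat-tabulate {n = suc n} f F = trans (cong sum (List.map-++ f (F zero) _))
  (trans (sum-++ (map f (F zero)) _) (cong (sum (map f (F zero)) +_) (sum-concat-tabulate f (F ∘ suc))))

sum-map-cong : {A : Set} {f g : A → ℕ} {xs : List A} → (∀ {x} → x ∈ xs → f x ≡ g x) → sum (map f xs) ≡ sum (map g xs)
sum-map-cong {xs = []}     h = refl
sum-map-cong {xs = x ∷ xs} h = cong₂ _+_ (h (here refl)) (sum-map-cong (h ∘ there))

EP-sum : {r d n : ℕ} {f : Fin n → (Fin r → ℕ) → ℕ} → (∀ i → EventuallyPolynomial d (f i)) →
         EventuallyPolynomial d (λ m → ℕ∑.sum (λ i → f i m))
EP-sum {n = zero}  F = EP-mono z≤n (EP-const 0)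
EP-sum {n = suc n} F = EP-+ (F zero) (EP-sum (F ∘ suc))

module _ {R : Ring c ℓr} {P : LeftModule R a ℓ} {P′ : LeftModule R p q} where
  private
    module P = LeftModule P
    module P′ = LeftModule P′

  span-image : {f : P.Carrierᴹ → P′.Carrierᴹ} → IsLinear P P′ f → {Q : P.Carrierᴹ → Set s} {Q′ : P′.Carrierᴹ → Set t} →
               (∀ {x} → Q x → Q′ (f x)) → ∀ {x} → ⟨_⟩ P Q x → ⟨_⟩ P′ Q′ (f x)
  span-image {f = f} lin {Q} {Q′} h = span-least P preimage (gen ∘ h)
    where
    open ModuleMorphisms.LeftModuleMorphisms.IsLeftModuleHomomorphism lin
    preimage : IsSubspace P (⟨_⟩ P′ Q′ ∘ f)
    preimage = record
      { resp   = λ x≈y → cast (⟦⟧-cong x≈y)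
      ; 0-mem  = cast (P′.≈ᴹ-sym 0ᴹ-homo) null
      ; +-mem  = λ g h → cast (P′.≈ᴹ-sym (+ᴹ-homo _ _)) (plus g h)
      ; *ₗ-mem = λ r g → cast (P′.≈ᴹ-sym (*ₗ-homo r _)) (scale r g)
      }

module Ambient (em : {ℓ : Level} → ExcludedMiddle ℓ) {R : Ring c ℓr} {g d : ℕ} (P : Rep R g a ℓ) (fg : FinitelyGenerated≤ d P) (𝐆 : GenusGraph g) where
  open FinitelyGenerated≤ fg
  private
    module P = Rep P
    module G = Graph (GenusGraph.graph 𝐆)
    target : Fin size → Graph
    target i = GenusGraph.graph (source i)
    module H (i : Fin size) = Graph (target i)

  Type : Set
  Type = Σ[ i ∈ Fin size ] List (H.V i) × List (Maybe (H.DirectedEdge i))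

  marks : (τ : Type) → List (Maybe (H.DirectedEdge (proj₁ τ)))
  marks (i , _ , ms) = ms

  Gaps : Type → Set
  Gaps τ = Vec ℕ (length (marks τ))

  private
    candidates : (i : Fin size) → List Type
    candidates i = cartesianProductWith (λ vs ms → i , vs , ms)
      (listsUpTo (Finite.size G.V-finite) (elements (H.V-finite i)))
      (listsUpTo (d + G.#E) (possibleMarks (target i)))

  -- The bound on the length of the marks alone would admit `d + #E` kept letters; the filter
  -- restores the bound d, which becomes the bound on the degree.
  types : List Type
  types = filter (λ τ → kept (marks τ) ℕ.≤? d) (concatMap candidates (allFin size))

  types-kept : All (λ τ → kept (marks τ) ≤ d) types
  types-kept = All.all-filter (λ τ → kept (marks τ) ℕ.≤? d) (concatMap candidates (allFin size))

  typeOf : (k : G.E → ℕ) {i : Fin size} → Contraction (subdivided 𝐆 k) (source i) → Type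
  typeOf k {i} φ = i , vertexTable 𝐆 k (Contraction.morphism φ) , proj₁ (code 𝐆 k (Contraction.morphism φ))

  typeOf-∈ : ∀ k {i} (φ : Contraction (subdivided 𝐆 k) (source i)) → typeOf k φ ∈ types
  typeOf-∈ k {i} φ = ∈.∈-filter⁺ (λ τ → kept (marks τ) ℕ.≤? d)
    (∈.∈-concatMap⁺ candidates (Any.map (λ { refl → candidate }) (∈.∈-allFin i)))
    few
    where
    open Contraction φ
    few : kept (proj₁ (code 𝐆 k morphism)) ≤ d
    few = ℕ.≤-trans (kept-≤ 𝐆 k morphism isContraction) (bounded i)
    candidate : typeOf k φ ∈ candidates i
    candidate = ∈.∈-cartesianProductWith⁺ (λ vs ms → i , vs , ms)
      (∈-listsUpTo (∈-elements (H.V-finite i)) (vertexTable 𝐆 k morphism)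
        (ℕ.≤-reflexive (List.length-tabulate (λ v → Morphism.onV morphism (inj₁ (Inverse.from (Finite.enum G.V-finite) v))))))
      (∈-listsUpTo (∈-possibleMarks (target i)) (proj₁ (code 𝐆 k morphism))
        (ℕ.≤-trans (ℕ.≤-reflexive (marks-length (words 𝐆 k morphism))) (ℕ.+-monoˡ-≤ G.#E few)))

  -- A relation rather than a function, since not every gap vector of a type comes from a
  -- contraction; by `labelled-unique` it determines v up to equality.
  Labelled : (k : G.E → ℕ) (τ : Type) → Gaps τ → P.∣ subdivided 𝐆 k ∣ → Set ℓ
  Labelled k (i , vs , ms) a v = Σ[ φ ∈ Contraction (subdivided 𝐆 k) (source i) ]
    vertexTable 𝐆 k (Contraction.morphism φ) ≡ vs × code 𝐆 k (Contraction.morphism φ) ≡ (ms , a) × subdivided 𝐆 k P.⊢ v ≈ P.map φ (generator i)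

  -- Positions in `types` order the types at no cost. A type listed twice is harmless: the vector of
  -- the later copy is already in the span of lower ones, so it is leading for every subspace and
  -- contributes 0.
  Label : Set
  Label = Σ[ t ∈ Fin (length types) ] Gaps (List.lookup types t)

  data _<ᴸ_ : Label → Label → Set where
    first : ∀ {t t′ a b} → t Fin.< t′ → (t , a) <ᴸ (t′ , b)
    later : ∀ {t a b} → a <ˡ b → (t , a) <ᴸ (t , b)

  <ᴸ-asym : ∀ {x y} → x <ᴸ y → ¬ (y <ᴸ x)
  <ᴸ-asym (first p) (first q) = ℕ.<-asym p q
  <ᴸ-asym (first p) (later q) = ℕ.<-irrefl refl p
  <ᴸ-asym (later p) (first q) = ℕ.<-irrefl refl q
  <ᴸ-asym (later p) (later q) = <ˡ-asym p q

  module _ (k : G.E → ℕ) where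
    open LeftModule (P.obj (subdivided 𝐆 k)) using (_≈ᴹ_; ≈ᴹ-refl; ≈ᴹ-sym; ≈ᴹ-trans)

    lengths : Vec ℕ G.#E
    lengths = Vec.tabulate (pathLengths 𝐆 k)

    LabelledBy : Label → P.∣ subdivided 𝐆 k ∣ → Set ℓ
    LabelledBy (t , a) = Labelled k (List.lookup types t) a

    labelled-unique : ∀ {x v w} → LabelledBy x v → LabelledBy x w → v ≈ᴹ w
    labelled-unique {t , a} (φ , vs , cs , e) (ψ , vs′ , cs′ , e′) = ≈ᴹ-trans e (≈ᴹ-trans
      (P.map-cong {φ = φ} {ψ} (code-injective 𝐆 k (Contraction.morphism φ) (Contraction.morphism ψ) (trans vs (sym vs′)) (trans cs (sym cs′))) _)
      (≈ᴹ-sym e′))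

    labelled-fits : ∀ τ {a v} → Labelled k τ a v → Fits (marks τ) a lengths
    labelled-fits (i , vs , ms) (φ , _ , eq , _) = subst (λ (ms , a) → Fits ms a lengths) eq (code-fits 𝐆 k (Contraction.morphism φ))

    labels : List Label
    labels = concat (List.tabulate (λ t → map (t ,_) (gapVectors (marks (List.lookup types t)) lengths)))

    labels-sorted : AllPairs _<ᴸ_ labels
    labels-sorted = AllPairs.concat⁺
      (All.tabulate⁺ (λ t → AllPairs.map⁺ (AllPairs.map later (sorted (marks (List.lookup types t)) lengths))))
      (AllPairs.tabulate⁺-< (λ t<t′ → All.map⁺ (All.universal (λ _ → All.map⁺ (All.universal (λ _ → first t<t′) _)) _)))

    labels-complete : ∀ {x v} → LabelledBy x v → x ∈ labels
    labels-complete {t , a} l = ∈.∈-concat⁺′ (∈.∈-map⁺ (t ,_) (Fits⇒∈ (marks (List.lookup types t)) a lengths (labelled-fits (List.lookup types t) l)))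
      (∈.∈-tabulate⁺ t)

    labels-span : ∀ v → ⟨_⟩ (P.obj (subdivided 𝐆 k)) (λ w → Σ[ x ∈ Label ] LabelledBy x w) v
    labels-span v with generates (subdivided 𝐆 k) v
    ... | n , j , x , e = cast (≈ᴹ-sym e) (linComb-mem _ (span-isSubspace _ _) x (λ i → gen (labelOf (proj₂ (j i)))))
      where
      labelOf : ∀ {i} (φ : Contraction (subdivided 𝐆 k) (source i)) → Σ[ x ∈ Label ] LabelledBy x (P.map φ (generator i))
      labelOf {i} φ with typeOf-∈ k φ
      ... | τ∈ = (Any.index τ∈ , proj₁ l) , proj₂ l
        where
        fromType : ∀ {τ} → typeOf k φ ≡ τ → Σ[ a ∈ Gaps τ ] Labelled k τ a (P.map φ (generator i))
        fromType refl = proj₂ (code 𝐆 k (Contraction.morphism φ)) , φ , refl , refl , ≈ᴹ-refl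
        l = fromType (Any.lookup-index τ∈)

    -- Unfolds to `LeadingLabel` of `Flag`, but is available without fixing the pair of subspaces
    -- compared there.
    LeadingLabelAt : (P.∣ subdivided 𝐆 k ∣ → Set s) → Label → Set _
    LeadingLabelAt S x = Σ[ v ∈ P.∣ subdivided 𝐆 k ∣ ] LabelledBy x v ×
      Leading (P.obj (subdivided 𝐆 k)) S (λ w → Σ[ y ∈ Label ] y <ᴸ x × LabelledBy y w) v

  module _ (S : ∀ G → P.∣ G ∣ → Set s) (stable : ∀ {G G′} (φ : Contraction G G′) {x} → S G′ x → S G (P.map φ x))
           (sub : ∀ G → IsSubspace (P.obj G) (S G)) where

    -- The position of the type is kept and f is monotone, so vectors below the label are pulled
    -- back to vectors below the new label, while stability keeps the pulled back sum in `S`.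
    pullback-leading : ∀ {f : ∀ {n} → Vec ℕ n → Vec ℕ n} (mono : ∀ {n} {a b : Vec ℕ n} → a <ˡ b → f a <ˡ f b) {k′ k} → ActsBy 𝐆 f k′ k →
                       ∀ {t a} → LeadingLabelAt k (S _) (t , a) → LeadingLabelAt k′ (S _) (t , f a)
    pullback-leading {f} mono {k′} {k} acts {t} {a} (v , l , w , w∈ , v+w∈) =
      P.map contraction v , pulled (List.lookup types t) l , P.map contraction w ,
      span-image (P.map-linear contraction) below w∈ ,
      IsSubspace.resp (sub _) (+ᴹ-homo v w) (stable contraction v+w∈)
      where
      open ActsBy acts
      open ModuleMorphisms.LeftModuleMorphisms.IsLeftModuleHomomorphism (P.map-linear contraction) using (+ᴹ-homo; ⟦⟧-cong)
      open LeftModule (P.obj (subdivided 𝐆 k′)) using (≈ᴹ-sym; ≈ᴹ-trans)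
      pulled : ∀ τ {a v} → Labelled k τ a v → Labelled k′ τ (f a) (P.map contraction v)
      pulled (i , vs , ms) {a} {v} (φ , eqV , eqC , e) = φ ∘ᶜ contraction ,
        trans (onVertices (Contraction.morphism φ)) eqV ,
        trans (onCode (Contraction.morphism φ)) (cong (λ (ms , a) → ms , f a) eqC) ,
        ≈ᴹ-trans (⟦⟧-cong e) (≈ᴹ-sym (P.map-∘ φ contraction (generator i)))
      below : ∀ {x} → Σ[ y ∈ Label ] y <ᴸ (t , a) × LabelledBy k y x → Σ[ y ∈ Label ] y <ᴸ (t , f a) × LabelledBy k′ y (P.map contraction x)
      below ((t′ , b) , first t′<t , l) = (t′ , f b) , first t′<t , pulled (List.lookup types t′) l
      below ((t′ , b) , later b<a , l)  = (t′ , f b) , later (mono b<a) , pulled (List.lookup types t′) l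

    -- Since the gaps fix the path lengths, the witness k is determined pointwise; quantifying over
    -- it yields one set of gap vectors for all subdivisions.
    LeadingGaps : (t : Fin (length types)) → Gaps (List.lookup types t) → Set _
    LeadingGaps t a = Σ[ k ∈ (G.E → ℕ) ] LeadingLabelAt k (S _) (t , a)

    LeadingGaps-upset : ∀ t → Upset (LeadingGaps t)
    LeadingGaps-upset t {a} {b} bump (k , lead) = subst (LeadingGaps t) (proj₂ (proj₂ position)) (proj₁ inserted , pulled)
      where
      τ = List.lookup types t
      position : Σ[ p ∈ ℕ ] p < wordSize a × insertGap p a ≡ b
      position = Bump⇒insertGap bump
      i = proj₁ position
      inserted : Σ[ k′ ∈ (G.E → ℕ) ] ActsBy 𝐆 (insertGap i) k′ k
      -- The gap vector and the words have the same number of insertion positions.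
      inserted = insertion 𝐆 k i (subst (i <_) (Fits-wordSize (marks τ) a (lengths k) (labelled-fits k τ (proj₁ (proj₂ lead)))) (proj₁ (proj₂ position)))
      pulled : LeadingLabelAt (proj₁ inserted) (S _) (t , insertGap i a)
      pulled = pullback-leading {f = insertGap i} (insertGap-mono i) {k = k} (proj₂ inserted) {t} {a} lead

    LeadingGaps⇒LeadingLabelAt : ∀ k {t a} → a ∈ gapVectors (marks (List.lookup types t)) (lengths k) → LeadingGaps t a → LeadingLabelAt k (S _) (t , a)
    LeadingGaps⇒LeadingLabelAt k {t} {a} a∈ (k′ , lead) = pullback-leading {f = id} id {k} {k′} (reindex 𝐆 k k′ k≗k′) {t} {a} lead
      where
      τ = List.lookup types t
      same-lengths : lengths k ≡ lengths k′
      same-lengths = Fits-unique (marks τ) a (lengths k) (lengths k′) (∈⇒Fits (marks τ) a (lengths k) a∈) (labelled-fits k′ τ (proj₁ (proj₂ lead)))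
      k≗k′ : ∀ e → k e ≡ k′ e
      k≗k′ e = subst (λ e → k e ≡ k′ e) (Inverse.strictlyInverseʳ (Finite.enum G.E-finite) e)
        (ℕ.suc-injective (Vec-tabulate-injective same-lengths (Inverse.to (Finite.enum G.E-finite) e)))
        where
        Vec-tabulate-injective : ∀ {n} {f g : Fin n → ℕ} → Vec.tabulate f ≡ Vec.tabulate g → ∀ i → f i ≡ g i
        Vec-tabulate-injective {n} {f} {g} eq i = trans (sym (Vec.lookup∘tabulate f i)) (trans (cong (λ v → Vec.lookup v i) eq) (Vec.lookup∘tabulate g i))

  module _ (zeroOrUnit : ∀ r → Ring._≈_ R r (Ring.0# R) ⊎ Σ[ r′ ∈ Ring.Carrier R ] Ring._≈_ R (Ring._*_ R r′ r) (Ring.1# R))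
           {C : ∀ G → P.∣ G ∣ → Set s} {A : ∀ G → P.∣ G ∣ → Set t}
           (stableC : ∀ {G G′} (φ : Contraction G G′) {x} → C G′ x → C G (P.map φ x))
           (stableA : ∀ {G G′} (φ : Contraction G G′) {x} → A G′ x → A G (P.map φ x))
           (subC : ∀ G → IsSubspace (P.obj G) (C G)) (subA : ∀ G → IsSubspace (P.obj G) (A G))
           (A⊆C : ∀ G {x} → A G x → C G x) where

    newLeading : (t : Fin (length types)) → Gaps (List.lookup types t) → ℕ
    newLeading t a = indicator em (LeadingGaps C stableC subC t a × ¬ LeadingGaps A stableA subA t a)

    relativeRank : (G.E → ℕ) → ℕ
    relativeRank k = ℕ∑.sum (λ t → count (marks (List.lookup types t)) (newLeading t) (lengths k))

    relativeBasis : ∀ k → RelativeBasis (P.obj (subdivided 𝐆 k)) (C _) (A _) (relativeRank k)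
    relativeBasis k = subst (RelativeBasis (P.obj (subdivided 𝐆 k)) (C _) (A _))
      (trans (sum-concat-tabulate contribution′ (λ t → map (t ,_) (gapVectors (marks (List.lookup types t)) (lengths k))))
        (ℕ∑.sum-cong-≗ (λ t → trans (cong sum (sym (List.map-∘ (gapVectors (marks (List.lookup types t)) (lengths k)))))
          (sum-map-cong (agree t)))))
      (F.flagBasis em _<ᴸ_ <ᴸ-asym (LabelledBy k) (λ {x} {v} {w} → labelled-unique k {x} {v} {w})
        (labels k) (labels-sorted k) (λ {x} {v} → labels-complete k {x} {v}) (labels-span k))
      where
      module F = Flag (P.obj (subdivided 𝐆 k)) zeroOrUnit (subC _) (subA _) (A⊆C _)
      contribution′ : Label → ℕ
      contribution′ = F.contribution em _<ᴸ_ <ᴸ-asym (LabelledBy k) (λ {x} {v} {w} → labelled-unique k {x} {v} {w})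
      agree : ∀ t {a} → a ∈ gapVectors (marks (List.lookup types t)) (lengths k) → contribution′ (t , a) ≡ newLeading t a
      agree t a∈ = indicator-cong em
        (λ (x , ¬y) → (k , x) , λ y → ¬y (LeadingGaps⇒LeadingLabelAt A stableA subA k a∈ y))
        (λ (x , ¬y) → LeadingGaps⇒LeadingLabelAt C stableC subC k a∈ x , λ y → ¬y (k , y))

    relativeRank-EP : {r : ℕ} (l : (Fin r → ℕ) → G.E → ℕ) →
                      (∀ i c q → EventuallyPolynomial (q ∸ 1) (λ m → β c q (pathLengths 𝐆 (l m) i))) →
                      EventuallyPolynomial d (relativeRank ∘ l)
    relativeRank-EP l h = EP-sum (λ t → EP-mono (All.lookup types-kept (∈.∈-lookup t)) (EP-Quasi (λ i m → pathLengths 𝐆 (l m) i) h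
      (Quasi-count (marks (List.lookup types t)) (newLeading t)
        (Tame-difference em _ _ (LeadingGaps-upset C stableC subC t) (LeadingGaps-upset A stableA subA t)))))

-- Filtrations

module _ {R : Ring c ℓr} (P : LeftModule R a ℓ) (N : LeftModule R a′ ℓ′) where
  open Ring R using (1#) renaming (Carrier to K; -_ to -ᴷ_)
  private
    module R = Ring R
    module P = LeftModule P
    module N = LeftModule N

  record IsLinearRelation (T : P.Carrierᴹ → N.Carrierᴹ → Set t) : Set (c ⊔ a ⊔ a′ ⊔ ℓ ⊔ ℓ′ ⊔ t) where
    field
      resp   : ∀ {x x′ y y′} → x P.≈ᴹ x′ → y N.≈ᴹ y′ → T x y → T x′ y′
      0-rel  : T P.0ᴹ N.0ᴹ
      +-rel  : ∀ {x x′ y y′} → T x y → T x′ y′ → T (x P.+ᴹ x′) (y N.+ᴹ y′)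
      *ₗ-rel : ∀ r {x y} → T x y → T (r P.*ₗ x) (r N.*ₗ y)

    linComb-rel : ∀ {n} (r : Fin n → K) {v w} → (∀ i → T (v i) (w i)) → T (linComb P r v) (linComb N r w)
    linComb-rel {zero}  r h = 0-rel
    linComb-rel {suc n} r h = +-rel (*ₗ-rel (r zero) (h zero)) (linComb-rel (r ∘ suc) (h ∘ suc))

  -- A linear relation T inducing an isomorphism C / A ≅ C′ / A′.
  RelativeBasis-transfer : {T : P.Carrierᴹ → N.Carrierᴹ → Set t} → IsLinearRelation T →
    {C : P.Carrierᴹ → Set p} {A : P.Carrierᴹ → Set q} {C′ : N.Carrierᴹ → Set s} {A′ : N.Carrierᴹ → Set u} → IsSubspace P A →
    (∀ {x} → C x → Σ[ y ∈ N.Carrierᴹ ] C′ y × T x y) → (∀ {y} → C′ y → Σ[ x ∈ P.Carrierᴹ ] C x × T x y) →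
    (∀ {x y} → T x y → A x → A′ y) → (∀ {x y} → T x y → A′ y → A x) →
    ∀ {n} → RelativeBasis P C A n → RelativeBasis N C′ A′ n
  RelativeBasis-transfer {T = T} lin {A = A} {A′ = A′} subA to from A⇒A′ A′⇒A b = record
    { vec         = λ i → proj₁ (to (vec-mem i))
    ; vec-mem     = λ i → proj₁ (proj₂ (to (vec-mem i)))
    ; spanning    = λ {y} y∈ →
        let (x , x∈C , xTy) = from y∈
            (r , z , z∈A , e) = spanning x∈C
            lP = linComb P r vec
            lN = linComb N r (λ i → proj₁ (to (vec-mem i)))
        -- The remainder `y - lN` is related to `x - lP`, which equals z and hence lies in A.
        in r , y N.+ᴹ (-ᴷ 1#) N.*ₗ lN ,
           A⇒A′ (T.+-rel xTy (T.*ₗ-rel (-ᴷ 1#) (related r))) (IsSubspace.resp subA (P.≈ᴹ-sym (P.≈ᴹ-trans (P.+ᴹ-congʳ e) (cancelP z lP))) z∈A) ,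
           N.≈ᴹ-sym (restoreN y lN)
    ; independent = λ r h → independent r (A′⇒A (related r) h)
    }
    where
    open RelativeBasis b
    module T = IsLinearRelation lin
    related : ∀ r → T (linComb P r vec) (linComb N r (λ i → proj₁ (to (vec-mem i))))
    related r = T.linComb-rel r (λ i → proj₂ (proj₂ (to (vec-mem i))))
    cancelP : ∀ x y → (x P.+ᴹ y) P.+ᴹ (-ᴷ 1#) P.*ₗ y P.≈ᴹ x
    cancelP x y = P.≈ᴹ-trans (P.+ᴹ-assoc x y _) (P.≈ᴹ-trans (P.+ᴹ-congˡ (P.≈ᴹ-trans (P.+ᴹ-congʳ (P.≈ᴹ-sym (P.*ₗ-identityˡ y)))
      (P.≈ᴹ-trans (P.≈ᴹ-sym (P.*ₗ-distribʳ y 1# (-ᴷ 1#))) (P.≈ᴹ-trans (P.*ₗ-congʳ (R.-‿inverseʳ 1#)) (P.*ₗ-zeroˡ y))))) (P.+ᴹ-identityʳ x))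
    restoreN : ∀ x y → (x N.+ᴹ (-ᴷ 1#) N.*ₗ y) N.+ᴹ y N.≈ᴹ x
    restoreN x y = N.≈ᴹ-trans (N.+ᴹ-assoc x _ y) (N.≈ᴹ-trans (N.+ᴹ-congˡ (N.≈ᴹ-trans (N.+ᴹ-congˡ (N.≈ᴹ-sym (N.*ₗ-identityˡ y)))
      (N.≈ᴹ-trans (N.≈ᴹ-sym (N.*ₗ-distribʳ y (-ᴷ 1#) 1#)) (N.≈ᴹ-trans (N.*ₗ-congʳ (R.-‿inverseˡ 1#)) (N.*ₗ-zeroˡ y))))) (N.+ᴹ-identityʳ x))

module _ {R : Ring c ℓr} (N : LeftModule R a ℓ) where
  open LeftModule N

  RelativeBasis-chain : {l : ℕ} (S : Fin (suc l) → Carrierᴹ → Set s) → (∀ i → IsSubspace N (S i)) →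
    (∀ i {x} → S (inject₁ i) x → S (suc i) x) → {n : Fin l → ℕ} →
    (∀ i → RelativeBasis N (S (suc i)) (S (inject₁ i)) (n i)) →
    RelativeBasis N (S (fromℕ l)) (S zero) (ℕ∑.sum n)
  RelativeBasis-chain {l = zero}  S sub asc b = RelativeBasis-trivial N id
  RelativeBasis-chain {l = suc l} S sub asc {n} b = ≡.subst (RelativeBasis N _ _) (ℕ.+-comm (ℕ∑.sum (n ∘ suc)) (n zero))
    (RelativeBasis-trans N (sub (suc zero)) (sub zero) (asc zero) (reach (S ∘ suc) (asc ∘ suc))
      (RelativeBasis-chain (S ∘ suc) (sub ∘ suc) (asc ∘ suc) (b ∘ suc)) (b zero))
    where
    reach : ∀ {l} (S : Fin (suc l) → Carrierᴹ → Set _) → (∀ i {x} → S (inject₁ i) x → S (suc i) x) → ∀ {x} → S zero x → S (fromℕ l) x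
    reach {zero}  S asc h = h
    reach {suc l} S asc h = reach (S ∘ suc) (asc ∘ suc) (asc zero h)

  RelativeBasis⇒HasRank : {C : Carrierᴹ → Set p} {A : Carrierᴹ → Set s} → IsSubspace N A → (∀ x → C x) → (∀ {x} → A x → x ≈ᴹ 0ᴹ) →
                          ∀ {n} → RelativeBasis N C A n → HasRank N n
  RelativeBasis⇒HasRank subA all A⇒0 b = vec , record
    { spanning    = λ y → let (r , z , z∈A , e) = spanning (all y) in
        r , ≈ᴹ-trans e (≈ᴹ-trans (+ᴹ-congʳ (A⇒0 z∈A)) (+ᴹ-identityˡ _))
    ; independent = λ r e → independent r (IsSubspace.resp subA (≈ᴹ-sym e) (IsSubspace.0-mem subA))
    }
    where open RelativeBasis b

module _ {c ℓ₁ ℓ₂ : Level} (em : {ℓ : Level} → ExcludedMiddle ℓ) (k : HeytingField c ℓ₁ ℓ₂) where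
  open HeytingField k using (Carrier; _≈_; _#_; 0#; 1#; tight; #⇒invertible) renaming (_*_ to _*ᴷ_)
  private module R = Ring (ringOf k)

  zeroOrUnit : ∀ r → r ≈ 0# ⊎ Σ[ r′ ∈ Carrier ] r′ *ᴷ r ≈ 1#
  zeroOrUnit r with em {P = r # 0#}
  ... | no ¬r#0  = inj₁ (proj₁ (tight r 0#) ¬r#0)
  ... | yes r#0 with #⇒invertible r#0
  ... | r′ , inverse , _ = inj₂ (r′ , R.trans (R.*-congˡ (R.sym r-0≈r)) inverse)
    where
    r-0≈r : r R.- R.0# R.≈ r
    r-0≈r = R.trans (R.+-congˡ (R.trans (R.sym (R.+-identityˡ _)) (R.-‿inverseʳ R.0#))) (R.+-identityʳ r)

-- The part of the ambient module that corresponds to the j-th layer of the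
-- filtration under the isomorphism of B / A with the associated graded module.
module Layer {R : Ring c ℓr} {g d : ℕ} {M : Rep R g a ℓ} (F : Filtration M) (small : IsSmall d (Filtration.gr F)) (j : Fin (Filtration.length F)) where
  open Filtration F renaming (length to #layers)
  open IsSmall small
  private
    module M = Rep M
    module P = Rep ambient
    module B = SubRep B
    module A = SubRep A
    module gr = Rep gr
    module Q = Rep (subquotient B A)
    module θ = _≅_ iso
    module layer (i : Fin #layers) = Rep (subquotient (step (suc i)) (step (inject₁ i)))
    module Mᴹ (G : GenusGraph g) = LeftModule (M.obj G)
    module Pᴹ (G : GenusGraph g) = LeftModule (P.obj G)
    module Qᴹ (G : GenusGraph g) = LeftModule (Q.obj G)
    module grᴹ (G : GenusGraph g) = LeftModule (gr.obj G)
    module layerᴹ (i : Fin #layers) (G : GenusGraph g) = LeftModule (layer.obj i G)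
    module θ-linear (G : GenusGraph g) = ModuleMorphisms.LeftModuleMorphisms.IsLeftModuleIsomorphism (θ.isIso G)

  Concentrated : ∀ G → gr.∣ G ∣ → Set _
  Concentrated G z = ∀ i → i ≢ j → layerᴹ._≈ᴹ_ i G (z i) (layerᴹ.0ᴹ i G)

  -- A relation and not a map: x matters only modulo A, and y only modulo the preceding step of the
  -- filtration, with no preferred representatives.
  Corresponds : ∀ G → P.∣ G ∣ → M.∣ G ∣ → Set _
  Corresponds G x y = Σ[ z ∈ gr.∣ G ∣ ] Concentrated G z × (Σ[ x∈B ∈ B.Mem G x ] G Q.⊢ θ.to G z ≈ (x , x∈B)) × G M.⊢ proj₁ (z j) ≈ y

  private
    Q-trans : ∀ G x y z → G Q.⊢ x ≈ y → G Q.⊢ y ≈ z → G Q.⊢ x ≈ z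
    Q-trans G x y z = Qᴹ.≈ᴹ-trans G {x} {y} {z}

    ~-≈ : ∀ G {x y : P.∣ G ∣} → G P.⊢ x ≈ y → A.Mem G (Pᴹ._+ᴹ_ G x (Pᴹ.-ᴹ_ G y))
    ~-≈ G = quotient-≈ (P.obj G) (A.at G)

  corresponds-isLinear : ∀ G → IsLinearRelation (P.obj G) (M.obj G) (Corresponds G)
  corresponds-isLinear G = record
    { resp   = λ x≈x′ y≈y′ (z , conc , (x∈B , e) , e′) →
        z , conc , (Submodule.resp (B.at G) x≈x′ x∈B , Q-trans G (θ.to G z) (_ , x∈B) (_ , Submodule.resp (B.at G) x≈x′ x∈B) e (~-≈ G x≈x′)) , Mᴹ.≈ᴹ-trans G e′ y≈y′
    ; 0-rel  = grᴹ.0ᴹ G , (λ i _ → layerᴹ.≈ᴹ-refl i G {layerᴹ.0ᴹ i G}) , (Submodule.0-mem (B.at G) , θ-linear.0ᴹ-homo G) , Mᴹ.≈ᴹ-refl G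
    ; +-rel  = λ (z , conc , (x∈B , e) , e₁) (z′ , conc′ , (x′∈B , e′) , e₁′) →
        grᴹ._+ᴹ_ G z z′ ,
        (λ i i≢j → IsSubspace.+-mem (0-isSubspace (layer.obj i G)) {z i} {z′ i} (conc i i≢j) (conc′ i i≢j)) ,
        (Submodule.+-mem (B.at G) x∈B x′∈B ,
          Q-trans G (θ.to G (grᴹ._+ᴹ_ G z z′)) (Qᴹ._+ᴹ_ G (θ.to G z) (θ.to G z′)) (_ , Submodule.+-mem (B.at G) x∈B x′∈B)
            (θ-linear.+ᴹ-homo G z z′) (Qᴹ.+ᴹ-cong G {θ.to G z} {_ , x∈B} {θ.to G z′} {_ , x′∈B} e e′)) ,
        Mᴹ.+ᴹ-cong G e₁ e₁′
    ; *ₗ-rel = λ r (z , conc , (x∈B , e) , e₁) →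
        grᴹ._*ₗ_ G r z ,
        (λ i i≢j → IsSubspace.*ₗ-mem (0-isSubspace (layer.obj i G)) r {z i} (conc i i≢j)) ,
        (Submodule.*ₗ-mem (B.at G) r x∈B ,
          Q-trans G (θ.to G (grᴹ._*ₗ_ G r z)) (Qᴹ._*ₗ_ G r (θ.to G z)) (_ , Submodule.*ₗ-mem (B.at G) r x∈B)
            (θ-linear.*ₗ-homo G r z) (Qᴹ.*ₗ-congˡ G {r} {θ.to G z} {_ , x∈B} e)) ,
        Mᴹ.*ₗ-congˡ G e₁
    }

  corresponds-map : ∀ {G H} (φ : Contraction G H) {x y} → Corresponds H x y → Corresponds G (P.map φ x) (M.map φ y)
  corresponds-map {G} {H} φ (z , conc , (x∈B , e) , e₁) =
    gr.map φ z ,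
    (λ i i≢j → layerᴹ.≈ᴹ-trans i G {layer.map i φ (z i)} {layer.map i φ (layerᴹ.0ᴹ i H)} {layerᴹ.0ᴹ i G}
      (layer-map.⟦⟧-cong i {z i} {layerᴹ.0ᴹ i H} (conc i i≢j)) (layer-map.0ᴹ-homo i)) ,
    (B.map-mem φ x∈B , Q-trans G (θ.to G (gr.map φ z)) (Q.map φ (θ.to H z)) (Q.map φ (_ , x∈B))
      (θ.natural φ z) (Q-map.⟦⟧-cong {θ.to H z} {_ , x∈B} e)) ,
    M-map.⟦⟧-cong e₁
    where
    module layer-map (i : Fin #layers) = ModuleMorphisms.LeftModuleMorphisms.IsLeftModuleHomomorphism (layer.map-linear i φ)
    module Q-map = ModuleMorphisms.LeftModuleMorphisms.IsLeftModuleHomomorphism (Q.map-linear φ)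
    module M-map = ModuleMorphisms.LeftModuleMorphisms.IsLeftModuleHomomorphism (M.map-linear φ)

  Lifts : ∀ G → P.∣ G ∣ → Set _
  Lifts G x = Σ[ y ∈ M.∣ G ∣ ] Corresponds G x y

  lifts-isSubspace : ∀ G → IsSubspace (P.obj G) (Lifts G)
  lifts-isSubspace G = record
    { resp   = λ e (y , h) → y , L.resp e (Mᴹ.≈ᴹ-refl G) h
    ; 0-mem  = _ , L.0-rel
    ; +-mem  = λ (y , h) (y′ , h′) → _ , L.+-rel h h′
    ; *ₗ-mem = λ r (y , h) → _ , L.*ₗ-rel r h
    }
    where module L = IsLinearRelation (corresponds-isLinear G)

  lifts-map : ∀ {G H} (φ : Contraction G H) {x} → Lifts H x → Lifts G (P.map φ x)
  lifts-map φ (y , h) = _ , corresponds-map φ h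

  private
    Mem-0 : ∀ {b m : Level} {N : LeftModule R b m} (S : Submodule N) {x} → Submodule.Mem S x →
            Submodule.Mem S (LeftModule._+ᴹ_ N x (LeftModule.-ᴹ_ N (LeftModule.0ᴹ N)))
    Mem-0 {N = N} S h = Submodule.+-mem S h (neg-mem N S (Submodule.0-mem S))

    Mem-0⁻ : ∀ {b m : Level} {N : LeftModule R b m} (S : Submodule N) {x} →
             Submodule.Mem S (LeftModule._+ᴹ_ N x (LeftModule.-ᴹ_ N (LeftModule.0ᴹ N))) → Submodule.Mem S x
    Mem-0⁻ {N = N} S {x} h = Submodule.resp S
      (≈ᴹ-trans (+ᴹ-assoc x _ _) (≈ᴹ-trans (+ᴹ-congˡ (-ᴹ‿inverseˡ 0ᴹ)) (+ᴹ-identityʳ x))) (Submodule.+-mem S h (Submodule.0-mem S))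
      where open LeftModule N

  A⊆Lifts : ∀ G {x} → A.Mem G x → Lifts G x
  A⊆Lifts G {x} h = _ , grᴹ.0ᴹ G , (λ i _ → layerᴹ.≈ᴹ-refl i G {layerᴹ.0ᴹ i G}) ,
    (A⊆B G h , Q-trans G (θ.to G (grᴹ.0ᴹ G)) (Qᴹ.0ᴹ G) (x , A⊆B G h) (θ-linear.0ᴹ-homo G) (Qᴹ.≈ᴹ-sym G {x , A⊆B G h} {Qᴹ.0ᴹ G} (Mem-0 (A.at G) h))) , Mᴹ.≈ᴹ-refl G

  private
    -- The element y placed in layer j and 0 elsewhere. The decision is a parameter, so that the
    -- component at j is computed by matching on it.
    concentrated : ∀ G → (y : M.∣ G ∣) → SubRep.Mem (step (suc j)) G y → ∀ i → Dec (i ≡ j) → layer.∣_∣ i G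
    concentrated G y y∈ i (yes ≡.refl) = y , y∈
    concentrated G y y∈ i (no _)       = layerᴹ.0ᴹ i G

    concentrated-≢ : ∀ G y y∈ i (d : Dec (i ≡ j)) → i ≢ j → layerᴹ._≈ᴹ_ i G (concentrated G y y∈ i d) (layerᴹ.0ᴹ i G)
    concentrated-≢ G y y∈ i (yes e) i≢j = contradiction e i≢j
    concentrated-≢ G y y∈ i (no _)  i≢j = layerᴹ.≈ᴹ-refl i G {layerᴹ.0ᴹ i G}

    concentrated-≡ : ∀ G y y∈ (d : Dec (j ≡ j)) → proj₁ (concentrated G y y∈ j d) ≡ y
    concentrated-≡ G y y∈ (yes ≡.refl) = ≡.refl
    concentrated-≡ G y y∈ (no ne)      = contradiction ≡.refl ne

  layerBasis : ∀ G {n} → RelativeBasis (P.obj G) (Lifts G) (A.Mem G) n →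
               RelativeBasis (M.obj G) (SubRep.Mem (step (suc j)) G) (SubRep.Mem (step (inject₁ j)) G) n
  layerBasis G = RelativeBasis-transfer (P.obj G) (M.obj G) (corresponds-isLinear G) (Submodule⇒IsSubspace (P.obj G) (A.at G))
    (λ (y , h@(z , _ , _ , e)) → y , Submodule.resp (SubRep.at (step (suc j)) G) e (proj₂ (z j)) , h)
    lift A⇒ ⇒A
    where
    lift : ∀ {y} → SubRep.Mem (step (suc j)) G y → Σ[ x ∈ P.∣ G ∣ ] Lifts G x × Corresponds G x y
    lift {y} y∈ = proj₁ (θ.to G z) , (y , h) , h
      where
      z : gr.∣ G ∣
      z i = concentrated G y y∈ i (i Fin.≟ j)
      h : Corresponds G (proj₁ (θ.to G z)) y
      h = z , (λ i i≢j → concentrated-≢ G y y∈ i (i Fin.≟ j) i≢j) , (proj₂ (θ.to G z) , Qᴹ.≈ᴹ-refl G {θ.to G z}) ,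
        LeftModule.≈ᴹ-reflexive (M.obj G) (concentrated-≡ G y y∈ (j Fin.≟ j))
    -- If x lies in A, then θ sends z to zero, so z is zero by injectivity and its component j lies
    -- in the preceding step.
    A⇒ : ∀ {x y} → Corresponds G x y → A.Mem G x → SubRep.Mem (step (inject₁ j)) G y
    A⇒ {x} (z , conc , (x∈B , e) , e₁) x∈A = Submodule.resp S e₁ (Mem-0⁻ S (z≈0 j))
      where
      S = SubRep.at (step (inject₁ j)) G
      z≈0 : ∀ i → layerᴹ._≈ᴹ_ i G (z i) (layerᴹ.0ᴹ i G)
      z≈0 = θ-linear.injective G {z} {grᴹ.0ᴹ G} (Q-trans G (θ.to G z) (x , x∈B) (θ.to G (grᴹ.0ᴹ G)) e
        (Q-trans G (x , x∈B) (Qᴹ.0ᴹ G) (θ.to G (grᴹ.0ᴹ G)) (Mem-0 (A.at G) x∈A) (Qᴹ.≈ᴹ-sym G {θ.to G (grᴹ.0ᴹ G)} {Qᴹ.0ᴹ G} (θ-linear.0ᴹ-homo G))))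
    -- Concentration matters here: once component j is zero, all of z is, and so is the class of x
    -- modulo A.
    ⇒A : ∀ {x y} → Corresponds G x y → SubRep.Mem (step (inject₁ j)) G y → A.Mem G x
    ⇒A {x} (z , conc , (x∈B , e) , e₁) y∈ = Mem-0⁻ (A.at G)
      (Q-trans G (x , x∈B) (θ.to G z) (Qᴹ.0ᴹ G) (Qᴹ.≈ᴹ-sym G {θ.to G z} {x , x∈B} e)
        (Q-trans G (θ.to G z) (θ.to G (grᴹ.0ᴹ G)) (Qᴹ.0ᴹ G) (θ-linear.⟦⟧-cong G {z} {grᴹ.0ᴹ G} z≈0) (θ-linear.0ᴹ-homo G)))
      where
      S = SubRep.at (step (inject₁ j)) G
      z≈0 : ∀ i → layerᴹ._≈ᴹ_ i G (z i) (layerᴹ.0ᴹ i G)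
      z≈0 i with i Fin.≟ j
      ... | yes ≡.refl = Mem-0 S (Submodule.resp S (Mᴹ.≈ᴹ-sym G e₁) y∈)
      ... | no i≢j     = conc i i≢j

-- Path lengths in the subdivision and the sum over the layers

module _ {g : ℕ} (𝐆 : GenusGraph g) {r : ℕ} (e⃗ : NonLoopTuple 𝐆 r) where
  private module G = Graph (GenusGraph.graph 𝐆)

  -- Whether e occurs in the tuple, and at which index, is settled before m is chosen, so the same
  -- variable serves for all m.
  interiorVertices-view : ∀ e → (Σ[ i ∈ Fin r ] (∀ m → interiorVertices 𝐆 e⃗ m e ≡ ℕ.pred (m i))) ⊎ (∀ m → interiorVertices 𝐆 e⃗ m e ≡ 0)
  interiorVertices-view e with Fin.any? (λ i → Finite._≟_ G.E-finite (proj₁ (NonLoopTuple.edge e⃗ i)) e)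
  ... | yes (i , _) = inj₁ (i , λ m → ≡.refl)
  ... | no _        = inj₂ (λ m → ≡.refl)

  EP-β-pathLengths : ∀ i c q → EventuallyPolynomial (q ∸ 1) (λ m → β c q (pathLengths 𝐆 (interiorVertices 𝐆 e⃗ m) i))
  EP-β-pathLengths i c q with interiorVertices-view (Inverse.from (Finite.enum G.E-finite) i)
  -- Positivity of `m i′` turns `suc (pred (m i′))` back into `m i′`.
  ... | inj₁ (i′ , h) = EP-cong 0 (λ m pos _ → ≡.cong (β c q) (≡.sym (≡.trans (≡.cong suc (h m)) (ℕ.suc-pred (m i′) {{ℕ.>-nonZero (pos i′)}})))) (EP-β i′ c q)
  -- An edge outside the tuple remains a path of one edge, which explains the constant `β c q 1`.
  ... | inj₂ h        = EP-cong 0 (λ m _ _ → ≡.cong (β c q) (≡.cong suc (≡.sym (h m)))) (EP-mono z≤n (EP-const (β c q 1)))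

corollary4p5 :
    ({ℓ : Level} → ExcludedMiddle ℓ) →
    {c ℓ₁ ℓ₂ a ℓ : Level} (k : HeytingField c ℓ₁ ℓ₂) (g d : ℕ)
    (M : Rep (ringOf k) g a ℓ) → IsSmallish d M →
    (G : GenusGraph g) (r : ℕ) (e⃗ : NonLoopTuple G r) →
    Σ[ f ∈ Polynomial r ] TotalDegree≤ d f ×
      (Σ[ N ∈ ℕ ] ((m : Fin r → ℕ) → (∀ i → 0 < m i) → (∀ i → N ≤ m i) →
        Σ[ n ∈ ℕ ] HasRank (Rep.obj M (subdivision G e⃗ m)) n × fromℕ-ℚ n ≡ eval f (fromℕ-ℚ ∘ m)))
corollary4p5 em k g d M (F , small) G r e⃗ =
  polynomial , degree≤ , threshold , λ m pos large → dimension m , rank m , agrees m pos large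
  where
  open Filtration F renaming (length to #layers)
  open IsSmall small
  module X = Ambient em ambient ambient≤ G
  module L (j : Fin #layers) = Layer F small j
  layerRank : Fin #layers → (Graph.E (GenusGraph.graph G) → ℕ) → ℕ
  layerRank j = X.relativeRank (zeroOrUnit em k) (L.lifts-map j) (SubRep.map-mem A) (L.lifts-isSubspace j)
    (λ H → Submodule⇒IsSubspace (Rep.obj ambient H) (SubRep.at A H)) (L.A⊆Lifts j)
  dimension : (Fin r → ℕ) → ℕ
  dimension m = ℕ∑.sum (λ j → layerRank j (interiorVertices G e⃗ m))
  open EventuallyPolynomial (EP-sum {f = λ j m → layerRank j (interiorVertices G e⃗ m)} (λ j →
    X.relativeRank-EP (zeroOrUnit em k) (L.lifts-map j) (SubRep.map-mem A) (L.lifts-isSubspace j)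
      (λ H → Submodule⇒IsSubspace (Rep.obj ambient H) (SubRep.at A H)) (L.A⊆Lifts j) (interiorVertices G e⃗) (EP-β-pathLengths G e⃗)))
  rank : ∀ m → HasRank (Rep.obj M (subdivision G e⃗ m)) (dimension m)
  -- The layer bases concatenate to a basis of the top step modulo the bottom one; `top` and
  -- `bottom` identify these with everything and with zero.
  rank m = RelativeBasis⇒HasRank N (isSub zero) (top S) (bottom S _)
    (RelativeBasis-chain N (λ i → SubRep.Mem (step i) S) isSub (λ i → ascending i S) (λ j →
      L.layerBasis j S (X.relativeBasis (zeroOrUnit em k) (L.lifts-map j) (SubRep.map-mem A) (L.lifts-isSubspace j)
        (λ H → Submodule⇒IsSubspace (Rep.obj ambient H) (SubRep.at A H)) (L.A⊆Lifts j) (interiorVertices G e⃗ m))))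
    where
    S = subdivision G e⃗ m
    N = Rep.obj M S
    isSub : ∀ i → IsSubspace N (SubRep.Mem (step i) S)
    isSub i = Submodule⇒IsSubspace N (SubRep.at (step i) S)
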